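{- For positive integers $n>d\geq k$, let $\phi(n,d,k)$ denote the smallest integer $\phi$ such that every graph on $n$ vertices having at least $\phi$ vertices of degree at least $d$ contains a path on $k+1$ vertices. Then for all positive integers $n,d,k$ with $n>d\geq k$ the following hold. (i) If $k$ is odd, then $\phi(n,d,k)=\frac{k-1}{2}q+1$, where $n=q(d+1)+r$ with integers $q$ and $0\leq r\leq d$. (ii) If $k$ is even, then: (a) if $k=2$, then $\phi(n,d,2)=1$; (b) if $k=4$, write $n=2qd+r$ with integers $q$ and $0\leq r<2d$; then $\phi(n,d,4)=2q+1$ if $0\leq r\leq d$, and $\phi(n,d,4)=2q+2$ if $d<r<2d$; (c) if $k\geq 6$, write $n=q(d+1)+r$ with integers $q$ and $0\leq r\leq d$; then $\phi(n,d,k)=\frac{k-2}{2}q+1$ if $0\leq r\leq d-\frac{k}{2}$, and $\phi(n,d,k)=\frac{k-2}{2}q+2$ if $d-\frac{k}{2}<r\leq d$.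
   Context: All graphs are finite and simple. "Contains a path on $k+1$ vertices" means has a (not necessarily induced) subgraph isomorphic to the path $P_{k+1}$ with $k+1$ vertices. -}

module Defs where

open import Data.Nat using (ℕ; zero; suc; _+_; _*_; _≤_; _≤?_; _<_)
open import Data.Bool using (Bool; true; false; if_then_else_)
open import Data.Fin using (Fin; inject₁) renaming (suc to fsuc)
open import Data.List using (List; length; filter; map; allFin)
open import Data.Nat.ListAction using (sum)
open import Data.Product using (Σ; _×_)
open import Function.Definitions using (Injective)
open import Relation.Binary.PropositionalEquality using (_≡_)
open import Relation.Nullary using (¬_)

record Graph (n : ℕ) : Set where
  field
    adj   : Fin n → Fin n → Bool
    sym   : ∀ i j → adj i j ≡ adj j i
    irrefl : ∀ i → adj i i ≡ false
open Graph public

degree : ∀ {n} → Graph n → Fin n → ℕ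
degree {n} G i = sum (map (λ j → if adj G i j then 1 else 0) (allFin n))

numHighDeg : ∀ {n} → Graph n → ℕ → ℕ
numHighDeg {n} G d = length (filter (λ i → d ≤? degree G i) (allFin n))

ContainsPathOn : ∀ {n} → Graph n → (k : ℕ) → Set
ContainsPathOn {n} G k =
  Σ (Fin (suc k) → Fin n) λ f →
    Injective _≡_ _≡_ f × (∀ (i : Fin k) → adj G (f (inject₁ i)) (f (fsuc i)) ≡ true)

Forces : ℕ → ℕ → ℕ → ℕ → Set
Forces n d k φ = (G : Graph n) → φ ≤ numHighDeg G d → ContainsPathOn G k

IsPhi : ℕ → ℕ → ℕ → ℕ → Set
IsPhi n d k m = Forces n d k m × (∀ m′ → m′ < m → ¬ Forces n d k m′)

{-# OPTIONS --safe #-}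
module Submission where

-- Upper bound.  Call a vertex of degree at least d high, and suppose there is no path on k + 1
-- vertices, where k = 2t + 1 or k = 2t + 2.  It suffices to find a large set S such that few high
-- vertices lie in S or have a neighbour in S: deleting S does not change the degree of any other
-- high vertex, so one can induct.  The right exchange rates are t high vertices for d + 1 vertices
-- and, for even k only, t + 1 high vertices for 2d + 1 - t vertices.
--
-- Take a path x … y with high ends that contains as many high vertices as possible (the set M)
-- and is as long as possible subject to that.  If no cycle contains M, then S = N(x) ∪ N(y) minus
-- the path works: x and y have few neighbours on the path by a crossing argument, and each vertex
-- of M adjacent to S is preceded or followed on the path by its own low vertex.  (For even k there
-- is one tight case, in which the vertices that can become ends by a rotation are added to S.)
-- If a cycle contains M, then no high vertex outside M is adjacent to M ∪ N(M) =: S, and one needs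
-- a lower bound for |S|.  Cover some X ⊆ M by as few disjoint alternating X–(S∖X) paths, all with
-- ends in X, as possible.  If |S| ≤ 2d + 1, Ore's argument glues these f runs together to a long path,
-- so f is large; on the other hand, minimality of f makes the sets of unused neighbours
-- of many vertices disjoint, so that |S∖X| ≥ f (d + 1 - |X|).
--
-- Lower bound.  Disjoint unions of t hubs joined to everything else in a block of d + 1 vertices
-- and, for even k, of the block in which a further vertex with d - t private leaves is joined to the hubs.
--
-- Existence of a path is decidable, so all of the upper bound is argued by contradiction with
-- goal ⊥, where the excluded middle and extremal choices are available.

open import Defs using (Graph; adj; irrefl; degree; numHighDeg; ContainsPathOn; Forces; IsPhi)
import Algebra.Solver.CommutativeMonoid as CMSolver
open import Data.Bool using (Bool; true; false; if_then_else_)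
open import Data.Bool.Properties using () renaming (_≟_ to _≟ᵇ_)
open import Data.Empty using (⊥; ⊥-elim)
open import Data.Fin using (Fin; zero; suc; inject₁; splitAt; _↑ˡ_; _↑ʳ_)
open import Data.Fin.Properties using (splitAt-↑ˡ; splitAt-↑ʳ; splitAt⁻¹-↑ˡ; splitAt⁻¹-↑ʳ; ↑ˡ-injective; ↑ʳ-injective)
open import Data.Fin.Properties using () renaming (_≟_ to _≟ᶠ_; any? to anyᶠ?; all? to allᶠ?)
open import Data.List using (List; []; _∷_; [_]; _++_; length; filter; map; reverse; concat; allFin; take) renaming (tabulate to tabulateˡ)
open import Data.List.Membership.Propositional using (_∈_; _∉_; find; lose)
open import Data.List.Membership.Propositional.Properties using (∈-++⁺ˡ; ∈-++⁺ʳ; ∈-++⁻; ∈-filter⁺; ∈-filter⁻; ∈-∃++; ∈-concat⁻′; ∈-concat⁺′; ∈-map⁺; ∈-map⁻; ∈-allFin)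
open import Data.List.Properties using (length-++; length-map; length-filter; length-take; length-tabulate; unfold-reverse; concat-++; map-++; ++-assoc; ++-identityʳ)
open import Data.List.Properties using (∷-injectiveˡ; ∷-injectiveʳ; filter-accept; filter-reject; filter-notAll; filter-≐)
open import Data.List.Relation.Binary.Permutation.Propositional using (_↭_; prep; swap; ↭-refl; ↭-reflexive; ↭-sym; ↭-trans; ↭⇒↭ₛ)
open import Data.List.Relation.Binary.Permutation.Propositional.Properties using (∈-resp-↭; ↭-length; ++⁺; ++⁺ˡ; ++⁺ʳ; ++-comm; ++-commutativeMonoid; ↭-reverse; shift; shifts; ∷↭∷ʳ)
import Data.List.Relation.Binary.Permutation.Setoid.Properties as PermS
open import Data.List.Relation.Unary.All using (All; []; _∷_; tabulate; lookup)
open import Data.List.Relation.Unary.All.Properties using (¬Any⇒All¬)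
open import Data.List.Relation.Unary.AllPairs using (AllPairs; []; _∷_)
open import Data.List.Relation.Unary.Any using (Any; here; there; any?) renaming (map to Any-map)
open import Data.List.Relation.Unary.Unique.Propositional using (Unique)
open import Data.List.Relation.Unary.Unique.Propositional.Properties using (allFin⁺; tabulate⁺) renaming (filter⁺ to unique-filter; map⁺ to unique-map; map⁻ to unique-map⁻; ++⁺ to unique-disjoint-++; Unique[x∷xs]⇒x∉xs to head-∉)
open import Data.Nat using (ℕ; zero; suc; _+_; _*_; _∸_; _≤_; _<_; z≤n; s≤s; _≤?_)
open import Data.Nat.ListAction using (sum)
open import Data.Nat.Properties
open import Data.Nat.Tactic.RingSolver using (solve-∀)
open import Data.Product using (Σ; ∃-syntax; _×_; _,_; proj₁; proj₂)
open import Data.Sum using (_⊎_; inj₁; inj₂; [_,_]′)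
open import Data.Sum.Properties using (inj₁-injective; inj₂-injective)
open import Data.Vec using (Vec; []; _∷_) renaming (lookup to lookupᵛ)
open import Function using (_∘_; case_of_)
open import Relation.Binary.PropositionalEquality using (_≡_; _≢_; refl; sym; trans; cong; cong₂; subst; setoid)
open import Relation.Nullary using (¬_; Dec; yes; no; ¬?)
open import Relation.Nullary.Decidable using (_⊎-dec_; _×-dec_; _→-dec_; decidable-stable) renaming (map′ to mapDec)
open import Relation.Unary using (Decidable)

-- Finite combinatorics of lists

-- The exchange rates are read off the two extremal blocks: the one with t hubs has d + 1 vertices,
-- and the one with a further centre has t + 1 + 2 (d - t) = 2d + 1 - t. The induction deletes `S`
-- but only demotes `T`: a vertex of `T` outside `S` stays in the graph as an ordinary vertex. Hence
-- "high" cannot mean "of degree at least d", and the argument runs for an arbitrary set `H` of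
-- vertices with that degree bound. The cycle case is the obstacle: all of `M` is given up, possibly
-- more than t vertices, and one closed neighbourhood may be too small a price. What forces the
-- number f of runs up is length. A cover of X by f runs has at least 2|X| - f vertices, and the
-- glued path has high ends, hence at most k - 2 vertices; so f ≥ 2|X| + 2 - k. Taking |X| = t + 1
-- gives f ≥ 3 for odd k and f ≥ 2 for even k; taking |X| = t + 2 gives f ≥ 4 for even k.

em : {P : Set} → ¬ ¬ Dec P
em k = k (no λ p → k (yes p))

-- Makes an arbitrary predicate on `Fin n` available to `filter` inside a proof of `⊥`.
decide : ∀ {n} (P : Fin n → Set) → ¬ ¬ Decidable P
decide {zero}  P k = k λ ()
decide {suc n} P k = em λ p₀ → decide (λ i → P (suc i)) λ p → k λ { zero → p₀ ; (suc i) → p i }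

maximum : (P : ℕ → Set) (bound : ℕ) → (∀ m → P m → m ≤ bound) → ∀ m → P m →
          ¬ ¬ (∃[ M ] P M × (∀ m′ → P m′ → m′ ≤ M))
maximum P bound ub m p k = go (suc bound) m p (≤-trans (n≤1+n bound) (m≤n+m (suc bound) m))
  where
  -- `gap` bounds how far `m` can still rise; each failure of maximality raises `m` and uses up one
  -- unit.
  go : ∀ gap m → P m → bound ≤ m + gap → ⊥
  go zero m p le = k (m , p , λ m′ p′ → ≤-trans (ub m′ p′) (subst (bound ≤_) (+-identityʳ m) le))
  go (suc gap) m p le = k (m , p , λ m′ p′ → ≮⇒≥ λ m<m′ →
    go gap m′ p′ (≤-trans le (≤-trans (≤-reflexive (+-suc m gap)) (+-monoˡ-≤ gap m<m′))))

minimum : (P : ℕ → Set) → ∀ m → P m → ¬ ¬ (∃[ M ] P M × (∀ m′ → P m′ → M ≤ m′))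
minimum P m p k = go (suc m) m p ≤-refl
  where
  go : ∀ fuel m → P m → m < fuel → ⊥
  go (suc fuel) m p (s≤s le) = k (m , p , λ m′ p′ → ≮⇒≥ λ m′<m → go fuel m′ p′ (<-≤-trans m′<m le))

∈-unmid : ∀ {A : Set} {b c : A} as {bs} → c ∈ as ++ b ∷ bs → c ≢ b → c ∈ as ++ bs
∈-unmid [] (here eq) ne = ⊥-elim (ne eq)
∈-unmid [] (there p) ne = p
∈-unmid (a ∷ as) (here eq) ne = here eq
∈-unmid (a ∷ as) (there p) ne = there (∈-unmid as p ne)

length-mid : ∀ {A : Set} (as : List A) {b bs} → length (as ++ b ∷ bs) ≡ suc (length (as ++ bs))
length-mid [] = refl
length-mid (a ∷ as) = cong suc (length-mid as)

module _ {A : Set} where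
  private variable
    a : A
    as bs : List A

  tail-unique : Unique (a ∷ as) → Unique as
  tail-unique (_ ∷ u) = u

  infixr 5 _∷ᵘ_
  _∷ᵘ_ : a ∉ as → Unique as → Unique (a ∷ as)
  p ∷ᵘ u = ¬Any⇒All¬ _ p ∷ u

  -- The pigeonhole principle for a relation instead of a function: in most uses the image of `a` is
  -- found by a case distinction, and the constructor of `R` remembers which case occurred.
  length-inj : {B : Set} {bs : List B} (R : A → B → Set) → Unique as →
               (∀ {a} → a ∈ as → ∃[ b ] b ∈ bs × R a b) →
               (∀ {a a′ b} → a ∈ as → a′ ∈ as → R a b → R a′ b → a ≡ a′) →
               length as ≤ length bs
  length-inj {as = []} R u f inj = z≤n
  length-inj {as = a ∷ as} R u f inj with f (here refl)
  ... | b , b∈ , rab with ∈-∃++ b∈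
  ... | bs₁ , bs₂ , refl = subst (suc (length as) ≤_) (sym (length-mid bs₁))
    (s≤s (length-inj R (tail-unique u) f′ (λ p q → inj (there p) (there q))))
    where
    f′ : ∀ {a′} → a′ ∈ as → ∃[ b′ ] b′ ∈ bs₁ ++ bs₂ × R a′ b′
    f′ {a′} a′∈ with f (there a′∈)
    ... | b′ , b′∈ , r = b′ , ∈-unmid bs₁ b′∈
          (λ { refl → head-∉ u (subst (_∈ as) (inj (there a′∈) (here refl) r rab) a′∈) }) , r

  length-⊆ : Unique as → (∀ {a} → a ∈ as → a ∈ bs) → length as ≤ length bs
  length-⊆ u sub = length-inj _≡_ u (λ {a} p → a , sub p , refl) (λ _ _ p q → trans p (sym q))

  unique-++ : Unique as → Unique bs → (∀ {a} → a ∈ as → a ∉ bs) → Unique (as ++ bs)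
  unique-++ u v dis = unique-disjoint-++ u v λ (p , q) → dis p q

  unique-++ˡ : ∀ as → Unique (as ++ bs) → Unique as
  unique-++ˡ [] u = []
  unique-++ˡ (a ∷ as) u = (head-∉ u ∘ ∈-++⁺ˡ) ∷ᵘ unique-++ˡ as (tail-unique u)

  unique-++ʳ : ∀ as → Unique (as ++ bs) → Unique bs
  unique-++ʳ [] u = u
  unique-++ʳ (a ∷ as) u = unique-++ʳ as (tail-unique u)

  unique-disjoint : ∀ as → Unique (as ++ bs) → a ∈ as → a ∉ bs
  unique-disjoint (a ∷ as) u (here refl) q = head-∉ u (∈-++⁺ʳ as q)
  unique-disjoint (a ∷ as) u (there p) q = unique-disjoint as (tail-unique u) p q

  unique-↭ : as ↭ bs → Unique as → Unique bs
  unique-↭ p = PermS.Unique-resp-↭ (setoid _) (↭⇒↭ₛ p)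

  filter-split : {P : A → Set} (P? : Decidable P) → ∀ as → length (filter P? as) + length (filter (¬? ∘ P?) as) ≡ length as
  filter-split P? [] = refl
  filter-split P? (a ∷ as) with P? a
  ... | yes _ = cong suc (filter-split P? as)
  ... | no  _ = trans (+-suc _ _) (cong suc (filter-split P? as))

long⇒∃∉ : {A : Set} {as bs : List A} → (∀ (x y : A) → Dec (x ≡ y)) → Unique as → length bs < length as → ∃[ a ] a ∈ as × a ∉ bs
long⇒∃∉ {as = as} {bs} _≟_ u lt with search as
  where
  open import Data.List.Membership.DecPropositional _≟_ using (_∈?_)
  search : ∀ cs → (∃[ a ] a ∈ cs × a ∉ bs) ⊎ (∀ {a} → a ∈ cs → a ∈ bs)
  search [] = inj₂ λ ()
  search (c ∷ cs) with c ∈? bs | search cs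
  ... | no c∉ | _ = inj₁ (c , here refl , c∉)
  ... | yes _ | inj₁ (a , p , q) = inj₁ (a , there p , q)
  ... | yes c∈ | inj₂ f = inj₂ λ { (here refl) → c∈ ; (there p) → f p }
... | inj₁ r = r
... | inj₂ f = ⊥-elim (<⇒≱ lt (length-⊆ u f))

-- Walks

-- On a duplicate-free list this is a partial injection, which is how the neighbours of a vertex are
-- counted through their predecessors or successors on a path.
data Next {A : Set} (u v : A) : List A → Set where
  here  : ∀ {zs} → Next u v (u ∷ v ∷ zs)
  there : ∀ {z zs} → Next u v zs → Next u v (z ∷ zs)

module _ {A : Set} where
  private variable
    u u′ v v′ z : A
    zs : List A

  next-∈ˡ : Next u v zs → u ∈ zs
  next-∈ˡ here = here refl
  next-∈ˡ (there p) = there (next-∈ˡ p)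

  next-∈-tail : Next u v (z ∷ zs) → v ∈ zs
  next-∈-tail here = here refl
  next-∈-tail {zs = _ ∷ _} (there p) = there (next-∈-tail p)

  next-∈ʳ : Next u v zs → v ∈ zs
  next-∈ʳ {zs = _ ∷ _} p = there (next-∈-tail p)

  pred-unique : Unique zs → Next u v zs → Next u′ v zs → u ≡ u′
  pred-unique un here here = refl
  pred-unique un here (there q) = ⊥-elim (head-∉ (tail-unique un) (next-∈-tail q))
  pred-unique un (there p) here = ⊥-elim (head-∉ (tail-unique un) (next-∈-tail p))
  pred-unique un (there p) (there q) = pred-unique (tail-unique un) p q

  succ-unique : Unique zs → Next u v zs → Next u v′ zs → v ≡ v′
  succ-unique un here here = refl
  succ-unique un here (there q) = ⊥-elim (head-∉ un (next-∈ˡ q))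
  succ-unique un (there p) here = ⊥-elim (head-∉ un (next-∈ˡ p))
  succ-unique un (there p) (there q) = succ-unique (tail-unique un) p q

module Walks {A : Set} (_~_ : A → A → Set) (~-sym : ∀ {u v} → u ~ v → v ~ u) where
  private variable
    u v w x y z : A
    as bs zs : List A

  data Walk : A → A → List A → Set where
    stop : Walk x x [ x ]
    step : x ~ z → Walk z y zs → Walk x y (x ∷ zs)

  join : Walk x y as → y ~ z → Walk z w bs → Walk x w (as ++ bs)
  join stop e q = step e q
  join (step f p) e q = step f (join p e q)

  rev : Walk x y zs → Walk y x (reverse zs)
  rev stop = stop
  rev {zs = x ∷ zs} (step e p) = subst (Walk _ _) (sym (unfold-reverse x zs)) (join (rev p) (~-sym e) stop)

  first-∈ : Walk x y zs → x ∈ zs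
  first-∈ stop = here refl
  first-∈ (step _ _) = here refl

  last-∈ : Walk x y zs → y ∈ zs
  last-∈ stop = here refl
  last-∈ (step _ p) = there (last-∈ p)

  first-no-pred : Walk x y zs → Unique zs → ¬ Next u x zs
  first-no-pred stop un p with next-∈-tail p
  ... | ()
  first-no-pred (step _ _) un p = head-∉ un (next-∈-tail p)

  last-no-succ : Walk x y zs → Unique zs → ¬ Next y v zs
  last-no-succ stop un (there ())
  last-no-succ (step e p) un here = head-∉ un (last-∈ p)
  last-no-succ (step e p) un (there q) = last-no-succ p (tail-unique un) q

  loop-trivial : Walk x x zs → Unique zs → zs ≡ [ x ]
  loop-trivial stop un = refl
  loop-trivial (step e p) un = ⊥-elim (head-∉ un (last-∈ p))

  pred : Walk x y zs → v ∈ zs → v ≡ x ⊎ ∃[ u ] Next u v zs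
  pred stop (here eq) = inj₁ eq
  pred (step e p) (here eq) = inj₁ eq
  pred (step e p) (there v∈) with pred p v∈
  pred (step e stop) (there v∈) | inj₁ refl = inj₂ (_ , here)
  pred (step e (step f p)) (there v∈) | inj₁ refl = inj₂ (_ , here)
  ... | inj₂ (u , nx) = inj₂ (u , there nx)

  next : Walk x y zs → v ∈ zs → v ≡ y ⊎ ∃[ w ] Next v w zs
  next stop (here eq) = inj₁ eq
  next (step e stop) (here refl) = inj₂ (_ , here)
  next (step e (step f p)) (here refl) = inj₂ (_ , here)
  next (step e p) (there v∈) with next p v∈
  ... | inj₁ eq = inj₁ eq
  ... | inj₂ (w , nx) = inj₂ (w , there nx)

  record Cut (x y u v : A) (zs : List A) : Set where
    constructor cutting
    field
      {front back} : List A
      frontWalk : Walk x u front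
      link      : u ~ v
      backWalk  : Walk v y back
      splits    : zs ≡ front ++ back

  cut : Walk x y zs → Next u v zs → Cut x y u v zs
  cut (step e stop) here = cutting stop e stop refl
  cut (step e (step f p)) here = cutting stop e (step f p) refl
  cut (step e p) (there nx) with cut p nx
  ... | cutting q l r eq = cutting (step e q) l r (cong (_ ∷_) eq)

  -- The vertices are recorded only up to permutation. Reversing and splicing then cost no
  -- bookkeeping, and most reroutings below reduce to an identity in the commutative monoid of
  -- lists.
  record Path (x y : A) (bag : List A) : Set where
    constructor path
    field
      {verts} : List A
      walk    : Walk x y verts
      perm    : verts ↭ bag

  ⌊_⌋ : Walk x y zs → Path x y zs
  ⌊ p ⌋ = path p ↭-refl

  point : Path x x [ x ]
  point = ⌊ stop ⌋

  infix 30 _⁻¹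
  _⁻¹ : Path x y zs → Path y x zs
  path p eq ⁻¹ = path (rev p) (↭-trans (↭-reverse _) eq)

  infixr 20 _∙⟨_⟩_
  _∙⟨_⟩_ : Path x y as → y ~ z → Path z w bs → Path x w (as ++ bs)
  path p eq ∙⟨ e ⟩ path q eq′ = path (join p e q) (++⁺ eq eq′)

  infixl 10 _by_
  _by_ : Path x y as → as ↭ bs → Path x y bs
  path p eq by eq′ = path p (↭-trans eq eq′)

  -- The closing edge makes the path a cycle, which is cut open just before `v`.
  rotate : Path x y zs → y ~ x → v ∈ zs → ∃[ w ] Path v w zs
  rotate (path {verts} p eq) e v∈ with pred p (∈-resp-↭ (↭-sym eq) v∈)
  ... | inj₁ refl = _ , path p eq
  ... | inj₂ (u , nx) with cut p nx
  ... | cutting {as} {bs} q l r refl = u , (⌊ r ⌋ ∙⟨ e ⟩ ⌊ q ⌋ by ↭-trans (++-comm bs as) eq)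

-- Covers by alternating runs

module Covers {n : ℕ} (X : Fin n → Set) (_≈_ : Fin n → Fin n → Set)
              (≈-sym : ∀ {u v} → u ≈ v → v ≈ u)
              (≈-alternates : ∀ {u v} → u ≈ v → (X u × ¬ X v) ⊎ (¬ X u × X v)) where

  private V = Fin n
  open Walks _≈_ ≈-sym public
  open CMSolver (++-commutativeMonoid {A = V}) using (solve; _⊜_; _⊕_; id)

  -- Below, `x` is the head of the run and `y` its tail. Both lie in `X`, so a low vertex of a run
  -- is always interior.
  record Run : Set where
    constructor run
    field
      {x y}   : V
      {verts} : List V
      Xx      : X x
      Xy      : X y
      walk    : Walk x y verts

  open Run using (x; y)

  used : List Run → List V
  used rs = concat (map Run.verts rs)

  record IsCover (rs : List Run) : Set where
    constructor cover
    field
      unique : Unique (used rs)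
      covers : ∀ {v} → X v → v ∈ used rs

  Minimal : List Run → Set
  Minimal rs = ∀ rs′ → IsCover rs′ → length rs ≤ length rs′

  used-++ : ∀ rs ss → used (rs ++ ss) ≡ used rs ++ used ss
  used-++ rs ss = trans (cong concat (map-++ Run.verts rs ss)) (sym (concat-++ (map Run.verts rs) (map Run.verts ss)))

  used-↭ : ∀ {rs ss} → rs ↭ ss → used rs ↭ used ss
  used-↭ _↭_.refl = ↭-refl
  used-↭ (prep r p) = ++⁺ˡ (Run.verts r) (used-↭ p)
  used-↭ (swap r s p) = ↭-trans (shifts (Run.verts r) (Run.verts s)) (++⁺ˡ (Run.verts s) (++⁺ˡ (Run.verts r) (used-↭ p)))
  used-↭ (_↭_.trans p q) = ↭-trans (used-↭ p) (used-↭ q)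

  ∈-used⁺ : ∀ {rs r v} → r ∈ rs → v ∈ Run.verts r → v ∈ used rs
  ∈-used⁺ r∈ v∈ = ∈-concat⁺′ v∈ (∈-map⁺ Run.verts r∈)

  ∈-used⁻ : ∀ {rs v} → v ∈ used rs → ∃[ r ] r ∈ rs × v ∈ Run.verts r
  ∈-used⁻ {rs} v∈ with ∈-concat⁻′ (map Run.verts rs) v∈
  ... | zs , v∈zs , zs∈ with ∈-map⁻ Run.verts zs∈
  ... | r , r∈ , refl = r , r∈ , v∈zs

  -- Candidate new runs, indexed by the vertices they use and by their number, which is all that
  -- `improve` has to know.
  data Runs : List V → ℕ → Set where
    []   : Runs [] 0
    _⟪_,_⟫∷_ : ∀ {x y bag bags j} → Path x y bag → X x → X y → Runs bags j → Runs (bag ++ bags) (suc j)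

  infixr 5 _⟪_,_⟫∷_

  toRuns : ∀ {bag j} → Runs bag j → Σ (List Run) λ rs → length rs ≡ j × used rs ↭ bag
  toRuns [] = [] , refl , ↭-refl
  toRuns (path p eq ⟪ Xx , Xy ⟫∷ ps) with toRuns ps
  ... | rs , refl , eq′ = run Xx Xy p ∷ rs , refl , ++⁺ eq eq′

  extract : ∀ {A : Set} {rs : List A} {r} → r ∈ rs → Σ (List A) λ rest → rs ↭ r ∷ rest
  extract {r = r} r∈ with ∈-∃++ r∈
  ... | as , bs , refl = as ++ bs , shift r as bs

  module Exchange (rs : List Run) (isCover : IsCover rs) (minimal : Minimal rs) where
    open IsCover isCover

    tail-determines : ∀ {r s} → r ∈ rs → s ∈ rs → y r ≡ y s → r ≡ s
    tail-determines = go rs unique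
      where
      go : ∀ rs → Unique (used rs) → ∀ {r s} → r ∈ rs → s ∈ rs → y r ≡ y s → r ≡ s
      go (q ∷ rs) un (here refl) (here refl) eq = refl
      go (q ∷ rs) un {s = s} (here refl) (there s∈) eq =
        ⊥-elim (unique-disjoint (Run.verts q) un (last-∈ (Run.walk q))
          (∈-used⁺ s∈ (subst (_∈ Run.verts s) (sym eq) (last-∈ (Run.walk s)))))
      go (q ∷ rs) un {r = r} (there r∈) (here refl) eq =
        ⊥-elim (unique-disjoint (Run.verts q) un (last-∈ (Run.walk q))
          (∈-used⁺ r∈ (subst (_∈ Run.verts r) eq (last-∈ (Run.walk r)))))
      go (q ∷ rs) un (there r∈) (there s∈) eq = go rs (unique-++ʳ (Run.verts q) un) r∈ s∈ eq

    -- Runs carry walks and are not compared directly; their tails tell them apart, which by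
    -- `tail-determines` loses nothing within a cover.
    _≭_ : Run → Run → Set
    r ≭ s = y r ≢ y s

    keep₁ : ∀ {s r : Run} {rest} → s ∈ r ∷ rest → s ≭ r → s ∈ rest
    keep₁ (here refl) ne = ⊥-elim (ne refl)
    keep₁ (there p) ne = p

    extract₂ : ∀ {r s} → r ∈ rs → s ∈ rs → s ≭ r → ∃[ rest ] rs ↭ r ∷ s ∷ rest
    extract₂ r∈ s∈ s≭r with extract r∈
    ... | _ , p with extract (keep₁ (∈-resp-↭ p s∈) s≭r)
    ... | rest , q = rest , ↭-trans p (prep _ q)

    extract₃ : ∀ {r s u} → r ∈ rs → s ∈ rs → u ∈ rs → s ≭ r → u ≭ r → u ≭ s →
               ∃[ rest ] rs ↭ r ∷ s ∷ u ∷ rest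
    extract₃ r∈ s∈ u∈ s≭r u≭r u≭s with extract₂ r∈ s∈ s≭r
    ... | _ , p with extract (keep₁ (keep₁ (∈-resp-↭ p u∈) u≭r) u≭s)
    ... | rest , q = rest , ↭-trans p (prep _ (prep _ q))

    extract₄ : ∀ {r s u v} → r ∈ rs → s ∈ rs → u ∈ rs → v ∈ rs →
               s ≭ r → u ≭ r → u ≭ s → v ≭ r → v ≭ s → v ≭ u →
               ∃[ rest ] rs ↭ r ∷ s ∷ u ∷ v ∷ rest
    extract₄ r∈ s∈ u∈ v∈ s≭r u≭r u≭s v≭r v≭s v≭u with extract₃ r∈ s∈ u∈ s≭r u≭r u≭s
    ... | _ , p with extract (keep₁ (keep₁ (keep₁ (∈-resp-↭ p v∈) v≭r) v≭s) v≭u)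
    ... | rest , q = rest , ↭-trans p (prep _ (prep _ (prep _ q)))

    -- Exchanging `olds` for the new runs keeps every vertex of `X` covered and lowers the number of
    -- runs. Minimality enters only here; each disjointness lemma below supplies the new runs.
    improve : ∀ {olds rest bag j α} → rs ↭ olds ++ rest → α ∉ used rs → Runs bag j →
              bag ↭ α ∷ used olds → j < length olds → ⊥
    improve {olds} {rest} {α = α} split α∉ ps eq lt with toRuns ps
    ... | news , refl , eq′ = <⇒≱ shorter (minimal (news ++ rest) (cover
            (unique-↭ (↭-sym same) (α∉ ∷ᵘ unique))
            (λ Xv → ∈-resp-↭ (↭-sym same) (there (covers Xv)))))
      where
      same : used (news ++ rest) ↭ α ∷ used rs
      same = ↭-trans (↭-reflexive (used-++ news rest)) (↭-trans (++⁺ʳ (used rest) (↭-trans eq′ eq))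
        (prep α (↭-trans (↭-reflexive (sym (used-++ olds rest))) (used-↭ (↭-sym split)))))
      shorter : length (news ++ rest) < length rs
      shorter = subst (_ <_) (sym (trans (↭-length split) (length-++ olds)))
        (subst (_< _) (sym (length-++ news)) (+-monoˡ-< (length rest) lt))

    record Mid (l : V) : Set where
      field
        {r}        : Run
        {w s}      : V
        {as bs}    : List V
        r∈         : r ∈ rs
        front      : Walk (x r) w as
        w≈l        : w ≈ l
        l≈s        : l ≈ s
        back       : Walk s (y r) bs
        splits     : Run.verts r ≡ as ++ l ∷ bs
        low        : ¬ X l

      Xs : X s
      Xs = [ (λ p → ⊥-elim (low (proj₁ p))) , proj₂ ]′ (≈-alternates l≈s)

      split↭ : Run.verts r ↭ as ++ [ l ] ++ bs
      split↭ = ↭-reflexive splits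

      -- A rotation: entering the tail of its own run from `l` reverses `back`, so the same vertices
      -- now end in `s`.
      own : l ≈ y r → Path (x r) s (as ++ [ l ] ++ bs)
      own e = ⌊ front ⌋ ∙⟨ w≈l ⟩ point ∙⟨ e ⟩ ⌊ back ⌋ ⁻¹

      arm : ∀ c → l ≈ y c → Path (x r) (x c) (as ++ [ l ] ++ Run.verts c)
      arm c e = ⌊ front ⌋ ∙⟨ w≈l ⟩ point ∙⟨ e ⟩ ⌊ Run.walk c ⌋ ⁻¹

    mid : ∀ {l} → l ∈ used rs → ¬ X l → Mid l
    mid {l} l∈ low with ∈-used⁻ {rs} l∈
    ... | r , r∈ , l∈r with pred (Run.walk r) l∈r
    ... | inj₁ refl = ⊥-elim (low (Run.Xx r))
    ... | inj₂ (w , nx) with cut (Run.walk r) nx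
    ... | cutting p e stop eq = ⊥-elim (low (Run.Xy r))
    ... | cutting p e (step f q) eq = record { r∈ = r∈ ; front = p ; w≈l = e ; l≈s = f ; back = q ; splits = eq ; low = low }

    -- Whichever single run has to be avoided, `l` can still be left through the tail of another
    -- one.
    record TwoTails (l : V) : Set where
      field
        {a b}       : Run
        a∈          : a ∈ rs
        b∈          : b ∈ rs
        a≭b         : a ≭ b
        l≈a         : l ≈ y a
        l≈b         : l ≈ y b

    tailAvoiding : ∀ {l} → TwoTails l → (c : Run) → ∃[ a ] a ∈ rs × l ≈ y a × a ≭ c
    tailAvoiding t c with y (TwoTails.a t) ≟ᶠ y c
    ... | no a≭c = _ , TwoTails.a∈ t , TwoTails.l≈a t , a≭c
    ... | yes eq = _ , TwoTails.b∈ t , TwoTails.l≈b t , λ eq′ → TwoTails.a≭b t (trans eq (sym eq′))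

    -- The reverse of `r`, then `α`, then `s` is one run in place of two.
    heads-disjoint : ∀ {r s α} → r ∈ rs → s ∈ rs → s ≭ r → α ∉ used rs → x r ≈ α → x s ≈ α → ⊥
    heads-disjoint {r} {s} {α} r∈ s∈ s≭r α∉ e f with extract₂ r∈ s∈ s≭r
    ... | rest , p = improve {r ∷ s ∷ []} p α∉
      (⌊ Run.walk r ⌋ ⁻¹ ∙⟨ e ⟩ point ∙⟨ ≈-sym f ⟩ ⌊ Run.walk s ⌋ ⟪ Run.Xy r , Run.Xy s ⟫∷ [])
      (solve 3 (λ a r s → (a ⊕ r ⊕ s) ⊕ id ⊜ r ⊕ a ⊕ s ⊕ id) ↭-refl (Run.verts r) [ α ] (Run.verts s))
      (s≤s (s≤s z≤n))

    -- `l` is left through a tail `c` other than that of `r`. If `l` lies on `r`, then `c`, the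
    -- front of `r` and its back are strung together through `l` and `α`. If `c` is the run of `l`,
    -- a rotation of it is joined to `r` through `α`. Otherwise three runs become two.
    head-mid-disjoint : ∀ {r l α} → r ∈ rs → (μ : Mid l) → TwoTails l → α ∉ used rs →
                        x r ≈ α → Mid.s μ ≈ α → ⊥
    head-mid-disjoint {r} {l} {α} r∈ μ t α∉ e f with y (Mid.r μ) ≟ᶠ y r
    ... | yes eq with tail-determines (Mid.r∈ μ) r∈ eq
    ... | refl with tailAvoiding t r
    ... | c , c∈ , l≈c , c≭r with extract₂ r∈ c∈ c≭r
    ... | rest , p = improve {r ∷ c ∷ []} p α∉
      ((M.arm c l≈c) ⁻¹ ∙⟨ e ⟩ point ∙⟨ ≈-sym f ⟩ ⌊ M.back ⌋ ⟪ Run.Xx c , Run.Xy r ⟫∷ [])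
      (↭-trans (solve 5 (λ as l c α bs → ((as ⊕ l ⊕ c) ⊕ α ⊕ bs) ⊕ id ⊜ α ⊕ (as ⊕ l ⊕ bs) ⊕ c ⊕ id) ↭-refl
                 M.as [ l ] (Run.verts c) [ α ] M.bs)
        (prep α (++⁺ʳ _ (↭-sym M.split↭))))
      (s≤s (s≤s z≤n))
      where module M = Mid μ
    head-mid-disjoint {r} {l} {α} r∈ μ t α∉ e f | no μ≭r with tailAvoiding t r
    ... | c , c∈ , l≈c , c≭r with y c ≟ᶠ y (Mid.r μ)
    ... | yes eq with tail-determines c∈ (Mid.r∈ μ) eq
    ... | refl with extract₂ c∈ r∈ (μ≭r ∘ sym)
    ... | rest , p = improve {c ∷ r ∷ []} p α∉
      (M.own l≈c ∙⟨ f ⟩ point ∙⟨ ≈-sym e ⟩ ⌊ Run.walk r ⌋ ⟪ Run.Xx c , Run.Xy r ⟫∷ [])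
      (↭-trans (solve 5 (λ as l r α bs → ((as ⊕ l ⊕ bs) ⊕ α ⊕ r) ⊕ id ⊜ α ⊕ (as ⊕ l ⊕ bs) ⊕ r ⊕ id) ↭-refl
                 M.as [ l ] (Run.verts r) [ α ] M.bs)
        (prep α (++⁺ʳ _ (↭-sym M.split↭))))
      (s≤s (s≤s z≤n))
      where module M = Mid μ
    head-mid-disjoint {r} {l} {α} r∈ μ t α∉ e f | no μ≭r | c , c∈ , l≈c , c≭r | no c≭μ
      with extract₃ (Mid.r∈ μ) c∈ r∈ c≭μ (μ≭r ∘ sym) (c≭r ∘ sym)
    ... | rest , p = improve {M.r ∷ c ∷ r ∷ []} p α∉
      (M.arm c l≈c ⟪ Run.Xx M.r , Run.Xx c ⟫∷
       (⌊ M.back ⌋ ⁻¹ ∙⟨ f ⟩ point ∙⟨ ≈-sym e ⟩ ⌊ Run.walk r ⌋) ⟪ Run.Xy M.r , Run.Xy r ⟫∷ [])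
      (↭-trans (solve 6 (λ as l c α bs r → (as ⊕ l ⊕ c) ⊕ (bs ⊕ α ⊕ r) ⊕ id ⊜ α ⊕ (as ⊕ l ⊕ bs) ⊕ c ⊕ r ⊕ id) ↭-refl
                 M.as [ l ] (Run.verts c) [ α ] M.bs (Run.verts r))
        (prep α (++⁺ʳ _ (↭-sym M.split↭))))
      (s≤s (s≤s (s≤s z≤n)))
      where module M = Mid μ

    -- The two lows l, l′ sit on the same run in the order  x … l s … w′ l′ s′ … y.
    record Ordered (r : Run) (l l′ s s′ : V) : Set where
      field
        {w w′}        : V
        {as ms bs}    : List V
        front         : Walk (x r) w as
        w≈l           : w ≈ l
        l≈s           : l ≈ s
        middle        : Walk s w′ ms
        w′≈l′         : w′ ≈ l′
        back          : Walk s′ (y r) bs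
        splits        : Run.verts r ≡ as ++ l ∷ (ms ++ l′ ∷ bs)

    -- `l′` is left through a tail `b` off `r`, and `l` through a tail `a` other than `b`, while `α`
    -- joins the middle of `r` to its back. If `a` is the tail of `r`, two runs become x ... l y ...
    -- s′ α s ... w′ l′ followed by `b` reversed; otherwise three become two.
    ordered-disjoint : ∀ {r l l′ s s′ α} → r ∈ rs → Ordered r l l′ s s′ → TwoTails l → TwoTails l′ →
                       α ∉ used rs → s ≈ α → s′ ≈ α → ⊥
    ordered-disjoint {r} {l} {l′} {s} {s′} {α} r∈ o t t′ α∉ e f with tailAvoiding t′ r
    ... | b , b∈ , l′≈b , b≭r with tailAvoiding t b
    ... | a , a∈ , l≈a , a≭b with y a ≟ᶠ y r
    ... | yes eq with tail-determines a∈ r∈ eq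
    ... | refl with extract₂ r∈ b∈ b≭r
    ... | rest , p = improve {r ∷ b ∷ []} p α∉
      (⌊ O.front ⌋ ∙⟨ O.w≈l ⟩ point ∙⟨ l≈a ⟩ ⌊ O.back ⌋ ⁻¹ ∙⟨ f ⟩ point ∙⟨ ≈-sym e ⟩ ⌊ O.middle ⌋
         ∙⟨ O.w′≈l′ ⟩ point ∙⟨ l′≈b ⟩ ⌊ Run.walk b ⌋ ⁻¹ ⟪ Run.Xx r , Run.Xx b ⟫∷ [])
      (↭-trans (solve 7 (λ as l ms l′ bs b α → (as ⊕ l ⊕ bs ⊕ α ⊕ ms ⊕ l′ ⊕ b) ⊕ id ⊜ α ⊕ (as ⊕ l ⊕ ms ⊕ l′ ⊕ bs) ⊕ b ⊕ id) ↭-refl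
                 O.as [ l ] O.ms [ l′ ] O.bs (Run.verts b) [ α ])
        (prep α (++⁺ʳ _ (↭-reflexive (sym O.splits)))))
      (s≤s (s≤s z≤n))
      where module O = Ordered o
    ordered-disjoint {r} {l} {l′} {s} {s′} {α} r∈ o t t′ α∉ e f | b , b∈ , l′≈b , b≭r | a , a∈ , l≈a , a≭b | no a≭r
      with extract₃ r∈ a∈ b∈ a≭r b≭r (a≭b ∘ sym)
    ... | rest , p = improve {r ∷ a ∷ b ∷ []} p α∉
      ((⌊ O.front ⌋ ∙⟨ O.w≈l ⟩ point ∙⟨ l≈a ⟩ ⌊ Run.walk a ⌋ ⁻¹) ⟪ Run.Xx r , Run.Xx a ⟫∷
       (⌊ O.back ⌋ ⁻¹ ∙⟨ f ⟩ point ∙⟨ ≈-sym e ⟩ ⌊ O.middle ⌋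
         ∙⟨ O.w′≈l′ ⟩ point ∙⟨ l′≈b ⟩ ⌊ Run.walk b ⌋ ⁻¹) ⟪ Run.Xy r , Run.Xx b ⟫∷ [])
      (↭-trans (solve 8 (λ as l ms l′ bs b α a → (as ⊕ l ⊕ a) ⊕ (bs ⊕ α ⊕ ms ⊕ l′ ⊕ b) ⊕ id ⊜ α ⊕ (as ⊕ l ⊕ ms ⊕ l′ ⊕ bs) ⊕ a ⊕ b ⊕ id) ↭-refl
                 O.as [ l ] O.ms [ l′ ] O.bs (Run.verts b) [ α ] (Run.verts a))
        (prep α (++⁺ʳ _ (↭-reflexive (sym O.splits)))))
      (s≤s (s≤s (s≤s z≤n)))
      where module O = Ordered o

    module _ {l l′ α : V} (μ : Mid l) (ν : Mid l′) (ν≭μ : Mid.r ν ≭ Mid.r μ)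
             (α∉ : α ∉ used rs) (e : Mid.s μ ≈ α) (f : Mid.s ν ≈ α) where
      private
        module M = Mid μ
        module N = Mid ν

      own-own : l ≈ y M.r → l′ ≈ y N.r → ⊥
      own-own l≈a l′≈c = let _ , p = extract₂ M.r∈ N.r∈ ν≭μ in improve {M.r ∷ N.r ∷ []} p α∉
        (M.own l≈a ∙⟨ e ⟩ point ∙⟨ ≈-sym f ⟩ (N.own l′≈c) ⁻¹ ⟪ Run.Xx M.r , Run.Xx N.r ⟫∷ [])
        (↭-trans (solve 3 (λ m n α → (m ⊕ α ⊕ n) ⊕ id ⊜ α ⊕ m ⊕ n ⊕ id) ↭-refl
                   (M.as ++ [ l ] ++ M.bs) (N.as ++ [ l′ ] ++ N.bs) [ α ])
          (prep α (++⁺ (↭-sym M.split↭) (++⁺ʳ _ (↭-sym N.split↭)))))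
        (s≤s (s≤s z≤n))

      own-foreign : ∀ {c} → c ∈ rs → c ≭ M.r → c ≭ N.r → l ≈ y M.r → l′ ≈ y c → ⊥
      own-foreign {c} c∈ c≭μ c≭ν l≈a l′≈c = let _ , p = extract₃ M.r∈ N.r∈ c∈ ν≭μ c≭μ c≭ν in improve {M.r ∷ N.r ∷ c ∷ []} p α∉
        ((M.own l≈a ∙⟨ e ⟩ point ∙⟨ ≈-sym f ⟩ ⌊ N.back ⌋) ⟪ Run.Xx M.r , Run.Xy N.r ⟫∷
         N.arm c l′≈c ⟪ Run.Xx N.r , Run.Xx c ⟫∷ [])
        (↭-trans (solve 6 (λ m α bs as l′ c → (m ⊕ α ⊕ bs) ⊕ (as ⊕ l′ ⊕ c) ⊕ id ⊜ α ⊕ m ⊕ (as ⊕ l′ ⊕ bs) ⊕ c ⊕ id) ↭-refl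
                   (M.as ++ [ l ] ++ M.bs) [ α ] N.bs N.as [ l′ ] (Run.verts c))
          (prep α (++⁺ (↭-sym M.split↭) (++⁺ʳ _ (↭-sym N.split↭)))))
        (s≤s (s≤s (s≤s z≤n)))

      foreign-own : ∀ {a} → a ∈ rs → a ≭ M.r → N.r ≭ a → l ≈ y a → l′ ≈ y N.r → ⊥
      foreign-own {a} a∈ a≭μ ν≭a l≈a l′≈c = let _ , p = extract₃ M.r∈ a∈ N.r∈ a≭μ ν≭μ ν≭a in improve {M.r ∷ a ∷ N.r ∷ []} p α∉
        (M.arm a l≈a ⟪ Run.Xx M.r , Run.Xx a ⟫∷
         (⌊ M.back ⌋ ⁻¹ ∙⟨ e ⟩ point ∙⟨ ≈-sym f ⟩ (N.own l′≈c) ⁻¹) ⟪ Run.Xy M.r , Run.Xx N.r ⟫∷ [])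
        (↭-trans (solve 6 (λ as l a bs α n → (as ⊕ l ⊕ a) ⊕ (bs ⊕ α ⊕ n) ⊕ id ⊜ α ⊕ (as ⊕ l ⊕ bs) ⊕ a ⊕ n ⊕ id) ↭-refl
                   M.as [ l ] (Run.verts a) M.bs [ α ] (N.as ++ [ l′ ] ++ N.bs))
          (prep α (++⁺ (↭-sym M.split↭) (++⁺ˡ (Run.verts a) (++⁺ʳ _ (↭-sym N.split↭))))))
        (s≤s (s≤s (s≤s z≤n)))

      foreign-back : ∀ {a} → a ∈ rs → a ≭ M.r → N.r ≭ a → l ≈ y a → l′ ≈ y M.r → ⊥
      foreign-back {a} a∈ a≭μ ν≭a l≈a l′≈c = let _ , p = extract₃ M.r∈ a∈ N.r∈ a≭μ ν≭μ ν≭a in improve {M.r ∷ a ∷ N.r ∷ []} p α∉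
        (M.arm a l≈a ⟪ Run.Xx M.r , Run.Xx a ⟫∷
         (⌊ N.front ⌋ ∙⟨ N.w≈l ⟩ point ∙⟨ l′≈c ⟩ ⌊ M.back ⌋ ⁻¹ ∙⟨ e ⟩ point ∙⟨ ≈-sym f ⟩ ⌊ N.back ⌋)
           ⟪ Run.Xx N.r , Run.Xy N.r ⟫∷ [])
        (↭-trans (solve 8 (λ as l a bs α as′ l′ bs′ → (as ⊕ l ⊕ a) ⊕ (as′ ⊕ l′ ⊕ bs ⊕ α ⊕ bs′) ⊕ id ⊜ α ⊕ (as ⊕ l ⊕ bs) ⊕ a ⊕ (as′ ⊕ l′ ⊕ bs′) ⊕ id) ↭-refl
                   M.as [ l ] (Run.verts a) M.bs [ α ] N.as [ l′ ] N.bs)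
          (prep α (++⁺ (↭-sym M.split↭) (++⁺ˡ (Run.verts a) (++⁺ʳ _ (↭-sym N.split↭))))))
        (s≤s (s≤s (s≤s z≤n)))

      foreign-foreign : ∀ {a c} → a ∈ rs → c ∈ rs → a ≭ M.r → N.r ≭ a → c ≭ M.r → c ≭ a → c ≭ N.r → l ≈ y a → l′ ≈ y c → ⊥
      foreign-foreign {a} {c} a∈ c∈ a≭μ ν≭a c≭μ c≭a c≭ν l≈a l′≈c = let _ , p = extract₄ M.r∈ a∈ N.r∈ c∈ a≭μ ν≭μ ν≭a c≭μ c≭a c≭ν in improve {M.r ∷ a ∷ N.r ∷ c ∷ []} p α∉
        (M.arm a l≈a ⟪ Run.Xx M.r , Run.Xx a ⟫∷
         (⌊ M.back ⌋ ⁻¹ ∙⟨ e ⟩ point ∙⟨ ≈-sym f ⟩ ⌊ N.back ⌋) ⟪ Run.Xy M.r , Run.Xy N.r ⟫∷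
         N.arm c l′≈c ⟪ Run.Xx N.r , Run.Xx c ⟫∷ [])
        (↭-trans (solve 9 (λ as l a bs α as′ l′ bs′ c → (as ⊕ l ⊕ a) ⊕ (bs ⊕ α ⊕ bs′) ⊕ (as′ ⊕ l′ ⊕ c) ⊕ id ⊜ α ⊕ (as ⊕ l ⊕ bs) ⊕ a ⊕ (as′ ⊕ l′ ⊕ bs′) ⊕ c ⊕ id) ↭-refl
                   M.as [ l ] (Run.verts a) M.bs [ α ] N.as [ l′ ] N.bs (Run.verts c))
          (prep α (++⁺ (↭-sym M.split↭) (++⁺ˡ (Run.verts a) (++⁺ʳ _ (↭-sym N.split↭))))))
        (s≤s (s≤s (s≤s (s≤s z≤n))))

      -- `a` avoids the run of `l′`, and `c` avoids `a`. The five remaining positions of `a` and `c`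
      -- relative to the two runs are those of the five reroutings above, each of which saves one
      -- run.
      mids-disjoint-≭ : TwoTails l → TwoTails l′ → ⊥
      mids-disjoint-≭ t t′ with tailAvoiding t N.r
      ... | a , a∈ , l≈a , a≭ν with tailAvoiding t′ a
      ... | c , c∈ , l′≈c , c≭a with y a ≟ᶠ y M.r | y c ≟ᶠ y N.r | y c ≟ᶠ y M.r
      ... | yes a≡μ | yes c≡ν | _ = own-own (subst (l ≈_) a≡μ l≈a) (subst (l′ ≈_) c≡ν l′≈c)
      ... | yes a≡μ | no c≭ν | _ = own-foreign c∈ (λ c≡μ → c≭a (trans c≡μ (sym a≡μ))) c≭ν (subst (l ≈_) a≡μ l≈a) l′≈c
      ... | no a≭μ | yes c≡ν | _ = foreign-own a∈ a≭μ (a≭ν ∘ sym) l≈a (subst (l′ ≈_) c≡ν l′≈c)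
      ... | no a≭μ | no c≭ν | yes c≡μ = foreign-back a∈ a≭μ (a≭ν ∘ sym) l≈a (subst (l′ ≈_) c≡μ l′≈c)
      ... | no a≭μ | no c≭ν | no c≭μ = foreign-foreign a∈ c∈ a≭μ (a≭ν ∘ sym) c≭μ c≭a c≭ν l≈a l′≈c

split-order : ∀ {A : Set} {l l′ : A} as {bs} as′ {bs′} → as ++ l ∷ bs ≡ as′ ++ l′ ∷ bs′ →
              Unique (as ++ l ∷ bs) → l′ ∈ as → l ∈ as′ → ⊥
split-order (h ∷ as) (h′ ∷ as′) eq un (here refl) q =
  head-∉ un (subst (h ∈_) (sym (∷-injectiveʳ eq)) (∈-++⁺ʳ as′ (here refl)))
split-order (h ∷ as) (h′ ∷ as′) eq un (there p) (here refl) =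
  head-∉ un (subst (_∈ as ++ h′ ∷ _) (sym (∷-injectiveˡ eq)) (∈-++⁺ʳ as (here refl)))
split-order (h ∷ as) (h′ ∷ as′) eq un (there p) (there q) =
  split-order as as′ (∷-injectiveʳ eq) (tail-unique un) p q

-- Counting the neighbours of a minimal cover

module CoverCount {n : ℕ} (X : Fin n → Set) (X? : Decidable X)
    (_≈_ : Fin n → Fin n → Set) (_≈?_ : ∀ u v → Dec (u ≈ v))
    (≈-sym : ∀ {u v} → u ≈ v → v ≈ u)
    (≈-alternates : ∀ {u v} → u ≈ v → (X u × ¬ X v) ⊎ (¬ X u × X v))
    (Y : List (Fin n)) (Y-unique : Unique Y)
    (Y-low : ∀ {v} → v ∈ Y → ¬ X v) (Y-complete : ∀ {u v} → X u → u ≈ v → v ∈ Y)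
    (Xs : List (Fin n)) (Xs-complete : ∀ {v} → X v → v ∈ Xs)
    (δ : ℕ) (Y-degree : ∀ {u} → X u → δ ≤ length (filter (u ≈?_) Y))
    (few : length Xs ≤ suc δ) where

  private V = Fin n
  open Covers X _≈_ ≈-sym ≈-alternates public
  open Run using (x; y)
  open import Data.List.Membership.DecPropositional (_≟ᶠ_ {n}) using (_∈?_)

  low? : Decidable (λ v → ¬ X v)
  low? v = ¬? (X? v)

  high∷ : ∀ {v zs} → X v → length (filter X? (v ∷ zs)) ≡ suc (length (filter X? zs))
                          × length (filter low? (v ∷ zs)) ≡ length (filter low? zs)
  high∷ {v} Xv with X? v
  ... | yes _ = refl , refl
  ... | no ¬X = ⊥-elim (¬X Xv)

  low∷ : ∀ {v zs} → ¬ X v → length (filter X? (v ∷ zs)) ≡ length (filter X? zs)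
                           × length (filter low? (v ∷ zs)) ≡ suc (length (filter low? zs))
  low∷ {v} ¬Xv with X? v
  ... | yes Xv = ⊥-elim (¬Xv Xv)
  ... | no _   = refl , refl

  run-alternates : ∀ {u v zs} → Walk u v zs → X v →
    (X u → length (filter X? zs) ≡ suc (length (filter low? zs))) ×
    (¬ X u → length (filter X? zs) ≡ length (filter low? zs))
  run-alternates {u} stop Xv = (λ Xu → trans (proj₁ (high∷ {u} {[]} Xu)) (cong suc (sym (proj₂ (high∷ {u} {[]} Xu))))) , λ ¬Xu → ⊥-elim (¬Xu Xv)
  run-alternates (step {x = u} {zs = zs} e p) Xv with ≈-alternates e | run-alternates p Xv
  ... | inj₁ (Xu , ¬Xz) | _ , even = (λ _ → trans (proj₁ (high∷ Xu)) (cong suc (trans (even ¬Xz) (sym (proj₂ (high∷ Xu)))))) , λ ¬Xu → ⊥-elim (¬Xu Xu)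
  ... | inj₂ (¬Xu , Xz) | odd , _ = (λ Xu → ⊥-elim (¬Xu Xu)) , λ _ → trans (proj₁ (low∷ ¬Xu)) (trans (odd Xz) (sym (proj₂ (low∷ ¬Xu))))

  filter-length-++ : {P : V → Set} (P? : Decidable P) → ∀ as {bs} →
                     length (filter P? (as ++ bs)) ≡ length (filter P? as) + length (filter P? bs)
  filter-length-++ P? [] = refl
  filter-length-++ P? (a ∷ as) with P? a
  ... | yes _ = cong suc (filter-length-++ P? as)
  ... | no  _ = filter-length-++ P? as

  used-balance : ∀ rs → length (filter X? (used rs)) ≡ length (filter low? (used rs)) + length rs
  used-balance [] = refl
  used-balance (r ∷ rs) = trans (filter-length-++ X? (Run.verts r))
    (trans (cong₂ _+_ (proj₁ (run-alternates (Run.walk r) (Run.Xy r)) (Run.Xx r)) (used-balance rs))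
    (trans (lemma (length (filter low? (Run.verts r))) _ _)
           (cong (_+ suc (length rs)) (sym (filter-length-++ low? (Run.verts r))))))
    where
    lemma : ∀ a b c → suc a + (b + c) ≡ a + b + suc c
    lemma = solve-∀

  lows : List Run → List V
  lows rs = filter low? (used rs)

  lows-few : ∀ {rs} → IsCover rs → length (lows rs) + length rs ≤ suc δ
  lows-few {rs} c = ≤-trans (≤-reflexive (sym (used-balance rs)))
    (≤-trans (length-⊆ (unique-filter X? (IsCover.unique c)) (Xs-complete ∘ proj₂ ∘ ∈-filter⁻ X? {xs = used rs})) few)

  used-length : ∀ {rs} → IsCover rs → length (used rs) + length rs ≡ length (filter X? (used rs)) + length (filter X? (used rs))
  used-length {rs} c = trans (cong (_+ length rs) (sym (filter-split X? (used rs))))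
    (trans (+-assoc (length (filter X? (used rs))) _ _) (cong (length (filter X? (used rs)) +_) (sym (used-balance rs))))

  module _ (rs : List Run) (isCover : IsCover rs) (minimal : Minimal rs) where
    open IsCover isCover
    open Exchange rs isCover minimal

    next-mid : ∀ {l s y bs} as → Walk s y bs → Next l s (as ++ l ∷ bs)
    next-mid [] stop = here
    next-mid [] (step _ _) = here
    next-mid (a ∷ as) p = there (next-mid as p)

    run-unique : ∀ {r} → r ∈ rs → Unique (Run.verts r)
    run-unique {r} r∈ with extract r∈
    ... | rest , p = unique-++ˡ (Run.verts r) (unique-↭ (used-↭ p) unique)

    order : ∀ {l l′} (μ : Mid l) (ν : Mid l′) → Mid.r μ ≡ Mid.r ν → l′ ∈ Mid.bs μ →
            Ordered (Mid.r μ) l l′ (Mid.s μ) (Mid.s ν)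
    order {l} {l′} μ ν refl l′∈ with pred (Mid.back μ) l′∈
    ... | inj₁ refl = ⊥-elim (Mid.low ν (Mid.Xs μ))
    ... | inj₂ (w′ , nx) with cut (Mid.back μ) nx
    ... | cutting p e stop eq = ⊥-elim (Mid.low ν (Run.Xy (Mid.r μ)))
    ... | cutting {ms} p e (step {zs = bs} f q) eq = record
      { front = M.front ; w≈l = M.w≈l ; l≈s = M.l≈s ; middle = p ; w′≈l′ = e
      ; back = subst (λ s → Walk s _ bs) same q ; splits = shape }
      where
      module M = Mid μ
      module N = Mid ν
      shape : Run.verts M.r ≡ M.as ++ l ∷ ms ++ l′ ∷ bs
      shape = trans M.splits (cong (λ zs → M.as ++ l ∷ zs) eq)
      -- The vertex after `l′` found by cutting `back` is the one stored in `ν`, as the run repeats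
      -- no vertex.
      same = succ-unique (run-unique M.r∈)
        (subst (Next l′ _) (trans (++-assoc M.as (l ∷ ms) _) (sym shape)) (next-mid (M.as ++ l ∷ ms) q))
        (subst (Next l′ N.s) (sym N.splits) (next-mid N.as N.back))

    mids-disjoint : ∀ {l l′ α} → (μ : Mid l) → (ν : Mid l′) → TwoTails l → TwoTails l′ → l ≢ l′ →
                    α ∉ used rs → Mid.s μ ≈ α → Mid.s ν ≈ α → ⊥
    mids-disjoint {l} {l′} μ ν t t′ l≢l′ α∉ e f with y (Mid.r ν) ≟ᶠ y (Mid.r μ)
    ... | no ν≭μ = mids-disjoint-≭ μ ν ν≭μ α∉ e f t t′
    ... | yes eq with tail-determines (Mid.r∈ ν) (Mid.r∈ μ) eq
    ... | ν≡μ with ∈-++⁻ (Mid.as μ) (subst (l′ ∈_) (trans (cong Run.verts ν≡μ) (Mid.splits μ)) (subst (l′ ∈_) (sym (Mid.splits ν)) (∈-++⁺ʳ (Mid.as ν) (here refl))))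
    ... | inj₂ (here l′≡l) = l≢l′ (sym l′≡l)
    ... | inj₂ (there l′∈) = ordered-disjoint (Mid.r∈ μ) (order μ ν (sym ν≡μ) l′∈) t t′ α∉ e f
    ... | inj₁ l′∈ with ∈-++⁻ (Mid.as ν) (subst (l ∈_) (trans (cong Run.verts (sym ν≡μ)) (Mid.splits ν)) (subst (l ∈_) (sym (Mid.splits μ)) (∈-++⁺ʳ (Mid.as μ) (here refl))))
    ... | inj₂ (here l≡l′) = l≢l′ l≡l′
    ... | inj₂ (there l∈) = ordered-disjoint (Mid.r∈ ν) (order ν μ ν≡μ l∈) t′ t α∉ f e
    ... | inj₁ l∈ = split-order (Mid.as μ) (Mid.as ν)
           (trans (sym (Mid.splits μ)) (trans (cong Run.verts (sym ν≡μ)) (Mid.splits ν)))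
           (subst Unique (Mid.splits μ) (run-unique (Mid.r∈ μ))) l′∈ l∈

    Λ free : List V
    Λ = lows rs
    free = filter (λ v → ¬? (v ∈? used rs)) Y

    outside : V → List V
    outside h = filter (h ≈?_) free

    ∈-outside : ∀ {h α} → α ∈ outside h → α ∈ free × α ∉ used rs × h ≈ α
    ∈-outside {h} α∈ with ∈-filter⁻ (h ≈?_) {xs = free} α∈
    ... | α∈free , e = α∈free , proj₂ (∈-filter⁻ (λ v → ¬? (v ∈? used rs)) {xs = Y} α∈free) , e

    outside-unique : ∀ h → Unique (outside h)
    outside-unique h = unique-filter (h ≈?_) (unique-filter _ Y-unique)

    degree-split : ∀ {u} → X u → δ ≤ length (outside u) + length (filter (u ≈?_) Λ)
    degree-split {u} Xu = ≤-trans (Y-degree Xu) (≤-trans (length-⊆ (unique-filter (u ≈?_) Y-unique) sub)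
        (≤-reflexive (length-++ (outside u))))
      where
      sub : ∀ {v} → v ∈ filter (u ≈?_) Y → v ∈ outside u ++ filter (u ≈?_) Λ
      sub {v} v∈ with ∈-filter⁻ (u ≈?_) {xs = Y} v∈
      ... | v∈Y , e with v ∈? used rs
      ... | yes v∈used = ∈-++⁺ʳ (outside u) (∈-filter⁺ (u ≈?_) (∈-filter⁺ low? v∈used (Y-low v∈Y)) e)
      ... | no  v∉used = ∈-++⁺ˡ (∈-filter⁺ (u ≈?_) (∈-filter⁺ (λ v → ¬? (v ∈? used rs)) v∈Y v∉used) e)

    runs-distinct : ∀ qs → Unique (used qs) → AllPairs (λ r s → s ≭ r) qs
    runs-distinct [] un = []
    runs-distinct (r ∷ qs) un = tabulate (λ {s} s∈ eq → unique-disjoint (Run.verts r) un (last-∈ (Run.walk r))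
        (∈-used⁺ s∈ (subst (_∈ Run.verts s) eq (last-∈ (Run.walk s)))))
      ∷ runs-distinct qs (unique-++ʳ (Run.verts r) un)

    tails-unique : ∀ qs → AllPairs (λ r s → s ≭ r) qs → Unique (map y qs)
    tails-unique [] _ = []
    tails-unique (r ∷ qs) (p ∷ ps) = (λ q → let s , s∈ , eq = ∈-map⁻ y q in lookup p s∈ (sym eq)) ∷ᵘ tails-unique qs ps

    headZone : List Run → List V
    headZone [] = []
    headZone (r ∷ qs) = outside (x r) ++ headZone qs

    ∈-headZone : ∀ qs {α} → α ∈ headZone qs → ∃[ r ] r ∈ qs × α ∈ outside (x r)
    ∈-headZone (r ∷ qs) α∈ with ∈-++⁻ (outside (x r)) α∈
    ... | inj₁ p = r , here refl , p
    ... | inj₂ p = let s , s∈ , q = ∈-headZone qs p in s , there s∈ , q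

    headZone-unique : ∀ qs → (∀ {r} → r ∈ qs → r ∈ rs) → AllPairs (λ r s → s ≭ r) qs → Unique (headZone qs)
    headZone-unique [] sub _ = []
    headZone-unique (r ∷ qs) sub (p ∷ ps) = unique-++ (outside-unique (x r)) (headZone-unique qs (sub ∘ there) ps)
      λ α∈ α∈′ → let s , s∈ , α∈s = ∈-headZone qs α∈′ ; _ , α∉ , e = ∈-outside α∈ ; _ , _ , f = ∈-outside α∈s in
        heads-disjoint (sub (here refl)) (sub (there s∈)) (lookup p s∈) α∉ e f

    Info : V → Set
    Info l = Mid l × TwoTails l

    midZone : ∀ {ls} → All Info ls → List V
    midZone [] = []
    midZone ((μ , _) ∷ is) = outside (Mid.s μ) ++ midZone is

    ∈-midZone : ∀ {ls} (is : All Info ls) {α} → α ∈ midZone is → ∃[ l ] l ∈ ls × Σ (Info l) λ i → α ∈ outside (Mid.s (proj₁ i))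
    ∈-midZone (i@(μ , _) ∷ is) α∈ with ∈-++⁻ (outside (Mid.s μ)) α∈
    ... | inj₁ p = _ , here refl , i , p
    ... | inj₂ p = let l , l∈ , r = ∈-midZone is p in l , there l∈ , r

    midZone-unique : ∀ {ls} (is : All Info ls) → Unique ls → Unique (midZone is)
    midZone-unique [] _ = []
    midZone-unique ((μ , t) ∷ is) un = unique-++ (outside-unique (Mid.s μ)) (midZone-unique is (tail-unique un))
      λ α∈ α∈′ → let l′ , l′∈ , (ν , t′) , α∈ν = ∈-midZone is α∈′ ; _ , α∉ , e = ∈-outside α∈ ; _ , _ , f = ∈-outside α∈ν in
        mids-disjoint μ ν t t′ (λ { refl → head-∉ un l′∈ }) α∉ e f

    τ : V → ℕ
    τ l = length (filter (l ≈?_) (map y rs))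

    twoTails : ∀ {l} → 2 ≤ τ l → TwoTails l
    twoTails {l} two = go (filter (l ≈?_) (map y rs)) two
        (unique-filter (l ≈?_) (tails-unique rs (runs-distinct rs unique))) (λ v∈ → ∈-filter⁻ (l ≈?_) v∈)
      where
      go : ∀ vs → 2 ≤ length vs → Unique vs → (∀ {v} → v ∈ vs → v ∈ map y rs × l ≈ v) → TwoTails l
      go (_ ∷ []) (s≤s ()) _ _
      go (v ∷ v′ ∷ vs) _ un inv with inv (here refl) | inv (there (here refl))
      ... | p , e | p′ , e′ with ∈-map⁻ y p | ∈-map⁻ y p′
      ... | a , a∈ , refl | b , b∈ , refl =
        record { a∈ = a∈ ; b∈ = b∈ ; a≭b = λ eq → head-∉ un (here eq) ; l≈a = e ; l≈b = e′ }

    -- Adjacent pairs of a tail and a low vertex, grouped by tails; `rowSum-∷` regroups them by low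
    -- vertices.
    rowSum : List Run → List V → ℕ
    rowSum qs ls = sum (map (λ r → length (filter (y r ≈?_) ls)) qs)

    rowSum-[] : ∀ qs → rowSum qs [] ≡ 0
    rowSum-[] [] = refl
    rowSum-[] (r ∷ qs) = rowSum-[] qs

    rowSum-∷ : ∀ qs l ls → rowSum qs (l ∷ ls) ≡ length (filter (l ≈?_) (map y qs)) + rowSum qs ls
    rowSum-∷ [] l ls = refl
    rowSum-∷ (r ∷ qs) l ls with y r ≈? l | l ≈? y r | rowSum-∷ qs l ls
    ... | yes _ | yes _ | ih = cong suc (trans (cong (length (filter (y r ≈?_) ls) +_) ih) (lemma (length (filter (y r ≈?_) ls)) (length (filter (l ≈?_) (map y qs))) (rowSum qs ls)))
      where lemma : ∀ a b c → a + (b + c) ≡ b + (a + c)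
            lemma = solve-∀
    ... | no  _ | no  _ | ih = trans (cong (length (filter (y r ≈?_) ls) +_) ih) (lemma (length (filter (y r ≈?_) ls)) (length (filter (l ≈?_) (map y qs))) (rowSum qs ls))
      where lemma : ∀ a b c → a + (b + c) ≡ b + (a + c)
            lemma = solve-∀
    ... | yes e | no ¬e | _ = ⊥-elim (¬e (≈-sym e))
    ... | no ¬e | yes e | _ = ⊥-elim (¬e (≈-sym e))

    crowded? : Decidable (λ l → 2 ≤ τ l)
    crowded? l = 2 ≤? τ l

    -- A low vertex meets at most one tail unless it is crowded, and then at most all g + 1 of them,
    -- an excess of g.
    rowSum-bound : ∀ {g} → length rs ≡ suc g → ∀ ls → rowSum rs ls ≤ length ls + g * length (filter crowded? ls)
    rowSum-bound eq [] = ≤-trans (≤-reflexive (rowSum-[] rs)) z≤n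
    rowSum-bound {g} eq (l ∷ ls) with 2 ≤? τ l
    ... | yes two = begin
      rowSum rs (l ∷ ls)                                            ≡⟨ rowSum-∷ rs l ls ⟩
      τ l + rowSum rs ls                                            ≤⟨ +-mono-≤ τ≤ (rowSum-bound eq ls) ⟩
      suc g + (length ls + g * length (filter crowded? ls))         ≡⟨ lemma g (length ls) (length (filter crowded? ls)) ⟩
      suc (length ls) + g * suc (length (filter crowded? ls))       ≡⟨ cong (λ zs → suc (length ls) + g * length zs) (sym (filter-accept crowded? two)) ⟩
      suc (length ls) + g * length (filter crowded? (l ∷ ls))       ∎
      where
      open ≤-Reasoning
      τ≤ : τ l ≤ suc g
      τ≤ = ≤-trans (length-filter (l ≈?_) (map y rs)) (≤-reflexive (trans (length-map y rs) eq))
      lemma : ∀ g a b → suc g + (a + g * b) ≡ suc a + g * suc b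
      lemma = solve-∀
    ... | no ¬two = begin
      rowSum rs (l ∷ ls)                                            ≡⟨ rowSum-∷ rs l ls ⟩
      τ l + rowSum rs ls                                            ≤⟨ +-mono-≤ (≤-pred (≰⇒> ¬two)) (rowSum-bound eq ls) ⟩
      suc (length ls) + g * length (filter crowded? ls)             ≡⟨ cong (λ zs → suc (length ls) + g * length zs) (sym (filter-reject crowded? ¬two)) ⟩
      suc (length ls) + g * length (filter crowded? (l ∷ ls))       ∎
      where
      open ≤-Reasoning

    -- The sets outside (x r), r a run, and outside s, s the successor of a low vertex adjacent to two
    -- or more tails, are disjoint; the latter make up for the low vertices that several tails share.
    Y-bound : (∀ {r} → r ∈ rs → length (outside (y r)) ≤ length (outside (x r))) → length rs * δ ≤ length Y
    Y-bound oriented = cases (length rs) refl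
      where
      crowded = filter crowded? Λ

      infos : All Info crowded
      infos = tabulate λ l∈ → let l∈Λ , two = ∈-filter⁻ crowded? {xs = Λ} l∈ ; l∈used , low = ∈-filter⁻ low? {xs = used rs} l∈Λ in
        mid l∈used low , twoTails two

      zones-unique : Unique (headZone rs ++ midZone infos)
      zones-unique = unique-++ (headZone-unique rs (λ p → p) (runs-distinct rs unique))
        (midZone-unique infos (unique-filter crowded? (unique-filter low? unique)))
        λ α∈ α∈′ → let r , r∈ , α∈r = ∈-headZone rs α∈ ; l , _ , (μ , t) , α∈μ = ∈-midZone infos α∈′
                       _ , α∉ , e = ∈-outside α∈r ; _ , _ , f = ∈-outside α∈μ in
          head-mid-disjoint r∈ μ t α∉ e f

      zones-free : ∀ {α} → α ∈ headZone rs ++ midZone infos → α ∈ free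
      zones-free α∈ with ∈-++⁻ (headZone rs) α∈
      ... | inj₁ p = let _ , _ , q = ∈-headZone rs p in proj₁ (∈-outside q)
      ... | inj₂ p = let _ , _ , _ , q = ∈-midZone infos p in proj₁ (∈-outside q)

      free+Λ : length free + length Λ ≤ length Y
      free+Λ = ≤-trans (≤-reflexive (sym (length-++ free))) (length-⊆
        (unique-++ (unique-filter _ Y-unique) (unique-filter low? unique)
          λ p q → proj₂ (∈-filter⁻ (λ v → ¬? (v ∈? used rs)) {xs = Y} p) (proj₁ (∈-filter⁻ low? {xs = used rs} q)))
        λ v∈ → [ proj₁ ∘ ∈-filter⁻ (λ v → ¬? (v ∈? used rs)) , Λ⊆Y ]′ (∈-++⁻ free v∈))
        where
        Λ⊆Y : ∀ {v} → v ∈ Λ → v ∈ Y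
        Λ⊆Y v∈ with ∈-filter⁻ low? {xs = used rs} v∈
        ... | v∈used , low = let μ = mid v∈used low in Y-complete (Mid.Xs μ) (≈-sym (Mid.l≈s μ))

      -- By `lows-few` each zone has at least g vertices, which is just the excess that its crowded
      -- low vertex can cause.
      midZone-long : ∀ {g} → length rs ≡ suc g → ∀ {ls} (is : All Info ls) → g * length ls ≤ length (midZone is)
      midZone-long {g} eq [] = ≤-reflexive (*-zeroʳ g)
      midZone-long {g} eq {_ ∷ ls} ((μ , _) ∷ is) = ≤-trans (≤-reflexive (*-suc g (length ls)))
        (≤-trans (+-mono-≤ g≤ (midZone-long eq is)) (≤-reflexive (sym (length-++ (outside (Mid.s μ))))))
        where
        g≤ : g ≤ length (outside (Mid.s μ))
        g≤ = +-cancelˡ-≤ (length Λ) g _ (≤-trans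
          (≤-pred (subst (_≤ suc δ) (+-suc (length Λ) g) (subst (λ f → length Λ + f ≤ suc δ) eq (lows-few isCover))))
          (≤-trans (degree-split (Mid.Xs μ)) (≤-trans (+-monoʳ-≤ (length (outside (Mid.s μ))) (length-filter (Mid.s μ ≈?_) Λ))
            (≤-reflexive (+-comm (length (outside (Mid.s μ))) _)))))

      tails-degree : ∀ qs → (∀ {r} → r ∈ qs → r ∈ rs) → length qs * δ ≤ length (headZone qs) + rowSum qs Λ
      tails-degree [] sub = z≤n
      tails-degree (r ∷ qs) sub = ≤-trans (+-mono-≤ (degree-split (Run.Xy r)) (tails-degree qs (sub ∘ there)))
        (≤-trans (+-monoˡ-≤ (length (headZone qs) + rowSum qs Λ) (+-monoˡ-≤ (length (filter (y r ≈?_) Λ)) (oriented (sub (here refl)))))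
          (≤-reflexive (trans (lemma (length (outside (x r))) _ _ _)
            (cong (_+ rowSum (r ∷ qs) Λ) (sym (length-++ (outside (x r))))))))
        where lemma : ∀ a b c d → a + b + (c + d) ≡ a + c + (b + d)
              lemma = solve-∀

      cases : ∀ f → length rs ≡ f → length rs * δ ≤ length Y
      cases zero eq = ≤-trans (≤-reflexive (cong (_* δ) eq)) z≤n
      cases (suc g) eq = begin
        length rs * δ                                                   ≤⟨ tails-degree rs (λ p → p) ⟩
        length (headZone rs) + rowSum rs Λ                              ≤⟨ +-monoʳ-≤ (length (headZone rs)) (rowSum-bound eq Λ) ⟩
        length (headZone rs) + (length Λ + g * length crowded)          ≤⟨ +-monoʳ-≤ (length (headZone rs)) (+-monoʳ-≤ (length Λ) (midZone-long eq infos)) ⟩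
        length (headZone rs) + (length Λ + length (midZone infos))      ≡⟨ lemma (length (headZone rs)) _ _ ⟩
        length (headZone rs) + length (midZone infos) + length Λ        ≡⟨ cong (_+ length Λ) (sym (length-++ (headZone rs))) ⟩
        length (headZone rs ++ midZone infos) + length Λ                ≤⟨ +-monoˡ-≤ (length Λ) (length-⊆ zones-unique zones-free) ⟩
        length free + length Λ                                          ≤⟨ free+Λ ⟩
        length Y                                                        ∎
        where
        open ≤-Reasoning
        lemma : ∀ a b c → a + (b + c) ≡ a + c + b
        lemma = solve-∀

  flip : Run → Run
  flip r = run (Run.Xy r) (Run.Xx r) (rev (Run.walk r))

  orient : (weight : V → ℕ) → ∀ rs → Σ (List Run) λ rs′ →
           used rs′ ↭ used rs × length rs′ ≡ length rs × (∀ {r} → r ∈ rs′ → weight (y r) ≤ weight (x r))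
  orient weight [] = [] , ↭-refl , refl , λ ()
  orient weight (r ∷ rs) with orient weight rs | weight (y r) ≤? weight (x r)
  ... | rs′ , p , l , q | yes le = r ∷ rs′ , ++⁺ˡ (Run.verts r) p , cong suc l , λ { (here refl) → le ; (there r∈) → q r∈ }
  ... | rs′ , p , l , q | no ≰ = flip r ∷ rs′ , ++⁺ (↭-reverse (Run.verts r)) p , cong suc l ,
        λ { (here refl) → <⇒≤ (≰⇒> ≰) ; (there r∈) → q r∈ }

  minimal-cover-bound : ∀ rs → IsCover rs → Minimal rs → length rs * δ ≤ length Y
  minimal-cover-bound rs c minimal with orient (λ h → length (filter (h ≈?_) (filter (λ v → ¬? (v ∈? used rs)) Y))) rs
  ... | rs′ , p , l , q = subst (λ f → f * δ ≤ length Y) l (Y-bound rs′ c′ min′ (λ {r} r∈ →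
      subst (λ fr → length (filter (y r ≈?_) fr) ≤ length (filter (x r ≈?_) fr)) same (q r∈)))
    where
    c′ : IsCover rs′
    c′ = cover (unique-↭ (↭-sym p) (IsCover.unique c)) (∈-resp-↭ (↭-sym p) ∘ IsCover.covers c)
    min′ : Minimal rs′
    min′ ss cs = subst (_≤ length ss) (sym l) (minimal ss cs)
    -- Flipping runs does not change the set of used vertices, so weights measured for `rs` remain
    -- valid for `rs′`.
    same : filter (λ v → ¬? (v ∈? used rs)) Y ≡ filter (λ v → ¬? (v ∈? used rs′)) Y
    same = filter-≐ _ _ ((λ ∉ ∈ → ∉ (∈-resp-↭ p ∈)) , (λ ∉ ∈ → ∉ (∈-resp-↭ (↭-sym p) ∈))) Y

-- Gluing

module _ {A B : Set} where
  infixr 5 _⊎ˡ_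
  _⊎ˡ_ : List A → List B → List (A ⊎ B)
  as ⊎ˡ bs = map inj₁ as ++ map inj₂ bs

  ⊎ˡ-unique : ∀ {as bs} → Unique as → Unique bs → Unique (as ⊎ˡ bs)
  ⊎ˡ-unique {as} {bs} u v = unique-++ (unique-map inj₁-injective u) (unique-map inj₂-injective v) λ p q → clash (∈-map⁻ inj₁ p) (∈-map⁻ inj₂ q)
    where
    clash : ∀ {c : A ⊎ B} → ∃[ a ] a ∈ as × c ≡ inj₁ a → ∃[ b ] b ∈ bs × c ≡ inj₂ b → ⊥
    clash (_ , _ , refl) (_ , _ , ())

  ⊎ˡ-length : ∀ as bs → length (as ⊎ˡ bs) ≡ length as + length bs
  ⊎ˡ-length as bs = trans (length-++ (map inj₁ as)) (cong₂ _+_ (length-map inj₁ as) (length-map inj₂ bs))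

  ∈-⊎ˡ₁ : ∀ as {bs a} → inj₁ a ∈ as ⊎ˡ bs → a ∈ as
  ∈-⊎ˡ₁ as p with ∈-++⁻ (map inj₁ as) p
  ... | inj₁ q with ∈-map⁻ inj₁ q
  ... | _ , q′ , refl = q′
  ∈-⊎ˡ₁ as p | inj₂ q with ∈-map⁻ inj₂ q
  ... | _ , _ , ()

  ∈-⊎ˡ₂ : ∀ as {bs b} → inj₂ b ∈ as ⊎ˡ bs → b ∈ bs
  ∈-⊎ˡ₂ as p with ∈-++⁻ (map inj₁ as) p
  ... | inj₂ q with ∈-map⁻ inj₂ q
  ... | _ , q′ , refl = q′
  ∈-⊎ˡ₂ as p | inj₁ q with ∈-map⁻ inj₁ q
  ... | _ , _ , ()

module Gluing {n : ℕ} (_~_ : Fin n → Fin n → Set) (_~?_ : ∀ u v → Dec (u ~ v))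
    (~-sym : ∀ {u v} → u ~ v → v ~ u) (~-irrefl : ∀ {u} → ¬ u ~ u)
    (X : Fin n → Set) (W : List (Fin n))
    (nbr⊆W : ∀ {u v} → X u → u ~ v → v ∈ W)
    (d : ℕ) (degree≥ : ∀ {u} → X u → d ≤ length (filter (u ~?_) (allFin n)))
    (W-small : length W ≤ suc (d + d)) where

  private V = Fin n
  open import Data.List.Membership.DecPropositional (_≟ᶠ_ {n}) using (_∈?_)

  -- Besides edges, a jump between any two vertices of X is allowed; jumps are counted by gaps.
  _≃_ : V → V → Set
  u ≃ v = u ~ v ⊎ (X u × X v)

  ≃-sym : ∀ {u v} → u ≃ v → v ≃ u
  ≃-sym (inj₁ e) = inj₁ (~-sym e)
  ≃-sym (inj₂ (p , q)) = inj₂ (q , p)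

  open Walks _≃_ ≃-sym
  module Real = Walks _~_ ~-sym

  jump : V → V → ℕ
  jump u v with u ~? v
  ... | yes _ = 0
  ... | no  _ = 1

  jump-edge : ∀ {u v} → u ~ v → jump u v ≡ 0
  jump-edge {u} {v} e with u ~? v
  ... | yes _ = refl
  ... | no ¬e = ⊥-elim (¬e e)

  jump≤1 : ∀ u v → jump u v ≤ 1
  jump≤1 u v with u ~? v
  ... | yes _ = z≤n
  ... | no  _ = ≤-refl

  jump-sym : ∀ u v → jump u v ≡ jump v u
  jump-sym u v with u ~? v | v ~? u
  ... | yes _ | yes _ = refl
  ... | no  _ | no  _ = refl
  ... | yes e | no ¬e = ⊥-elim (¬e (~-sym e))
  ... | no ¬e | yes e = ⊥-elim (¬e (~-sym e))

  gaps : List V → ℕ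
  gaps [] = 0
  gaps (u ∷ []) = 0
  gaps (u ∷ v ∷ zs) = jump u v + gaps (v ∷ zs)

  gaps-∷ : ∀ {x z y zs} → Walk z y zs → gaps (x ∷ zs) ≡ jump x z + gaps zs
  gaps-∷ stop = refl
  gaps-∷ (step _ _) = refl

  gaps-++ : ∀ {x y z w as bs} → Walk x y as → y ≃ z → Walk z w bs → gaps (as ++ bs) ≡ gaps as + (jump y z + gaps bs)
  gaps-++ stop e q = gaps-∷ q
  gaps-++ {y = y} {z} {as = _ ∷ as} {bs} (step {x = x} {z = z′} f p) e q = trans (gaps-∷ (join p e q))
    (trans (cong (jump x z′ +_) (gaps-++ p e q)) (trans (sym (+-assoc (jump x z′) (gaps as) _)) (cong (_+ (jump y z + gaps bs)) (sym (gaps-∷ p)))))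

  gaps-reverse : ∀ {x y zs} → Walk x y zs → gaps (reverse zs) ≡ gaps zs
  gaps-reverse stop = refl
  gaps-reverse {zs = x ∷ zs} (step {z = z} e p) = trans (cong gaps (unfold-reverse x zs))
    (trans (gaps-++ (rev p) (≃-sym e) stop) (trans (cong₂ _+_ (gaps-reverse p) (trans (+-identityʳ _) (jump-sym z x)))
      (trans (+-comm (gaps zs) _) (sym (gaps-∷ p)))))

  first-gap : ∀ {x y zs} → Walk x y zs → 0 < gaps zs → ∃[ u ] ∃[ v ] Next u v zs × X u × X v × jump u v ≡ 1
  first-gap stop ()
  first-gap (step {x} {z} e p) lt with x ~? z in eq
  ... | no ¬e with e | p
  ... | inj₁ f | _ = ⊥-elim (¬e f)
  ... | inj₂ (Xx , Xz) | stop = x , z , here , Xx , Xz , lemma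
    where lemma : jump x z ≡ 1
          lemma rewrite eq = refl
  ... | inj₂ (Xx , Xz) | step _ _ = x , z , here , Xx , Xz , lemma
    where lemma : jump x z ≡ 1
          lemma rewrite eq = refl
  first-gap (step {x} {z} e p) lt | yes f with first-gap p (subst (0 <_) (trans (gaps-∷ p) (cong (_+ _) (jump-edge f))) lt)
  ... | u , v , nx , rest = u , v , there nx , rest

  realise : ∀ {x y zs} → Walk x y zs → gaps zs ≡ 0 → Real.Walk x y zs
  realise stop _ = Real.stop
  realise (step {x} {z} e p) eq with x ~? z in is
  ... | yes f = Real.step f (realise p (m+n≡0⇒n≡0 (jump x z) (trans (sym (gaps-∷ p)) eq)))
  ... | no ¬f = ⊥-elim (1≢0 (trans (sym lemma) (m+n≡0⇒m≡0 (jump x z) (trans (sym (gaps-∷ p)) eq))))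
    where lemma : jump x z ≡ 1
          lemma rewrite is = refl
          1≢0 : 1 ≢ 0
          1≢0 ()

  record Chain (j q : ℕ) : Set where
    constructor chain
    field
      {x y} : V
      {zs}  : List V
      Xx    : X x
      Xy    : X y
      walk  : Walk x y zs
      gaps≤ : gaps zs ≤ j
      long  : q ≤ length zs
      unique : Unique zs
      inside : ∀ {v} → v ∈ zs → v ∈ W

  record Piece (x y : V) (bag : List V) (g : ℕ) : Set where
    constructor piece
    field
      {verts} : List V
      walk    : Walk x y verts
      perm    : verts ↭ bag
      gaps≤   : gaps verts ≤ g

  ⌈_⌉ : ∀ {x y zs} → Walk x y zs → Piece x y zs (gaps zs)
  ⌈ p ⌉ = piece p ↭-refl ≤-refl

  flipped : ∀ {x y zs g} → Piece x y zs g → Piece y x zs g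
  flipped (piece p eq le) = piece (rev p) (↭-trans (↭-reverse _) eq) (≤-trans (≤-reflexive (gaps-reverse p)) le)

  infixr 20 _∙⟪_⟫_
  _∙⟪_⟫_ : ∀ {x y z w as bs i j} → Piece x y as i → y ~ z → Piece z w bs j → Piece x w (as ++ bs) (i + j)
  piece {vs} p eq le ∙⟪ e ⟫ piece {vs′} q eq′ le′ = piece (join p (inj₁ e) q) (++⁺ eq eq′)
    (≤-trans (≤-reflexive (trans (gaps-++ p (inj₁ e) q) (cong (λ i → gaps vs + (i + gaps vs′)) (jump-edge e)))) (+-mono-≤ le le′))

  toChain : ∀ {x y bag g j q} → X x → X y → Piece x y bag g → g ≤ j → q ≤ length bag → Unique bag → (∀ {v} → v ∈ bag → v ∈ W) → Chain j q
  toChain Xx Xy (piece p eq le) g≤ q≤ un sub = chain Xx Xy p (≤-trans le g≤) (≤-trans q≤ (≤-reflexive (sym (↭-length eq))))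
    (unique-↭ (↭-sym eq) un) (sub ∘ ∈-resp-↭ eq)

  cut-gaps : ∀ {x y u v zs} → (c : Cut x y u v zs) → gaps (Cut.front c) + gaps (Cut.back c) ≤ gaps zs
  cut-gaps (cutting {as} {bs} p e q refl) = ≤-trans (+-monoʳ-≤ (gaps as) (m≤n+m (gaps bs) _)) (≤-reflexive (sym (gaps-++ p e q)))

  -- Ore's exchange: the two ends of a jump have so many neighbours in W that the jump can be
  -- bypassed by a common outside neighbour or by reversing a segment.
  bypass : ∀ {s u v r as bs j q} → Walk s u as → Walk v r bs → X s → X u → X v → X r →
           gaps as + gaps bs ≤ j → q ≤ length (as ++ bs) → Unique (as ++ bs) → (∀ {v} → v ∈ as ++ bs → v ∈ W) →
           ¬ ¬ Chain j q
  bypass {s} {u} {v} {r} {as} {bs} {j} {q} p p′ Xs Xu Xv Xr g≤ q≤ un sub k = <⇒≱ small big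
    where
    result : ∀ {x y bag g} → X x → X y → Piece x y bag g → g ≤ j → bag ↭ as ++ bs → ⊥
    result Xx Xy pc g≤j eq = k (toChain Xx Xy pc g≤j (≤-trans q≤ (≤-reflexive (sym (↭-length eq)))) (unique-↭ (↭-sym eq) un) (sub ∘ ∈-resp-↭ eq))

    u∈ : u ∈ as
    u∈ = last-∈ p
    r∈ : r ∈ bs
    r∈ = last-∈ p′

    N : V → List V
    N h = filter (h ~?_) (allFin n)

    -- Neither `u` nor `r` can be a target, so fewer than 2d places remain for the 2d or more
    -- neighbours of `u` and `v`.
    W′ : List V
    W′ = filter (λ w → ¬? (w ≟ᶠ u)) (filter (λ w → ¬? (w ≟ᶠ r)) W)

    ∈W′ : ∀ {w} → w ∈ W → w ≢ u → w ≢ r → w ∈ W′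
    ∈W′ w∈ w≢u w≢r = ∈-filter⁺ (λ w → ¬? (w ≟ᶠ u)) (∈-filter⁺ (λ w → ¬? (w ≟ᶠ r)) w∈ w≢r) w≢u

    drop : ∀ {w zs} → w ∈ zs → suc (length (filter (λ z → ¬? (z ≟ᶠ w)) zs)) ≤ length zs
    drop {w} {zs} w∈ = filter-notAll (λ z → ¬? (z ≟ᶠ w)) zs (Any-map (λ { refl ne → ne refl }) w∈)

    small : length W′ < d + d
    small = ≤-pred (≤-trans (≤-trans (s≤s (drop (∈-filter⁺ (λ w → ¬? (w ≟ᶠ r)) (sub (∈-++⁺ˡ u∈)) λ { refl → unique-disjoint as un u∈ r∈ }))) (drop (sub (∈-++⁺ʳ as r∈)))) W-small)

    data Target : V ⊎ V → V → Set where
      same    : ∀ {g} → Target (inj₁ g) g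
      outer   : ∀ {g} → g ∉ as ++ bs → Target (inj₂ g) g
      before₁ : ∀ {g b} → Next b g as → Target (inj₂ g) b
      before₂ : ∀ {g b} → Next b g bs → Target (inj₂ g) b

    target : ∀ {c} → c ∈ N u ⊎ˡ N v → ∃[ b ] b ∈ W′ × Target c b
    target {inj₁ g} c∈ = g , ∈W′ (nbr⊆W Xu u~g) (λ { refl → ~-irrefl u~g })
        (λ { refl → result Xs Xv (⌈ p ⌉ ∙⟪ u~g ⟫ flipped ⌈ p′ ⌉) g≤ ↭-refl }) , same
      where u~g = proj₂ (∈-filter⁻ (u ~?_) {xs = allFin n} (∈-⊎ˡ₁ (N u) c∈))
    target {inj₂ g} c∈ = go (proj₂ (∈-filter⁻ (v ~?_) {xs = allFin n} (∈-⊎ˡ₂ (N u) c∈))) (g ∈? as) (g ∈? bs)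
      where
      go : v ~ g → Dec (g ∈ as) → Dec (g ∈ bs) → ∃[ b ] b ∈ W′ × Target (inj₂ g) b
      go e (yes g∈) _ with pred p g∈
      ... | inj₁ refl = ⊥-elim (result Xu Xr (flipped ⌈ p ⌉ ∙⟪ ~-sym e ⟫ ⌈ p′ ⌉) g≤ ↭-refl)
      ... | inj₂ (b , nx) = b , ∈W′ (sub (∈-++⁺ˡ (next-∈ˡ nx))) (λ { refl → last-no-succ p (unique-++ˡ as un) nx })
              (λ { refl → unique-disjoint as un (next-∈ˡ nx) r∈ }) , before₁ nx
      go e (no g∉) (yes g∈) with pred p′ g∈
      ... | inj₁ refl = ⊥-elim (~-irrefl e)
      ... | inj₂ (b , nx) = b , ∈W′ (sub (∈-++⁺ʳ as (next-∈ˡ nx))) (λ { refl → unique-disjoint as un u∈ (next-∈ˡ nx) })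
              (λ { refl → last-no-succ p′ (unique-++ʳ as un) nx }) , before₂ nx
      go e (no g∉) (no g∉′) = g , ∈W′ (nbr⊆W Xv e) (λ { refl → g∉ u∈ }) (λ { refl → g∉′ r∈ }) , outer λ q → [ g∉ , g∉′ ]′ (∈-++⁻ as q)

    -- A shared target removes the jump: by inserting the common neighbour, or as s ... b u ... g v
    -- ... r, or as s ... u b ... v g ... r.
    clash : ∀ {g g′ b} → u ~ g → v ~ g′ → Target (inj₁ g) b → Target (inj₂ g′) b → ⊥
    clash {g} e f same (outer g∉) = k (toChain Xs Xr (⌈ p ⌉ ∙⟪ e ⟫ ⌈ stop ⌉ ∙⟪ ~-sym f ⟫ ⌈ p′ ⌉) g≤
        (≤-trans q≤ (≤-trans (n≤1+n _) (≤-reflexive (sym (↭-length (shift g as bs))))))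
        (unique-↭ (↭-sym (shift g as bs)) (g∉ ∷ᵘ un)) (λ w∈ → inside (∈-resp-↭ (shift g as bs) w∈)))
      where
      inside : ∀ {w} → w ∈ g ∷ as ++ bs → w ∈ W
      inside (here refl) = nbr⊆W Xu e
      inside (there w∈) = sub w∈
    clash e f same (before₁ nx) with cut p nx
    ... | c@(cutting {as₁} {as₂} q₁ _ q₂ refl) = result Xs Xr
      (⌈ q₁ ⌉ ∙⟪ ~-sym e ⟫ flipped ⌈ q₂ ⌉ ∙⟪ ~-sym f ⟫ ⌈ p′ ⌉)
      (≤-trans (≤-trans (≤-reflexive (sym (+-assoc (gaps as₁) _ _))) (+-monoˡ-≤ (gaps bs) (cut-gaps c))) g≤)
      (↭-reflexive (sym (++-assoc as₁ as₂ bs)))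
    clash e f same (before₂ nx) with cut p′ nx
    ... | c@(cutting q₁ _ q₂ refl) = result Xs Xr
      (⌈ p ⌉ ∙⟪ e ⟫ flipped ⌈ q₁ ⌉ ∙⟪ f ⟫ ⌈ q₂ ⌉)
      (≤-trans (+-monoʳ-≤ (gaps as) (cut-gaps c)) g≤) ↭-refl

    nbr₁ : ∀ {g} → inj₁ g ∈ N u ⊎ˡ N v → u ~ g
    nbr₁ c∈ = proj₂ (∈-filter⁻ (u ~?_) {xs = allFin n} (∈-⊎ˡ₁ (N u) c∈))
    nbr₂ : ∀ {g} → inj₂ g ∈ N u ⊎ˡ N v → v ~ g
    nbr₂ c∈ = proj₂ (∈-filter⁻ (v ~?_) {xs = allFin n} (∈-⊎ˡ₂ (N u) c∈))

    injective : ∀ {c c′ b} → c ∈ N u ⊎ˡ N v → c′ ∈ N u ⊎ˡ N v → Target c b → Target c′ b → c ≡ c′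
    injective {inj₁ _} {inj₁ _} _ _ same same = refl
    injective {inj₁ _} {inj₂ _} c∈ c′∈ t t′ = ⊥-elim (clash (nbr₁ c∈) (nbr₂ c′∈) t t′)
    injective {inj₂ _} {inj₁ _} c∈ c′∈ t t′ = ⊥-elim (clash (nbr₁ c′∈) (nbr₂ c∈) t′ t)
    injective {inj₂ _} {inj₂ _} _ _ (outer _) (outer _) = refl
    injective {inj₂ _} {inj₂ _} _ _ (outer g∉) (before₁ nx) = ⊥-elim (g∉ (∈-++⁺ˡ (next-∈ˡ nx)))
    injective {inj₂ _} {inj₂ _} _ _ (outer g∉) (before₂ nx) = ⊥-elim (g∉ (∈-++⁺ʳ as (next-∈ˡ nx)))
    injective {inj₂ _} {inj₂ _} _ _ (before₁ nx) (outer g∉) = ⊥-elim (g∉ (∈-++⁺ˡ (next-∈ˡ nx)))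
    injective {inj₂ _} {inj₂ _} _ _ (before₂ nx) (outer g∉) = ⊥-elim (g∉ (∈-++⁺ʳ as (next-∈ˡ nx)))
    injective {inj₂ _} {inj₂ _} _ _ (before₁ nx) (before₁ nx′) = cong inj₂ (succ-unique (unique-++ˡ as un) nx nx′)
    injective {inj₂ _} {inj₂ _} _ _ (before₂ nx) (before₂ nx′) = cong inj₂ (succ-unique (unique-++ʳ as un) nx nx′)
    injective {inj₂ _} {inj₂ _} _ _ (before₁ nx) (before₂ nx′) = ⊥-elim (unique-disjoint as un (next-∈ˡ nx) (next-∈ˡ nx′))
    injective {inj₂ _} {inj₂ _} _ _ (before₂ nx) (before₁ nx′) = ⊥-elim (unique-disjoint as un (next-∈ˡ nx′) (next-∈ˡ nx))

    big : d + d ≤ length W′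
    big = ≤-trans (+-mono-≤ (degree≥ Xu) (degree≥ Xv)) (≤-trans (≤-reflexive (sym (⊎ˡ-length (N u) (N v))))
      (length-inj Target (⊎ˡ-unique (unique-filter (u ~?_) (allFin⁺ n)) (unique-filter (v ~?_) (allFin⁺ n))) target injective))

  -- Each bypass removes at least one jump and loses no vertex; it applies because jumps have both
  -- ends in `X`.
  close : ∀ j {q} → Chain j q → ¬ ¬ Chain 0 q
  close zero c k = k c
  close (suc j) (chain {zs = zs} Xx Xy p g≤ long un sub) k with gaps zs in eq
  ... | zero = k (chain Xx Xy p (≤-reflexive eq) long un sub)
  ... | suc i with first-gap p (subst (0 <_) (sym eq) (s≤s z≤n))
  ... | u , v , nx , Xu , Xv , isGap with cut p nx
  ... | cutting {as} {bs} p₁ e p₂ refl = bypass p₁ p₂ Xx Xu Xv Xy fewer long un sub (λ c′ → close j c′ k)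
    where
    fewer : gaps as + gaps bs ≤ j
    fewer = ≤-pred (≤-trans (≤-reflexive (sym (trans (gaps-++ p₁ e p₂) (trans (cong (λ i → gaps as + (i + gaps bs)) isGap) (+-suc (gaps as) (gaps bs)))))) (≤-trans (≤-reflexive eq) g≤))

  glue : ∀ {j q} → Chain j q → ¬ ¬ (∃[ x ] ∃[ y ] ∃[ zs ] X x × X y × Real.Walk x y zs × Unique zs × q ≤ length zs)
  glue {j} c k = close j c λ { (chain Xx Xy p g≤ long un sub) → k (_ , _ , _ , Xx , Xy , realise p (n≤0⇒n≡0 g≤) , un , long) }

-- Paths through high vertices

filter-∪∩ : {A : Set} {P Q : A → Set} (P? : Decidable P) (Q? : Decidable Q) → ∀ zs →
            length (filter P? zs) + length (filter Q? zs) ≡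
            length (filter (λ z → P? z ⊎-dec Q? z) zs) + length (filter (λ z → P? z ×-dec Q? z) zs)
filter-∪∩ P? Q? [] = refl
filter-∪∩ P? Q? (z ∷ zs) with P? z | Q? z | filter-∪∩ P? Q? zs
... | yes _ | yes _ | ih = cong suc (trans (+-suc _ _) (trans (cong suc ih) (sym (+-suc _ _))))
... | yes _ | no  _ | ih = cong suc ih
... | no  _ | yes _ | ih = trans (+-suc _ _) (cong suc ih)
... | no  _ | no  _ | ih = ih

next-++ˡ : {A : Set} {u v : A} {as bs : List A} → Next u v as → Next u v (as ++ bs)
next-++ˡ here = here
next-++ˡ (there p) = there (next-++ˡ p)

data Parity (k t : ℕ) : Set where
  odd  : k ≡ 1 + (t + t) → Parity k t
  even : k ≡ 2 + (t + t) → Parity k t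

-- The affordable ways to delete s vertices and to give up τ high ones.
data Gain (d k t s τ : ℕ) : Set where
  single : suc d ≤ s → τ ≤ t → Gain d k t s τ
  double : suc d + suc d ≤ s → τ ≤ t + t → Gain d k t s τ
  extra  : k ≡ 2 + (t + t) → suc (d + d) ≤ s + t → τ ≤ suc t → Gain d k t s τ

module HighPaths {n : ℕ} (_~_ : Fin n → Fin n → Set) (_~?_ : ∀ u v → Dec (u ~ v))
    (~-sym : ∀ {u v} → u ~ v → v ~ u) (~-irrefl : ∀ {u} → ¬ u ~ u)
    (H : Fin n → Set) (H? : Decidable H) (d k : ℕ) (k≤d : k ≤ d)
    (degree≥ : ∀ {u} → H u → d ≤ length (filter (u ~?_) (allFin n))) where

  V : Set
  V = Fin n
  open Walks _~_ ~-sym public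
  open import Data.List.Membership.DecPropositional (_≟ᶠ_ {n}) using (_∈?_) public

  N : V → List V
  N u = filter (u ~?_) (allFin n)

  ∈N⁻ : ∀ {u v} → v ∈ N u → u ~ v
  ∈N⁻ {u} p = proj₂ (∈-filter⁻ (u ~?_) {xs = allFin n} p)

  N-unique : ∀ u → Unique (N u)
  N-unique u = unique-filter (u ~?_) (allFin⁺ n)

  closedN-unique : ∀ u → Unique (u ∷ N u)
  closedN-unique u = (λ p → ~-irrefl (∈N⁻ p)) ∷ᵘ N-unique u

  high : List V → List V
  high = filter H?

  NoLongPath : Set
  NoLongPath = ∀ {x y zs} → Walk x y zs → Unique zs → length zs ≤ k

  -- `S` is deleted, `T` is only struck off the list of high vertices. `S-near` keeps `S` inside the
  -- part of the graph still in play, since edges of `_~_` will exist only there.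
  record Removal (t : ℕ) : Set where
    field
      S T       : List V
      S-unique  : Unique S
      S-near    : ∀ {s} → s ∈ S → H s ⊎ ∃[ h ] h ~ s
      untouched : ∀ {h} → H h → h ∉ T → h ∉ S × (∀ {s} → s ∈ S → ¬ h ~ s)
      gain      : Gain d k t (length S) (length T)

  escape : ∀ {x zs} → H x → x ∈ zs → length zs ≤ k → ∃[ a ] x ~ a × a ∉ zs
  escape {x} Hx x∈ le with long⇒∃∉ _≟ᶠ_ (closedN-unique x) (≤-<-trans (≤-trans le k≤d) (s≤s (degree≥ Hx)))
  ... | a , here refl , a∉ = ⊥-elim (a∉ x∈)
  ... | a , there a∈ , a∉ = a , ∈N⁻ a∈ , a∉

  -- A closed neighbourhood of a high vertex has at least d + 1 > k vertices, so either end has a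
  -- neighbour off the path, and the path grows by two.
  short : NoLongPath → ∀ {x y zs} → Walk x y zs → H x → H y → Unique zs → 2 + length zs ≤ k
  short noPath {x} {y} {zs} p Hx Hy un with escape Hx (first-∈ p) (noPath p un)
  ... | a , x~a , a∉ with noPath (step (~-sym x~a) p) (a∉ ∷ᵘ un)
  ... | le with escape Hy (there (last-∈ p)) le
  ... | b , y~b , b∉ = subst (_≤ k) (trans (length-++ (a ∷ zs)) (+-comm _ 1))
        (noPath (join (step (~-sym x~a) p) y~b stop) (unique-++ (a∉ ∷ᵘ un) ((λ ()) ∷ᵘ []) λ { v∈ (here refl) → b∉ v∈ }))

  -- A walk cut off after its last high vertex. Reroutings may leave a low end, while `Best`
  -- compares paths with two high ends.
  data Trim (u : V) (zs : List V) : Set where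
    allLow  : (∀ {v} → v ∈ zs → ¬ H v) → Trim u zs
    trimmed : ∀ {y ys} → H y → Walk u y ys → (∀ {v} → v ∈ ys → v ∈ zs) → (∀ {v} → v ∈ zs → H v → v ∈ ys) →
              (Unique zs → Unique ys) → Trim u zs

  trim : ∀ {u w zs} → Walk u w zs → Trim u zs
  trim {u} stop with H? u
  ... | yes Hu = trimmed Hu stop (λ p → p) (λ p _ → p) (λ p → p)
  ... | no ¬Hu = allLow λ { (here refl) → ¬Hu }
  trim {u} (step e p) with trim p
  ... | trimmed Hy q sub sup un = trimmed Hy (step e q) (λ { (here eq) → here eq ; (there v∈) → there (sub v∈) })
          (λ { (here eq) _ → here eq ; (there v∈) Hv → there (sup v∈ Hv) })
          (λ u′ → (head-∉ u′ ∘ sub) ∷ᵘ un (tail-unique u′))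
  ... | allLow low with H? u
  ... | yes Hu = trimmed Hu stop (λ { (here eq) → here eq }) (λ { (here eq) _ → here eq ; (there v∈) Hv → ⊥-elim (low v∈ Hv) }) (λ _ → (λ ()) ∷ᵘ [])
  ... | no ¬Hu = allLow λ { (here refl) → ¬Hu ; (there v∈) → low v∈ }

  record HPath : Set where
    constructor hpath
    field
      {x y}  : V
      {zs}   : List V
      Hx     : H x
      Hy     : H y
      walk   : Walk x y zs
      unique : Unique zs

  record Best : Set where
    field
      best  : HPath
    open HPath best public renaming (zs to xs)
    field
      richest : ∀ (P : HPath) → length (high (HPath.zs P)) ≤ length (high xs)
      longest : ∀ (P : HPath) → length (high xs) ≤ length (high (HPath.zs P)) → length (HPath.zs P) ≤ length xs

  exists-best : NoLongPath → ∀ {h} → H h → ¬ ¬ Best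
  exists-best noPath {h} Hh cont =
    maximum (λ m → Σ HPath λ P → length (high (HPath.zs P)) ≡ m) k
      (λ { m (P , refl) → ≤-trans (length-filter H? (HPath.zs P)) (noPath (HPath.walk P) (HPath.unique P)) })
      _ (hpath Hh Hh stop ((λ ()) ∷ᵘ []) , refl) λ { (m , (P , refl) , max) →
    maximum (λ p → Σ HPath λ Q → length (high (HPath.zs P)) ≤ length (high (HPath.zs Q)) × length (HPath.zs Q) ≡ p) k
      (λ { p (Q , _ , refl) → noPath (HPath.walk Q) (HPath.unique Q) })
      _ (P , ≤-refl , refl) λ { (p , (Q , le , refl) , max′) →
    cont (record { best = Q ; richest = λ R → ≤-trans (max _ (R , refl)) le
                 ; longest = λ R le′ → max′ _ (R , ≤-trans le le′ , refl) }) } }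

  module FromBest (noPath : NoLongPath) (B : Best) where
    open Best B

    M : List V
    M = high xs

    M⁻ : ∀ {v} → v ∈ M → v ∈ xs × H v
    M⁻ = ∈-filter⁻ H?

    M-unique : Unique M
    M-unique = unique-filter H? unique

    2+p≤k : 2 + length xs ≤ k
    2+p≤k = short noPath walk Hx Hy unique

    too-rich : ∀ {u w bag v} → Path u w bag → H u → Unique bag → (∀ {h} → h ∈ M → h ∈ bag) → v ∈ bag → H v → v ∉ xs → ⊥
    too-rich (path p eq) Hu un sub v∈ Hv v∉ with trim p
    ... | allLow low = low (first-∈ p) Hu
    ... | trimmed {ys = ys} Hz q _ sup un′ = <⇒≱ (length-⊆ ((v∉ ∘ proj₁ ∘ M⁻) ∷ᵘ M-unique) inside)
                                         (richest (hpath Hu Hz q (un′ (unique-↭ (↭-sym eq) un))))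
      where
      inside : ∀ {h} → h ∈ _ ∷ M → h ∈ high ys
      inside (here refl) = ∈-filter⁺ H? (sup (∈-resp-↭ (↭-sym eq) v∈) Hv) Hv
      inside (there h∈) = ∈-filter⁺ H? (sup (∈-resp-↭ (↭-sym eq) (sub h∈)) (proj₂ (M⁻ h∈))) (proj₂ (M⁻ h∈))

    too-long : ∀ {u w bag} → Path u w bag → H u → H w → Unique bag → (∀ {h} → h ∈ M → h ∈ bag) → length bag ≤ length xs
    too-long (path {zs} p eq) Hu Hw un sub = ≤-trans (≤-reflexive (sym (↭-length eq)))
      (longest (hpath Hu Hw p (unique-↭ (↭-sym eq) un))
        (length-⊆ M-unique λ h∈ → ∈-filter⁺ H? (∈-resp-↭ (↭-sym eq) (sub h∈)) (proj₂ (M⁻ h∈))))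

    record Cycle : Set where
      constructor cycle
      field
        {u w}  : V
        {bag}  : List V
        around : Path u w bag
        closes : w ~ u
        distinct : Unique bag
        through : ∀ {h} → h ∈ M → h ∈ bag

    -- Opening the cycle at `v`, at `c`, or at a neighbour of `c` in `M`, and attaching `v` if it is
    -- missing, gives a path through `M` and `v`.
    cycle-absorbs : Cycle → ∀ {v} → H v → v ∉ xs → ∀ {c} → (∃[ h ] h ∈ M × h ~ c) ⊎ c ∈ M → ¬ v ~ c
    cycle-absorbs (cycle {bag = bag} P e un sub) {v} Hv v∉ {c} near v~c with v ∈? bag
    ... | yes v∈ = too-rich (proj₂ (rotate P e v∈)) Hv un sub v∈ Hv v∉
    ... | no v∉bag with c ∈? bag
    ... | yes c∈ = too-rich (point ∙⟨ v~c ⟩ proj₂ (rotate P e c∈)) Hv (v∉bag ∷ᵘ un) (there ∘ sub) (here refl) Hv v∉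
    ... | no c∉ with near
    ... | inj₂ c∈M = c∉ (sub c∈M)
    ... | inj₁ (h , h∈ , h~c) = too-rich (point ∙⟨ v~c ⟩ point ∙⟨ ~-sym h~c ⟩ proj₂ (rotate P e (sub h∈))) Hv
            ((λ { (here refl) → ~-irrefl v~c ; (there v∈) → v∉bag v∈ }) ∷ᵘ c∉ ∷ᵘ un) (λ h∈ → there (there (sub h∈))) (here refl) Hv v∉

    x∈M : x ∈ M
    x∈M = ∈-filter⁺ H? (first-∈ walk) Hx

    M≤p : length M ≤ length xs
    M≤p = length-filter H? xs

    -- If `M` is small, the closed neighbourhood of `x` already pays for giving up all of `M`;
    -- `cycle-absorbs` keeps other high vertices away from it.
    closed-neighbourhood : ∀ {t} → Cycle → length M ≤ t → Removal t
    closed-neighbourhood C m≤t = record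
      { S = x ∷ N (x) ; T = M ; S-unique = closedN-unique _
      ; S-near = λ { (here refl) → inj₁ Hx ; (there s∈) → inj₂ (_ , ∈N⁻ s∈) }
      ; untouched = λ {h} Hh h∉ → let h∉xs = λ h∈ → h∉ (∈-filter⁺ H? h∈ Hh) in
          (λ { (here refl) → h∉ x∈M ; (there h∈) → cycle-absorbs C Hh h∉xs (inj₂ x∈M) (~-sym (∈N⁻ h∈)) }) ,
          (λ { (here refl) → cycle-absorbs C Hh h∉xs (inj₂ x∈M) ; (there s∈) → cycle-absorbs C Hh h∉xs (inj₁ (_ , x∈M , ∈N⁻ s∈)) })
      ; gain = single (s≤s (degree≥ Hx)) m≤t }

    module Sparse (noCycle : ¬ Cycle) where
      on off : V → List V
      on u  = filter (_∈? xs) (N u)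
      off u = filter (λ v → ¬? (v ∈? xs)) (N u)

      A B₀ : List V
      A = off x
      B₀ = off y

      on⁻ : ∀ {u v} → v ∈ on u → u ~ v × v ∈ xs
      on⁻ {u} p = let v∈ , q = ∈-filter⁻ (_∈? xs) {xs = N u} p in ∈N⁻ v∈ , q

      off⁻ : ∀ {u v} → v ∈ off u → u ~ v × v ∉ xs
      off⁻ {u} p = let v∈ , q = ∈-filter⁻ (λ v → ¬? (v ∈? xs)) {xs = N u} p in ∈N⁻ v∈ , q

      on-unique : ∀ u → Unique (on u)
      on-unique u = unique-filter (_∈? xs) (N-unique u)

      off-unique : ∀ u → Unique (off u)
      off-unique u = unique-filter _ (N-unique u)

      degree-split : ∀ {u} → H u → d ≤ length (on u) + length (off u)
      degree-split {u} Hu = ≤-trans (degree≥ Hu) (≤-reflexive (sym (filter-split (_∈? xs) (N u))))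

      M⊆xs : ∀ {h} → h ∈ M → h ∈ xs
      M⊆xs = proj₁ ∘ M⁻

      end-low : ∀ {u w a} → Path u w xs → u ~ a → a ∉ xs → ¬ H a
      end-low P u~a a∉ Ha = too-rich (point ∙⟨ ~-sym u~a ⟩ P) Ha (a∉ ∷ᵘ unique) (there ∘ M⊆xs) (here refl) Ha a∉

      end-untouched : ∀ {u w a v} → Path u w xs → u ~ a → a ∉ xs → H v → v ∉ xs → ¬ v ~ a
      end-untouched P u~a a∉ Hv v∉ v~a = too-rich (point ∙⟨ v~a ⟩ point ∙⟨ ~-sym u~a ⟩ P) Hv
        ((λ { (here refl) → ~-irrefl v~a ; (there v∈) → v∉ v∈ }) ∷ᵘ a∉ ∷ᵘ unique) (λ h∈ → there (there (M⊆xs h∈))) (here refl) Hv v∉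

      start-untouched : ∀ {u w v} → Path u w xs → H v → v ∉ xs → ¬ v ~ u
      start-untouched P Hv v∉ v~u = too-rich (point ∙⟨ v~u ⟩ P) Hv (v∉ ∷ᵘ unique) (there ∘ M⊆xs) (here refl) Hv v∉

      forth : Path x y xs
      forth = ⌊ walk ⌋

      AB-disjoint : ∀ {a} → a ∈ A → a ∉ B₀
      AB-disjoint a∈ a∈′ = noCycle (cycle (point ∙⟨ ~-sym (proj₁ (off⁻ {x} a∈)) ⟩ forth) (proj₁ (off⁻ {y} a∈′))
        (proj₂ (off⁻ {x} a∈) ∷ᵘ unique) (there ∘ M⊆xs))

      -- The cycle would be b ... x g ... y b.
      crossing : ∀ {b g} → Next b g xs → x ~ g → y ~ b → ⊥
      crossing nx x~g y~b with cut walk nx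
      ... | cutting p _ q eq = noCycle (cycle (⌊ p ⌋ ⁻¹ ∙⟨ x~g ⟩ ⌊ q ⌋ by ↭-reflexive (sym eq)) y~b unique M⊆xs)

      -- The predecessors of neighbours of `x` are disjoint from the neighbours of `y`, and `y` is
      -- in neither set.
      on-bound : suc (length (on x) + length (on y)) ≤ length xs
      on-bound = ≤-trans (s≤s (≤-trans (≤-reflexive (sym (⊎ˡ-length (on x) (on y))))
          (length-inj Target (⊎ˡ-unique (on-unique x) (on-unique y)) target injective)))
          (filter-notAll (λ z → ¬? (z ≟ᶠ y)) xs (Any-map (λ { refl ne → ne refl }) (last-∈ walk)))
        where
        data Target : V ⊎ V → V → Set where
          before : ∀ {g b} → Next b g xs → Target (inj₁ g) b
          same   : ∀ {g} → Target (inj₂ g) g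
        target : ∀ {c} → c ∈ on x ⊎ˡ on y → ∃[ b ] b ∈ filter (λ z → ¬? (z ≟ᶠ y)) xs × Target c b
        target {inj₁ g} c∈ with on⁻ {x} (∈-⊎ˡ₁ (on x) c∈)
        ... | x~g , g∈ with pred walk g∈
        ... | inj₁ refl = ⊥-elim (~-irrefl x~g)
        ... | inj₂ (b , nx) = b , ∈-filter⁺ (λ z → ¬? (z ≟ᶠ y)) (next-∈ˡ nx) (λ { refl → last-no-succ walk unique nx }) , before nx
        target {inj₂ g} c∈ with on⁻ {y} (∈-⊎ˡ₂ (on x) c∈)
        ... | y~g , g∈ = g , ∈-filter⁺ (λ z → ¬? (z ≟ᶠ y)) g∈ (λ { refl → ~-irrefl y~g }) , same
        injective : ∀ {c c′ b} → c ∈ on x ⊎ˡ on y → c′ ∈ on x ⊎ˡ on y → Target c b → Target c′ b → c ≡ c′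
        injective _ _ (before nx) (before nx′) = cong inj₁ (succ-unique unique nx nx′)
        injective _ _ same same = refl
        injective c∈ c′∈ (before nx) same = ⊥-elim (crossing nx (proj₁ (on⁻ {x} (∈-⊎ˡ₁ (on x) c∈))) (proj₁ (on⁻ {y} (∈-⊎ˡ₂ (on x) c′∈))))
        injective c∈ c′∈ same (before nx) = ⊥-elim (crossing nx (proj₁ (on⁻ {x} (∈-⊎ˡ₁ (on x) c′∈))) (proj₁ (on⁻ {y} (∈-⊎ˡ₂ (on x) c∈))))

      -- The two ends have degree sum at least 2d, and by `on-bound` at most d - 1 of it is spent on
      -- the path.
      AB-large : suc d ≤ length (A ++ B₀)
      AB-large = +-cancelˡ-≤ (length (on x) + length (on y)) (suc d) _ (begin
        length (on x) + length (on y) + suc d                                  ≡⟨ +-suc _ d ⟩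
        suc (length (on x) + length (on y)) + d                                ≤⟨ +-monoˡ-≤ d (≤-trans on-bound (≤-trans (m≤n+m _ 2) (≤-trans 2+p≤k k≤d))) ⟩
        d + d                                                                  ≤⟨ +-mono-≤ (degree-split Hx) (degree-split Hy) ⟩
        length (on x) + length A + (length (on y) + length B₀)                 ≡⟨ lemma (length (on x)) _ _ _ ⟩
        length (on x) + length (on y) + (length A + length B₀)                 ≡⟨ cong (length (on x) + length (on y) +_) (sym (length-++ A)) ⟩
        length (on x) + length (on y) + length (A ++ B₀)                       ∎)
        where
        open ≤-Reasoning
        lemma : ∀ a b c d → a + b + (c + d) ≡ a + c + (b + d)
        lemma = solve-∀

      AB-unique : Unique (A ++ B₀)
      AB-unique = unique-++ (off-unique x) (off-unique y) AB-disjoint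

      touch? : Decidable (λ h → Any (h ~_) (A ++ B₀))
      touch? h = any? (h ~?_) (A ++ B₀)

      T₁ : List V
      T₁ = filter touch? M

      AB-low : ∀ {s} → s ∈ A ++ B₀ → ¬ H s
      AB-low s∈ with ∈-++⁻ A s∈
      ... | inj₁ p = let e , a∉ = off⁻ {x} p in end-low forth e a∉
      ... | inj₂ p = let e , a∉ = off⁻ {y} p in end-low (forth ⁻¹) e a∉

      AB-untouched : ∀ {s v} → s ∈ A ++ B₀ → H v → v ∉ xs → ¬ v ~ s
      AB-untouched s∈ with ∈-++⁻ A s∈
      ... | inj₁ p = let e , a∉ = off⁻ {x} p in end-untouched forth e a∉
      ... | inj₂ p = let e , a∉ = off⁻ {y} p in end-untouched (forth ⁻¹) e a∉

      AB-near : ∀ {s} → s ∈ A ++ B₀ → H s ⊎ ∃[ h ] h ~ s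
      AB-near s∈ with ∈-++⁻ A s∈
      ... | inj₁ p = inj₂ (_ , proj₁ (off⁻ {x} p))
      ... | inj₂ p = inj₂ (_ , proj₁ (off⁻ {y} p))

      low? : Decidable (λ v → ¬ H v)
      low? v = ¬? (H? v)

      -- Otherwise the path could be lengthened by a (or by b).
      pred-low : ∀ {l h a} → Next l h xs → a ∈ A → h ~ a → ¬ H l
      pred-low {l} {h} {a} nx a∈ h~a Hl with cut walk nx
      ... | cutting {as} {bs} p _ q eq = <⇒≱ ≤-refl (too-long
        (⌊ p ⌋ ⁻¹ ∙⟨ proj₁ (off⁻ {x} a∈) ⟩ point ∙⟨ ~-sym h~a ⟩ ⌊ q ⌋ by ↭-trans (shift a as bs) (prep a (↭-reflexive (sym eq))))
        Hl Hy (proj₂ (off⁻ {x} a∈) ∷ᵘ unique) (there ∘ M⊆xs))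

      succ-low : ∀ {l h b} → Next h l xs → b ∈ B₀ → h ~ b → ¬ H l
      succ-low {l} {h} {b} nx b∈ h~b Hl with cut walk nx
      ... | cutting {as} {bs} p _ q eq = <⇒≱ ≤-refl (too-long
        (⌊ p ⌋ ∙⟨ h~b ⟩ point ∙⟨ ~-sym (proj₁ (off⁻ {y} b∈)) ⟩ ⌊ q ⌋ ⁻¹ by ↭-trans (shift b as bs) (prep b (↭-reflexive (sym eq))))
        Hx Hl (proj₂ (off⁻ {y} b∈) ∷ᵘ unique) (there ∘ M⊆xs))

      -- The path x ... h′ l h ... y with `l` taken out; if `l` is low, the two pieces still contain
      -- all of `M`.
      record Bracket (h′ l h : V) : Set where
        constructor bracketed
        field
          {before after} : List V
          left           : Walk x h′ before
          right          : Walk h y after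
          around         : xs ↭ l ∷ before ++ after

        rest-unique : Unique (before ++ after)
        rest-unique = tail-unique (unique-↭ around unique)

        rest⊆xs : ∀ {v} → v ∈ before ++ after → v ∈ xs
        rest⊆xs v∈ = ∈-resp-↭ (↭-sym around) (there v∈)

        M⊆rest : ¬ H l → ∀ {v} → v ∈ M → v ∈ before ++ after
        M⊆rest low v∈ with ∈-resp-↭ around (M⊆xs v∈)
        ... | here refl = ⊥-elim (low (proj₂ (M⁻ v∈)))
        ... | there v∈′ = v∈′

      bracket : ∀ {h′ l h} → Next h′ l xs → Next l h xs → Bracket h′ l h
      bracket {h′} {l} nx′ nx with cut walk nx
      ... | cutting {as} {bs} p _ q eq with pred p (last-∈ p)
      ... | inj₁ refl = ⊥-elim (first-no-pred walk unique nx′)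
      ... | inj₂ (h″ , nx″) with pred-unique unique nx′ (subst (Next h″ l) (sym eq) (next-++ˡ nx″))
      ... | refl with cut p nx″
      ... | cutting {cs} p₁ _ p₂ eq′ with loop-trivial p₂ (unique-++ʳ cs (subst Unique eq′ (unique-++ˡ as (subst Unique eq unique))))
      ... | refl = bracketed p₁ q (↭-trans (↭-reflexive (trans eq (trans (cong (_++ bs) eq′) (++-assoc cs [ l ] bs)))) (shift l cs bs))

      -- x … h′ b y … h a is a cycle through all of M, as it only skips the low vertex l.
      low-shared : ∀ {l h h′ a b} → ¬ H l → Next l h xs → a ∈ A → h ~ a → Next h′ l xs → b ∈ B₀ → h′ ~ b → ⊥
      low-shared {a = a} {b} low nx a∈ h~a nx′ b∈ h′~b with bracket nx′ nx
      ... | br@(bracketed {cs} {bs} p q _) = noCycle (cycle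
          (⌊ p ⌋ ∙⟨ h′~b ⟩ point ∙⟨ ~-sym (proj₁ (off⁻ {y} b∈)) ⟩ ⌊ q ⌋ ⁻¹ ∙⟨ h~a ⟩ point by
             ↭-trans (shift b cs (bs ++ [ a ])) (prep b (↭-trans (↭-reflexive (sym (++-assoc cs bs [ a ]))) (↭-sym (∷↭∷ʳ a (cs ++ bs))))))
          (~-sym (proj₁ (off⁻ {x} a∈)))
          ((λ { (here refl) → AB-disjoint a∈ b∈ ; (there b∈′) → proj₂ (off⁻ {y} b∈) (rest⊆xs b∈′) }) ∷ᵘ
           (λ a∈′ → proj₂ (off⁻ {x} a∈) (rest⊆xs a∈′)) ∷ᵘ rest-unique)
          (λ m∈ → there (there (M⊆rest low m∈))))
        where
        open Bracket br using (rest-unique; rest⊆xs; M⊆rest)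

      -- The constant 2 pays for `x` and `y`, which lack a predecessor or a successor to be charged.
      -- By `low-shared` no low vertex is charged from both sides.
      T₁-bound : length T₁ ≤ 2 + length (filter low? xs)
      T₁-bound = ≤-trans (length-⊆ (unique-filter touch? M-unique) splits) (+-monoʳ-≤ 2 (length-inj Target (unique-filter _ (unique-filter _ (unique-filter touch? M-unique))) target injective))
        where
        T′ : List V
        T′ = filter (λ h → ¬? (h ≟ᶠ x)) (filter (λ h → ¬? (h ≟ᶠ y)) T₁)
        splits : ∀ {h} → h ∈ T₁ → h ∈ x ∷ y ∷ T′
        splits {h} h∈ with h ≟ᶠ x | h ≟ᶠ y
        ... | yes eq | _ = here eq
        ... | no _ | yes eq = there (here eq)
        ... | no h≢x | no h≢y = there (there (∈-filter⁺ (λ h → ¬? (h ≟ᶠ x)) (∈-filter⁺ (λ h → ¬? (h ≟ᶠ y)) h∈ h≢y) h≢x))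
        data Target (h l : V) : Set where
          viaA : ∀ {a} → Next l h xs → a ∈ A → h ~ a → Target h l
          viaB : ∀ {b} → Next h l xs → b ∈ B₀ → h ~ b → Target h l
        target-low : ∀ {h l} → Target h l → ¬ H l
        target-low (viaA nx a∈ e) = pred-low nx a∈ e
        target-low (viaB nx b∈ e) = succ-low nx b∈ e
        target : ∀ {h} → h ∈ T′ → ∃[ l ] l ∈ filter low? xs × Target h l
        target {h} h∈ with ∈-filter⁻ (λ h → ¬? (h ≟ᶠ x)) {xs = filter (λ h → ¬? (h ≟ᶠ y)) T₁} h∈
        ... | h∈′ , h≢x with ∈-filter⁻ (λ h → ¬? (h ≟ᶠ y)) {xs = T₁} h∈′
        ... | h∈T₁ , h≢y with ∈-filter⁻ touch? {xs = M} h∈T₁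
        ... | h∈M , touches with find touches
        ... | s , s∈ , h~s with ∈-++⁻ A s∈
        ... | inj₁ a∈ with pred walk (M⊆xs h∈M)
        ... | inj₁ eq = ⊥-elim (h≢x eq)
        ... | inj₂ (l , nx) = l , ∈-filter⁺ low? (next-∈ˡ nx) (pred-low nx a∈ h~s) , viaA nx a∈ h~s
        target {h} h∈ | h∈′ , h≢x | h∈T₁ , h≢y | h∈M , touches | s , s∈ , h~s | inj₂ b∈ with next walk (M⊆xs h∈M)
        ... | inj₁ eq = ⊥-elim (h≢y eq)
        ... | inj₂ (l , nx) = l , ∈-filter⁺ low? (next-∈ʳ nx) (succ-low nx b∈ h~s) , viaB nx b∈ h~s
        injective : ∀ {h h′ l} → h ∈ T′ → h′ ∈ T′ → Target h l → Target h′ l → h ≡ h′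
        injective _ _ (viaA nx _ _) (viaA nx′ _ _) = succ-unique unique nx nx′
        injective _ _ (viaB nx _ _) (viaB nx′ _ _) = pred-unique unique nx nx′
        injective _ _ t@(viaA nx a∈ e) (viaB nx′ b∈ f) = ⊥-elim (low-shared (target-low t) nx a∈ e nx′ b∈ f)
        injective _ _ t@(viaB nx′ b∈ f) (viaA nx a∈ e) = ⊥-elim (low-shared (target-low t) nx a∈ e nx′ b∈ f)

      sparse-removal : ∀ {t} → length T₁ ≤ t → Removal t
      sparse-removal le = record
        { S = A ++ B₀ ; T = T₁ ; S-unique = AB-unique ; S-near = AB-near
        ; untouched = λ {h} Hh h∉ → (λ h∈ → AB-low h∈ Hh) , λ s∈ e → h∉ (∈-filter⁺ touch? (∈-filter⁺ H? (on-path s∈ e Hh) Hh) (lose s∈ e))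
        ; gain = single AB-large le }
        where
        on-path : ∀ {s h} → s ∈ A ++ B₀ → h ~ s → H h → h ∈ xs
        on-path {h = h} s∈ e Hh with h ∈? xs
        ... | yes h∈ = h∈
        ... | no h∉ = ⊥-elim (AB-untouched s∈ Hh h∉ e)

      -- The vertices that one rotation turns into an end: `Px b` yields a path from `b` to `y`, and
      -- `Py b` one from `b` to `x`, on the same vertices.
      Px Py : V → Set
      Px b = ∃[ g ] Next b g xs × x ~ g
      Py b = ∃[ g ] Next g b xs × y ~ g

      rotated-x : ∀ {b} → Px b → Path b y xs
      rotated-x (g , nx , x~g) with cut walk nx
      ... | cutting p _ q eq = ⌊ p ⌋ ⁻¹ ∙⟨ x~g ⟩ ⌊ q ⌋ by ↭-reflexive (sym eq)

      rotated-y : ∀ {b} → Py b → Path b x xs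
      rotated-y (g , nx , y~g) with cut walk nx
      ... | cutting {as} {bs} p _ q eq = ⌊ q ⌋ ∙⟨ y~g ⟩ ⌊ p ⌋ ⁻¹ by ↭-trans (++-comm bs as) (↭-reflexive (sym eq))

      next-link : ∀ {b g} → Next b g xs → b ~ g
      next-link nx = Cut.link (cut walk nx)

      -- The path without `b` closes to the cycle x ... g′ y ... g x, which would contain `M` if `b`
      -- were low.
      Pxy-high : ∀ {b} → Px b → Py b → ¬ ¬ H b
      Pxy-high (g , nx , x~g) (g′ , nx′ , y~g′) low with bracket nx′ nx
      ... | br@(bracketed p q _) = noCycle (cycle (⌊ p ⌋ ∙⟨ ~-sym y~g′ ⟩ ⌊ q ⌋ ⁻¹) (~-sym x~g)
                                     (Bracket.rest-unique br) (Bracket.M⊆rest br low))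

      module _ (Px? : Decidable Px) (Py? : Decidable Py) where

        both either : List V
        both = filter (λ b → Px? b ×-dec Py? b) xs
        either = filter (λ b → Px? b ⊎-dec Py? b) xs

        both⁻ : ∀ {b} → b ∈ both → b ∈ xs × Px b × Py b
        both⁻ = ∈-filter⁻ (λ b → Px? b ×-dec Py? b)

        either⁻ : ∀ {b} → b ∈ either → b ∈ xs × (Px b ⊎ Py b)
        either⁻ = ∈-filter⁻ (λ b → Px? b ⊎-dec Py? b)

        -- `x` has no predecessor and `y` no successor, so neither is in `both`, whose members are
        -- all high by `Pxy-high`.
        both-few : x ≢ y → 2 + length both ≤ length M
        both-few x≢y = length-⊆
          ((λ { (here eq) → x≢y eq ; (there p) → let _ , _ , (_ , nx , _) = both⁻ p in first-no-pred walk unique nx }) ∷ᵘ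
           (λ p → let _ , (_ , nx , _) , _ = both⁻ p in last-no-succ walk unique nx) ∷ᵘ unique-filter _ unique)
          λ { (here refl) → x∈M ; (there (here refl)) → ∈-filter⁺ H? (last-∈ walk) Hy
            ; (there (there p)) → let b∈ , px , py = both⁻ p in ∈-filter⁺ H? b∈ (decidable-stable (H? _) (Pxy-high px py)) }

        on-x≤ : length (on x) ≤ length (filter Px? xs)
        on-x≤ = length-inj (λ g b → Next b g xs) (on-unique x) target (λ _ _ → succ-unique unique)
          where
          target : ∀ {g} → g ∈ on x → ∃[ b ] b ∈ filter Px? xs × Next b g xs
          target g∈ with on⁻ {x} g∈
          ... | x~g , g∈xs with pred walk g∈xs
          ... | inj₁ refl = ⊥-elim (~-irrefl x~g)
          ... | inj₂ (b , nx) = b , ∈-filter⁺ Px? (next-∈ˡ nx) (_ , nx , x~g) , nx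

        on-y≤ : length (on y) ≤ length (filter Py? xs)
        on-y≤ = length-inj (λ g b → Next g b xs) (on-unique y) target (λ _ _ → pred-unique unique)
          where
          target : ∀ {g} → g ∈ on y → ∃[ b ] b ∈ filter Py? xs × Next g b xs
          target g∈ with on⁻ {y} g∈
          ... | y~g , g∈xs with next walk g∈xs
          ... | inj₁ refl = ⊥-elim (~-irrefl y~g)
          ... | inj₂ (b , nx) = b , ∈-filter⁺ Py? (next-∈ʳ nx) (_ , nx , y~g) , nx

        S₂ : List V
        S₂ = (A ++ B₀) ++ either

        S₂-unique : Unique S₂
        S₂-unique = unique-++ AB-unique (unique-filter _ unique) λ s∈ s∈′ → [ (λ p → proj₂ (off⁻ {x} p) (proj₁ (either⁻ s∈′)))
                                                                           , (λ p → proj₂ (off⁻ {y} p) (proj₁ (either⁻ s∈′))) ]′ (∈-++⁻ A s∈)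

        -- The neighbours of the ends on the path are at most |Px| + |Py| = |either| + |both|, and
        -- |both| ≤ |M| - 2. For |M| = t + 1 this is exactly the price 2d + 1 - t.
        S₂-large : x ≢ y → 2 + (d + d) ≤ length S₂ + length M
        S₂-large x≢y = +-cancelˡ-≤ (length both) _ _ (begin
          length both + (2 + (d + d))                                                         ≡⟨ lemma₁ (length both) (d + d) ⟩
          2 + length both + (d + d)                                                           ≤⟨ +-mono-≤ (both-few x≢y) (+-mono-≤ (degree-split Hx) (degree-split Hy)) ⟩
          length M + (length (on x) + length A + (length (on y) + length B₀))                 ≡⟨ lemma₂ (length M) (length (on x)) (length A) (length (on y)) (length B₀) ⟩
          length (on x) + length (on y) + (length A + length B₀ + length M)                   ≤⟨ +-monoˡ-≤ _ (+-mono-≤ on-x≤ on-y≤) ⟩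
          length (filter Px? xs) + length (filter Py? xs) + (length A + length B₀ + length M) ≡⟨ cong (_+ (length A + length B₀ + length M)) (filter-∪∩ Px? Py? xs) ⟩
          length either + length both + (length A + length B₀ + length M)                     ≡⟨ lemma₃ (length either) (length both) (length A + length B₀) (length M) ⟩
          length both + (length A + length B₀ + length either + length M)                     ≡⟨ cong (λ z → length both + (z + length M)) (sym (trans (length-++ (A ++ B₀)) (cong (_+ length either) (length-++ A)))) ⟩
          length both + (length S₂ + length M)                                                ∎)
          where
          open ≤-Reasoning
          lemma₁ : ∀ a b → a + (2 + b) ≡ 2 + a + b
          lemma₁ = solve-∀
          lemma₂ : ∀ m a b c e → m + (a + b + (c + e)) ≡ a + c + (b + e + m)
          lemma₂ = solve-∀
          lemma₃ : ∀ a b c m → a + b + (c + m) ≡ b + (c + a + m)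
          lemma₃ = solve-∀

        extra-removal : ∀ {t} → k ≡ 2 + (t + t) → x ≢ y → length M ≡ suc t → Removal t
        extra-removal {t} k≡ x≢y m≡ = record
          { S = S₂ ; T = M ; S-unique = S₂-unique ; S-near = near
          ; untouched = λ Hh h∉ → let h∉xs = λ h∈ → h∉ (∈-filter⁺ H? h∈ Hh) in
              (λ h∈ → [ (λ p → AB-low p Hh) , (λ p → h∉xs (proj₁ (either⁻ p))) ]′ (∈-++⁻ (A ++ B₀) h∈)) , avoid Hh h∉xs
          ; gain = extra k≡ (≤-pred (≤-trans (S₂-large x≢y) (≤-reflexive (trans (cong (length S₂ +_) m≡) (+-suc _ t))))) (≤-reflexive m≡) }
          where
          near : ∀ {s} → s ∈ S₂ → H s ⊎ ∃[ h ] h ~ s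
          near s∈ with ∈-++⁻ (A ++ B₀) s∈
          ... | inj₁ p = AB-near p
          ... | inj₂ p with proj₂ (either⁻ p)
          ... | inj₁ (g , nx , _) = inj₂ (g , ~-sym (next-link nx))
          ... | inj₂ (g , nx , _) = inj₂ (g , next-link nx)
          avoid : ∀ {h s} → H h → h ∉ xs → s ∈ S₂ → ¬ h ~ s
          avoid Hh h∉ s∈ with ∈-++⁻ (A ++ B₀) s∈
          ... | inj₁ p = AB-untouched p Hh h∉
          ... | inj₂ p with proj₂ (either⁻ p)
          ... | inj₁ px = start-untouched (rotated-x px) Hh h∉
          ... | inj₂ py = start-untouched (rotated-y py) Hh h∉

      M+low : length M + length (filter low? xs) ≡ length xs
      M+low = filter-split H? xs

      -- `T₁-bound` and |xs| ≤ k - 2 give |T₁| + |M| ≤ k, where |T₁| ≤ |M|. So |T₁| > t is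
      -- impossible for k = 2t + 1, and for k = 2t + 2 it leaves only |M| = t + 1, where `extra`
      -- applies.
      sparse : ∀ {t} → Parity k t → ¬ ¬ Removal t
      sparse {t} par cont with length T₁ ≤? t
      ... | yes le = cont (sparse-removal le)
      ... | no ≰ with par
      ... | odd k≡ = <⇒≱ (+-mono-≤ (≰⇒> ≰) (≰⇒> ≰)) (≤-trans both≤ (≤-trans (≤-trans 2+p≤k (≤-reflexive k≡)) (≤-reflexive (sym (+-suc t t)))))
        where
        both≤ : length T₁ + length T₁ ≤ 2 + length xs
        both≤ = ≤-trans (+-mono-≤ T₁-bound (length-filter touch? M))
          (≤-reflexive (cong (2 +_) (trans (+-comm (length (filter low? xs)) _) M+low)))
      ... | even k≡ = decide Px λ Px? → decide Py λ Py? → cont (extra-removal Px? Py? k≡ x≢y (≤-antisym m≤ t<m))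
        where
        p≤ : length xs ≤ t + t
        p≤ = ≤-pred (≤-pred (≤-trans 2+p≤k (≤-reflexive k≡)))
        t<m : suc t ≤ length M
        t<m = ≤-trans (≰⇒> ≰) (length-filter touch? M)
        m≤ : length M ≤ suc t
        m≤ = +-cancelʳ-≤ (suc t) (length M) (suc t) (begin
          length M + suc t                               ≤⟨ +-monoʳ-≤ (length M) (≤-trans (≰⇒> ≰) T₁-bound) ⟩
          length M + (2 + length (filter low? xs))       ≡⟨ lemma (length M) _ ⟩
          2 + (length M + length (filter low? xs))       ≡⟨ cong (2 +_) M+low ⟩
          2 + length xs                                  ≤⟨ +-monoʳ-≤ 2 p≤ ⟩
          2 + (t + t)                                    ≡⟨ cong suc (sym (+-suc t t)) ⟩
          suc t + suc t                                  ∎)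
          where
          open ≤-Reasoning
          lemma : ∀ a b → a + (2 + b) ≡ 2 + (a + b)
          lemma = solve-∀
        x≢y : x ≢ y
        x≢y eq with loop-trivial (subst (λ v → Walk x v xs) (sym eq) walk) unique
        ... | xs≡ = go t (≤-trans t<m (≤-trans M≤p (≤-reflexive (cong length xs≡)))) (subst (_≤ t + t) (cong length xs≡) p≤)
          where
          go : ∀ t → suc t ≤ 1 → 1 ≤ t + t → ⊥
          go zero _ ()
          go (suc t) (s≤s ()) _

-- The cycle case: a large neighbourhood of the high vertices

module Steps {n : ℕ} (_~_ : Fin n → Fin n → Set) (_~?_ : ∀ u v → Dec (u ~ v))
    (~-sym : ∀ {u v} → u ~ v → v ~ u) (~-irrefl : ∀ {u} → ¬ u ~ u)
    (H : Fin n → Set) (H? : Decidable H) (d k : ℕ) (k≤d : k ≤ d)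
    (degree≥ : ∀ {u} → H u → d ≤ length (filter (u ~?_) (allFin n))) where

  open HighPaths _~_ _~?_ ~-sym ~-irrefl H H? d k k≤d degree≥ public

  module Closed (noPath : NoLongPath) (B : Best) where
    open FromBest noPath B

    near? : Decidable (λ v → v ∈ M ⊎ Any (_~ v) M)
    near? v = (v ∈? M) ⊎-dec any? (_~? v) M

    W : List V
    W = filter near? (allFin n)

    W-unique : Unique W
    W-unique = unique-filter near? (allFin⁺ n)

    M⊆W : ∀ {v} → v ∈ M → v ∈ W
    M⊆W {v} v∈ = ∈-filter⁺ near? (∈-allFin v) (inj₁ v∈)

    N⊆W : ∀ {u v} → u ∈ M → u ~ v → v ∈ W
    N⊆W {v = v} u∈ e = ∈-filter⁺ near? (∈-allFin v) (inj₂ (lose u∈ e))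

    W-removal : ∀ {t} → Cycle → Gain d k t (length W) (length M) → Removal t
    W-removal C g = record
      { S = W ; T = M ; S-unique = W-unique ; S-near = λ s∈ → nearby (proj₂ (∈-filter⁻ near? {xs = allFin n} s∈))
      ; untouched = λ Hh h∉ → let h∉xs = λ h∈ → h∉ (∈-filter⁺ H? h∈ Hh) in
          (λ h∈ → [ h∉ , (λ a → let h′ , h′∈ , e = find a in cycle-absorbs C Hh h∉xs (inj₂ h′∈) (~-sym e)) ]′ (proj₂ (∈-filter⁻ near? {xs = allFin n} h∈))) ,
          (λ s∈ → cycle-absorbs C Hh h∉xs ([ inj₂ , (inj₁ ∘ find) ]′ (proj₂ (∈-filter⁻ near? {xs = allFin n} s∈))))
      ; gain = g }
      where
      nearby : ∀ {s} → s ∈ M ⊎ Any (_~ s) M → H s ⊎ ∃[ h ] h ~ s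
      nearby (inj₁ s∈) = inj₁ (proj₂ (M⁻ s∈))
      nearby (inj₂ a) = let h , _ , e = find a in inj₂ (h , e)

    module Selected (Xs : List V) (Xs-unique : Unique Xs) (Xs⊆M : ∀ {v} → v ∈ Xs → v ∈ M)
        (δ : ℕ) (δ+X : δ + length Xs ≡ suc d) (few : length Xs ≤ suc δ) (W-small : length W ≤ suc (d + d)) where

      X : V → Set
      X v = v ∈ Xs

      X? : Decidable X
      X? v = v ∈? Xs

      _≈_ : V → V → Set
      u ≈ v = u ~ v × ((X u × ¬ X v) ⊎ (¬ X u × X v))

      _≈?_ : ∀ u v → Dec (u ≈ v)
      u ≈? v = (u ~? v) ×-dec ((X? u ×-dec ¬? (X? v)) ⊎-dec (¬? (X? u) ×-dec X? v))

      ≈-sym : ∀ {u v} → u ≈ v → v ≈ u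
      ≈-sym (e , inj₁ (p , q)) = ~-sym e , inj₂ (q , p)
      ≈-sym (e , inj₂ (p , q)) = ~-sym e , inj₁ (q , p)

      X-high : ∀ {v} → X v → H v
      X-high = proj₂ ∘ M⁻ ∘ Xs⊆M

      Y : List V
      Y = filter (λ v → ¬? (X? v)) W

      -- `u` is itself in `X`, so its closed neighbourhood loses at most |X| of its d + 1 vertices;
      -- this is where δ = d + 1 - |X| comes from.
      Y-degree : ∀ {u} → X u → δ ≤ length (filter (u ≈?_) Y)
      Y-degree {u} Xu = +-cancelʳ-≤ (length Xs) δ _ (≤-trans (≤-reflexive δ+X) (≤-trans (s≤s (degree≥ (X-high Xu)))
          (≤-trans (length-⊆ (closedN-unique u) split) (≤-reflexive (length-++ (filter (u ≈?_) Y))))))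
        where
        split : ∀ {v} → v ∈ u ∷ N u → v ∈ filter (u ≈?_) Y ++ Xs
        split {v} v∈ with X? v
        ... | yes Xv = ∈-++⁺ʳ (filter (u ≈?_) Y) Xv
        split (here refl) | no ¬X = ⊥-elim (¬X Xu)
        split (there v∈) | no ¬X = ∈-++⁺ˡ (∈-filter⁺ (u ≈?_) (∈-filter⁺ (λ v → ¬? (X? v)) (N⊆W (Xs⊆M Xu) (∈N⁻ v∈)) ¬X) (∈N⁻ v∈ , inj₁ (Xu , ¬X)))

      Y-complete : ∀ {u v} → X u → u ≈ v → v ∈ Y
      Y-complete Xu (e , inj₁ (_ , ¬Xv)) = ∈-filter⁺ (λ v → ¬? (X? v)) (N⊆W (Xs⊆M Xu) e) ¬Xv
      Y-complete Xu (_ , inj₂ (¬Xu , _)) = ⊥-elim (¬Xu Xu)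

      open CoverCount X X? _≈_ _≈?_ ≈-sym proj₂ Y (unique-filter _ W-unique)
        (proj₂ ∘ ∈-filter⁻ (λ v → ¬? (X? v)) {xs = W})
        Y-complete
        Xs (λ p → p) δ Y-degree few
        using (Run; run; used; ∈-used⁻; IsCover; cover; minimal-cover-bound; used-length) renaming (Walk to Alternating; stop to stop≈; step to step≈)
      open Gluing _~_ _~?_ ~-sym ~-irrefl X W (λ Xu → N⊆W (Xs⊆M Xu)) d (λ Xu → degree≥ (X-high Xu)) W-small
        using (gaps; gaps-∷; gaps-++; jump; jump-edge; jump≤1; Chain; chain; glue; _≃_; ≃-sym)
      module Loose = Walks _≃_ ≃-sym

      singletons : ∀ vs → (∀ {v} → v ∈ vs → X v) → Σ (List Run) λ rs → used rs ≡ vs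
      singletons [] _ = [] , refl
      singletons (v ∷ vs) sub with singletons vs (sub ∘ there)
      ... | rs , eq = run (sub (here refl)) (sub (here refl)) stop≈ ∷ rs , cong (v ∷_) eq

      loosen : ∀ {u v zs} → Alternating u v zs → Loose.Walk u v zs × gaps zs ≡ 0
      loosen stop≈ = Loose.stop , refl
      loosen (step≈ {zs = zs} (e , _) p) with loosen p
      ... | q , eq = Loose.step (inj₁ e) q , trans (gaps-∷ q) (trans (cong (_+ gaps zs) (jump-edge e)) eq)

      -- One jump from the tail of each run to the head of the next, hence fewer gaps than runs.
      string : ∀ r rs → ∃[ y ] X y × Loose.Walk (Run.x r) y (used (r ∷ rs)) × gaps (used (r ∷ rs)) ≤ length rs
      string r [] with loosen (Run.walk r)
      ... | q , eq = Run.y r , Run.Xy r , subst (Loose.Walk _ _) (sym (++-identityʳ _)) q , ≤-reflexive (trans (cong gaps (++-identityʳ (Run.verts r))) eq)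
      string r (s ∷ rs) with loosen (Run.walk r) | string s rs
      ... | q , eq | y , Xy , q′ , le = y , Xy , Loose.join q (inj₂ (Run.Xy r , Run.Xx s)) q′ ,
            ≤-trans (≤-reflexive (trans (gaps-++ q (inj₂ (Run.Xy r , Run.Xx s)) q′) (cong (_+ (jump (Run.y r) (Run.x s) + gaps (used (s ∷ rs)))) eq))) (+-mono-≤ (jump≤1 (Run.y r) (Run.x s)) le)

      alternating⊆W : ∀ {u v zs} → Alternating u v zs → X v → ∀ {z} → z ∈ zs → z ∈ W
      alternating⊆W stop≈ Xv (here refl) = M⊆W (Xs⊆M Xv)
      alternating⊆W (step≈ (e , inj₁ (Xu , _)) p) Xv (here refl) = M⊆W (Xs⊆M Xu)
      alternating⊆W (step≈ (e , inj₂ (_ , Xz)) p) Xv (here refl) = N⊆W (Xs⊆M Xz) (~-sym e)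
      alternating⊆W (step≈ _ p) Xv (there z∈) = alternating⊆W p Xv z∈

      used-short : ∀ rs → 0 < length rs → IsCover rs → ¬ ¬ (2 + length (used rs) ≤ k)
      used-short (r ∷ rs) _ c cont with string r rs
      ... | y , Xy , q , le = glue (chain (Run.Xx r) Xy q le ≤-refl (IsCover.unique c)
              (λ v∈ → let s , _ , v∈s = ∈-used⁻ {r ∷ rs} v∈ in alternating⊆W (Run.walk s) (Run.Xy s) v∈s))
              λ { (_ , _ , _ , Xx′ , Xy′ , p , un , long) → cont (≤-trans (+-monoʳ-≤ 2 long) (short noPath p (X-high Xx′) (X-high Xy′) un)) }

      X+Y : length Xs + length Y ≤ length W
      X+Y = ≤-trans (≤-reflexive (sym (length-++ Xs))) (length-⊆
        (unique-++ Xs-unique (unique-filter _ W-unique) λ p q → proj₂ (∈-filter⁻ (λ v → ¬? (X? v)) {xs = W} q) p)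
        λ v∈ → [ M⊆W ∘ Xs⊆M , proj₁ ∘ ∈-filter⁻ (λ v → ¬? (X? v)) ]′ (∈-++⁻ Xs v∈))

      X-count : ∀ {rs} → IsCover rs → length Xs ≤ length (filter X? (used rs))
      X-count c = length-⊆ Xs-unique λ v∈ → ∈-filter⁺ X? (IsCover.covers c v∈) v∈

      cover-size : 0 < length Xs → ¬ ¬ (∃[ f ] 2 + (length Xs + length Xs) ≤ k + f × length Xs + f * δ ≤ length W)
      cover-size pos cont with singletons Xs (λ p → p)
      ... | rs₀ , eq₀ = minimum (λ f → Σ (List Run) λ rs → IsCover rs × length rs ≡ f) _
        (rs₀ , cover (subst Unique (sym eq₀) Xs-unique) (subst (_ ∈_) (sym eq₀)) , refl)
        λ { (f , (rs , c , refl) , least) →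
          used-short rs (nonempty rs c) c λ le → cont (length rs ,
            (begin
              2 + (length Xs + length Xs)                                        ≤⟨ +-monoʳ-≤ 2 (+-mono-≤ (X-count c) (X-count c)) ⟩
              2 + (length (filter X? (used rs)) + length (filter X? (used rs)))  ≡⟨ cong (2 +_) (sym (used-length c)) ⟩
              2 + (length (used rs) + length rs)                                 ≤⟨ +-monoˡ-≤ (length rs) le ⟩
              k + length rs                                                      ∎) ,
            ≤-trans (+-monoʳ-≤ (length Xs) (minimal-cover-bound rs c (λ rs′ c′ → least _ (rs′ , c′ , refl)))) X+Y) }
        where
        open ≤-Reasoning
        nonempty : ∀ rs → IsCover rs → 0 < length rs
        nonempty (_ ∷ _) _ = s≤s z≤n
        nonempty [] c with long⇒∃∉ {bs = []} _≟ᶠ_ Xs-unique pos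
        ... | v , v∈ , _ with IsCover.covers c v∈
        ... | ()

    select : ∀ m₀ δ → m₀ ≤ length M → 0 < m₀ → δ + m₀ ≡ suc d → m₀ ≤ suc δ → length W ≤ suc (d + d) →
             ¬ ¬ (∃[ f ] 2 + (m₀ + m₀) ≤ k + f × m₀ + f * δ ≤ length W)
    select m₀ δ m₀≤ pos δ+m₀ few small cont = subst Result len (cover-size (subst (0 <_) (sym len) pos)) cont
      where
      Result : ℕ → Set
      Result m = ¬ ¬ (∃[ f ] 2 + (m + m) ≤ k + f × m + f * δ ≤ length W)
      len : length (take m₀ M) ≡ m₀
      len = trans (length-take m₀ M) (m≤n⇒m⊓n≡m m₀≤)
      prefix : ∀ m (vs : List V) {v} → v ∈ take m vs → v ∈ vs
      prefix (suc m) (_ ∷ vs) (here eq) = here eq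
      prefix (suc m) (_ ∷ vs) (there p) = there (prefix m vs p)
      prefix-unique : ∀ m (vs : List V) → Unique vs → Unique (take m vs)
      prefix-unique zero _ _ = []
      prefix-unique (suc m) [] _ = []
      prefix-unique (suc m) (v ∷ vs) un = (head-∉ un ∘ prefix m vs) ∷ᵘ prefix-unique m vs (tail-unique un)
      open Selected (take m₀ M) (prefix-unique m₀ M M-unique) (prefix m₀ M) δ (trans (cong (δ +_) len) δ+m₀)
        (≤-trans (≤-reflexive len) few) small using (cover-size)

    M≤2t : ∀ {t} → Parity k t → length M ≤ t + t
    M≤2t par = ≤-pred (≤-pred (≤-trans (+-monoʳ-≤ 2 M≤p) (≤-trans 2+p≤k (bound par))))
      where
      bound : ∀ {t} → Parity k t → k ≤ 2 + (t + t)
      bound (odd refl) = n≤1+n _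
      bound (even refl) = ≤-refl

    -- If |W| ≥ 2d + 2, `double` applies. Otherwise f ≥ 3 gives |W| ≥ t + 1 + 3 (d - t), and f ≥ 4
    -- gives |W| ≥ t + 2 + 4 (d - t - 1); both exceed 2d + 1 as d ≥ k. What remains is k even with
    -- |M| = t + 1, where f ≥ 2 gives |W| ≥ 2d + 1 - t, the price in `extra`.
    closed : ∀ {t} → Parity k t → Cycle → ¬ ¬ Removal t
    closed {t} par C cont with length M ≤? t | suc d + suc d ≤? length W
    ... | yes m≤t | _ = cont (closed-neighbourhood C m≤t)
    ... | no _ | yes big = cont (W-removal C (double big (M≤2t par)))
    ... | no m≰t | no small with par
    ... | odd refl = select (suc t) (d ∸ t) t<m (s≤s z≤n) δ+ (s≤s (<⇒≤ t<δ)) W≤ λ { (f , f≥ , W≥) →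
            <⇒≱ t<δ (+-cancelˡ-≤ (δ + δ + suc t) δ t (begin
              δ + δ + suc t + δ         ≡⟨ lemma₁ δ t ⟩
              suc t + 3 * δ             ≤⟨ +-monoʳ-≤ (suc t) (*-monoˡ-≤ δ (three f f≥)) ⟩
              suc t + f * δ             ≤⟨ W≥ ⟩
              length W                  ≤⟨ W≤ ⟩
              suc (d + d)               ≡⟨ cong (λ z → suc (z + z)) d≡ ⟩
              suc (δ + t + (δ + t))     ≡⟨ lemma₂ δ t ⟩
              δ + δ + suc t + t         ∎)) }
      where
      open ≤-Reasoning
      δ = d ∸ t
      t<m = ≰⇒> m≰t
      t≤d : t ≤ d
      t≤d = ≤-trans (≤-trans (m≤m+n t t) (n≤1+n _)) k≤d
      d≡ : d ≡ δ + t
      d≡ = sym (m∸n+n≡m t≤d)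
      δ+ : δ + suc t ≡ suc d
      δ+ = trans (+-suc δ t) (cong suc (sym d≡))
      t<δ : t < δ
      t<δ = +-cancelʳ-≤ t (suc t) δ (≤-trans k≤d (≤-reflexive d≡))
      W≤ : length W ≤ suc (d + d)
      W≤ = ≤-pred (≤-trans (≰⇒> small) (≤-reflexive (cong suc (+-suc d d))))
      three : ∀ f → 2 + (suc t + suc t) ≤ suc (t + t) + f → 3 ≤ f
      three f le = +-cancelˡ-≤ (suc (t + t)) 3 f (≤-trans (≤-reflexive (lemma t)) le)
        where lemma : ∀ t → suc (t + t) + 3 ≡ 2 + (suc t + suc t)
              lemma = solve-∀
      lemma₁ : ∀ δ t → δ + δ + suc t + δ ≡ suc t + 3 * δ
      lemma₁ = solve-∀
      lemma₂ : ∀ δ t → suc (δ + t + (δ + t)) ≡ δ + δ + suc t + t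
      lemma₂ = solve-∀
    ... | even refl with length M ≤? suc t
    ... | yes m≤ = select (suc t) (d ∸ t) t<m (s≤s z≤n) δ+ (s≤s t≤δ) W≤ λ { (f , f≥ , W≥) →
            cont (W-removal C (extra refl (begin
              suc (d + d)               ≡⟨ cong (λ z → suc (z + z)) d≡ ⟩
              suc (δ + t + (δ + t))     ≡⟨ lemma₁ δ t ⟩
              suc t + 2 * δ + t         ≤⟨ +-monoˡ-≤ t (+-monoʳ-≤ (suc t) (*-monoˡ-≤ δ (two f f≥))) ⟩
              suc t + f * δ + t         ≤⟨ +-monoˡ-≤ t W≥ ⟩
              length W + t              ∎) m≤)) }
      where
      open ≤-Reasoning
      δ = d ∸ t
      t<m = ≰⇒> m≰t
      t≤d : t ≤ d
      t≤d = ≤-trans (≤-trans (m≤m+n t t) (m≤n+m _ 2)) k≤d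
      d≡ : d ≡ δ + t
      d≡ = sym (m∸n+n≡m t≤d)
      δ+ : δ + suc t ≡ suc d
      δ+ = trans (+-suc δ t) (cong suc (sym d≡))
      t≤δ : t ≤ δ
      t≤δ = +-cancelʳ-≤ t t δ (≤-trans (m≤n+m _ 2) (≤-trans k≤d (≤-reflexive d≡)))
      W≤ : length W ≤ suc (d + d)
      W≤ = ≤-pred (≤-trans (≰⇒> small) (≤-reflexive (cong suc (+-suc d d))))
      two : ∀ f → 2 + (suc t + suc t) ≤ 2 + (t + t) + f → 2 ≤ f
      two f le = +-cancelˡ-≤ (2 + (t + t)) 2 f (≤-trans (≤-reflexive (lemma t)) le)
        where lemma : ∀ t → 2 + (t + t) + 2 ≡ 2 + (suc t + suc t)
              lemma = solve-∀
      lemma₁ : ∀ δ t → suc (δ + t + (δ + t)) ≡ suc t + 2 * δ + t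
      lemma₁ = solve-∀
    ... | no m≰ = select (2 + t) (d ∸ suc t) (≰⇒> m≰) (s≤s z≤n) δ+ (s≤s t<δ) W≤ λ { (f , f≥ , W≥) →
            <⇒≱ t<δ (+-cancelˡ-≤ (δ + δ + δ + 2 + t) δ t (begin
              δ + δ + δ + 2 + t + δ     ≡⟨ lemma₁ δ t ⟩
              2 + t + 4 * δ             ≤⟨ +-monoʳ-≤ (2 + t) (*-monoˡ-≤ δ (four f f≥)) ⟩
              2 + t + f * δ             ≤⟨ W≥ ⟩
              length W                  ≤⟨ W≤ ⟩
              suc (d + d)               ≡⟨ cong (λ z → suc (z + z)) d≡ ⟩
              suc (δ + suc t + (δ + suc t))     ≡⟨ lemma₂ δ t ⟩
              δ + δ + suc t + 2 + t     ≤⟨ +-monoˡ-≤ t (+-monoˡ-≤ 2 (+-monoʳ-≤ (δ + δ) t<δ)) ⟩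
              δ + δ + δ + 2 + t         ≤⟨ m≤m+n _ t ⟩
              δ + δ + δ + 2 + t + t     ∎)) }
      where
      open ≤-Reasoning
      δ = d ∸ suc t
      t≤d : suc t ≤ d
      t≤d = ≤-trans (s≤s (≤-trans (m≤m+n t t) (n≤1+n _))) k≤d
      d≡ : d ≡ δ + suc t
      d≡ = sym (m∸n+n≡m t≤d)
      δ+ : δ + (2 + t) ≡ suc d
      δ+ = trans (+-suc δ (suc t)) (cong suc (sym d≡))
      t<δ : t < δ
      t<δ = +-cancelʳ-≤ (suc t) (suc t) δ (≤-trans (≤-reflexive (cong suc (+-suc t t))) (≤-trans k≤d (≤-reflexive d≡)))
      W≤ : length W ≤ suc (d + d)
      W≤ = ≤-pred (≤-trans (≰⇒> small) (≤-reflexive (cong suc (+-suc d d))))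
      four : ∀ f → 2 + (2 + t + (2 + t)) ≤ 2 + (t + t) + f → 4 ≤ f
      four f le = +-cancelˡ-≤ (2 + (t + t)) 4 f (≤-trans (≤-reflexive (lemma t)) le)
        where lemma : ∀ t → 2 + (t + t) + 4 ≡ 2 + (2 + t + (2 + t))
              lemma = solve-∀
      lemma₁ : ∀ δ t → δ + δ + δ + 2 + t + δ ≡ 2 + t + 4 * δ
      lemma₁ = solve-∀
      lemma₂ : ∀ δ t → suc (δ + suc t + (δ + suc t)) ≡ δ + δ + suc t + 2 + t
      lemma₂ = solve-∀

  removable : NoLongPath → ∀ {t h} → Parity k t → H h → ¬ ¬ Removal t
  removable noPath par Hh cont = exists-best noPath Hh λ B → em λ
    { (yes C) → Closed.closed noPath B par C cont
    ; (no ¬C) → FromBest.Sparse.sparse noPath B ¬C par cont }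

-- Accounting

-- u vertices pay for h high ones: blocks of d + 1 vertices pay for t each and, if k is even,
-- blocks of 2d + 1 ∸ t vertices pay for t + 1 each.
record Budget (d k t u h : ℕ) : Set where
  constructor budget
  field
    a b     : ℕ
    parity  : b ≡ 0 ⊎ k ≡ 2 + (t + t)
    enough  : a * suc d + b * (suc (d + d) ∸ t) ≤ u
    covered : h ≤ a * t + b * suc t

pay : ∀ {d k t s τ u u′ h h′} → Gain d k t s τ → s + u′ ≤ u → h ≤ τ + h′ → Budget d k t u′ h′ → Budget d k t u h
pay {d} {k} {t} {s} {τ} {u} {u′} {h} {h′} (single s≥ τ≤) su τh (budget a b p en co) = budget (suc a) b p
  (≤-trans (≤-reflexive (+-assoc (suc d) (a * suc d) _)) (≤-trans (+-mono-≤ s≥ en) su))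
  (≤-trans τh (≤-trans (+-mono-≤ τ≤ co) (≤-reflexive (sym (+-assoc t (a * t) _)))))
pay {d} {k} {t} (double s≥ τ≤) su τh (budget a b p en co) = budget (2 + a) b p
  (≤-trans (≤-reflexive (lemma (suc d) (a * suc d) _)) (≤-trans (+-mono-≤ s≥ en) su))
  (≤-trans τh (≤-trans (+-mono-≤ τ≤ co) (≤-reflexive (sym (lemma t (a * t) _)))))
  where lemma : ∀ d x y → d + (d + x) + y ≡ d + d + (x + y)
        lemma = solve-∀
pay {d} {k} {t} {s} (extra k≡ s≥ τ≤) su τh (budget a b p en co) = budget a (suc b) (inj₂ k≡)
  (≤-trans (≤-reflexive (lemma (suc (d + d) ∸ t) (a * suc d) _)) (≤-trans (+-mono-≤ (m≤n+o⇒m∸n≤o _ t (≤-trans s≥ (≤-reflexive (+-comm s t)))) en) su))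
  (≤-trans τh (≤-trans (+-mono-≤ τ≤ co) (≤-reflexive (sym (lemma (suc t) (a * t) _)))))
  where lemma : ∀ d x y → x + (d + y) ≡ d + (x + y)
        lemma = solve-∀

Adjacent : ∀ {n} → Graph n → Fin n → Fin n → Set
Adjacent G u v = adj G u v ≡ true

adjacent? : ∀ {n} (G : Graph n) u v → Dec (Adjacent G u v)
adjacent? G u v = adj G u v ≟ᵇ true

adjacent-sym : ∀ {n} (G : Graph n) {u v} → Adjacent G u v → Adjacent G v u
adjacent-sym G {u} {v} e = trans (Graph.sym G v u) e

adjacent-irrefl : ∀ {n} (G : Graph n) {u} → ¬ Adjacent G u u
adjacent-irrefl G {u} e with trans (sym e) (irrefl G u)
... | ()

PathFree : ∀ {n} → Graph n → ℕ → Set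
PathFree G k = ∀ {x y zs} → Walks.Walk (Adjacent G) (adjacent-sym G) x y zs → Unique zs → length zs ≤ k

module Accounting {n : ℕ} (G : Graph n) (d k t : ℕ) (k≤d : k ≤ d) (par : Parity k t) (free : PathFree G k) where
  open import Data.List.Membership.DecPropositional (_≟ᶠ_ {n}) using (_∈?_)

  -- Untouched high vertices have no neighbour in `S` and keep their degree inside `Us`. The
  -- recursion ends because every gain makes `S` nonempty.
  account : ∀ fuel (Us Hs : List (Fin n)) → length Us ≤ fuel → Unique Us → Unique Hs → (∀ {h} → h ∈ Hs → h ∈ Us) →
            (∀ {h} → h ∈ Hs → d ≤ length (filter (adjacent? G h) Us)) → ¬ ¬ Budget d k t (length Us) (length Hs)
  account fuel Us [] _ _ _ _ _ cont = cont (budget 0 0 (inj₁ refl) z≤n z≤n)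
  account zero [] (h ∷ Hs) z≤n uU uH sub deg cont with sub (here refl)
  ... | ()
  account (suc fuel) Us Hs@(h₀ ∷ _) le uU uH sub deg cont = removable noPath par (here refl) remove
    where
    _~_ : Fin n → Fin n → Set
    u ~ v = Adjacent G u v × u ∈ Us × v ∈ Us
    _~?_ : ∀ u v → Dec (u ~ v)
    u ~? v = adjacent? G u v ×-dec (u ∈? Us) ×-dec (v ∈? Us)
    ~-sym : ∀ {u v} → u ~ v → v ~ u
    ~-sym (e , p , q) = adjacent-sym G e , q , p
    degree≥ : ∀ {h} → h ∈ Hs → d ≤ length (filter (h ~?_) (allFin n))
    degree≥ {h} h∈ = ≤-trans (deg h∈) (length-⊆ (unique-filter (adjacent? G h) uU)
      λ {v} v∈ → let v∈U , e = ∈-filter⁻ (adjacent? G h) {xs = Us} v∈ in ∈-filter⁺ (h ~?_) (∈-allFin v) (e , sub h∈ , v∈U))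
    open Steps _~_ _~?_ ~-sym (λ e → adjacent-irrefl G (proj₁ e)) (_∈ Hs) (_∈? Hs) d k k≤d degree≥ hiding (_∈?_)
    forget : ∀ {x y zs} → Walk x y zs → Walks.Walk (Adjacent G) (adjacent-sym G) x y zs
    forget stop = Walks.stop
    forget (step (e , _) p) = Walks.step e (forget p)
    noPath : NoLongPath
    noPath p un = free (forget p) un

    t≤d : t ≤ d
    t≤d = ≤-trans (go par) k≤d
      where
      go : Parity k t → t ≤ k
      go (odd refl) = ≤-trans (m≤m+n t t) (n≤1+n _)
      go (even refl) = ≤-trans (m≤m+n t t) (m≤n+m _ 2)

    positive : ∀ {s τ} → Gain d k t s τ → 1 ≤ s
    positive (single p _) = ≤-trans (s≤s z≤n) p
    positive (double p _) = ≤-trans (s≤s z≤n) p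
    positive {s} (extra _ p _) = +-cancelʳ-≤ t 1 s (≤-trans (s≤s (≤-trans t≤d (m≤m+n d d))) p)

    remove : Removal t → ⊥
    remove R = account fuel Us′ Hs′ smaller (unique-filter _ uU) (unique-filter (λ h → ¬? (h ∈? T)) uH)
        (λ h∈ → let h∈H , h∉T = ∈-filter⁻ (λ h → ¬? (h ∈? T)) {xs = Hs} h∈ in ∈-filter⁺ (λ v → ¬? (v ∈? S)) (sub h∈H) (proj₁ (untouched h∈H h∉T)))
        deg′ (cont ∘ pay gain sizeU sizeH)
      where
      open Removal R
      Us′ = filter (λ v → ¬? (v ∈? S)) Us
      Hs′ = filter (λ h → ¬? (h ∈? T)) Hs
      S⊆U : ∀ {s} → s ∈ S → s ∈ Us
      S⊆U s∈ with S-near s∈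
      ... | inj₁ s∈H = sub s∈H
      ... | inj₂ (_ , _ , _ , s∈U) = s∈U
      sizeU : length S + length Us′ ≤ length Us
      sizeU = ≤-trans (≤-reflexive (sym (length-++ S))) (length-⊆
        (unique-++ S-unique (unique-filter _ uU) λ p q → proj₂ (∈-filter⁻ (λ v → ¬? (v ∈? S)) {xs = Us} q) p)
        λ v∈ → [ S⊆U , proj₁ ∘ ∈-filter⁻ (λ v → ¬? (v ∈? S)) ]′ (∈-++⁻ S v∈))
      sizeH : length Hs ≤ length T + length Hs′
      sizeH = ≤-trans (length-⊆ uH split) (≤-reflexive (length-++ T))
        where
        split : ∀ {h} → h ∈ Hs → h ∈ T ++ Hs′
        split {h} h∈ with h ∈? T
        ... | yes h∈T = ∈-++⁺ˡ h∈T
        ... | no  h∉T = ∈-++⁺ʳ T (∈-filter⁺ (λ h → ¬? (h ∈? T)) h∈ h∉T)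
      smaller : length Us′ ≤ fuel
      smaller = ≤-pred (≤-trans (+-monoˡ-≤ (length Us′) (positive gain)) (≤-trans sizeU le))
      deg′ : ∀ {h} → h ∈ Hs′ → d ≤ length (filter (adjacent? G h) Us′)
      deg′ {h} h∈ with ∈-filter⁻ (λ h → ¬? (h ∈? T)) {xs = Hs} h∈
      ... | h∈H , h∉T = ≤-trans (deg h∈H) (length-⊆ (unique-filter (adjacent? G h) uU) λ {v} v∈ →
            let v∈U , e = ∈-filter⁻ (adjacent? G h) {xs = Us} v∈ in
            ∈-filter⁺ (adjacent? G h) (∈-filter⁺ (λ v → ¬? (v ∈? S)) v∈U (λ v∈S → proj₂ (untouched h∈H h∉T) v∈S (e , sub h∈H , v∈U))) e)

degree≡ : ∀ {n} (G : Graph n) v → degree G v ≡ length (filter (adjacent? G v) (allFin n))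
degree≡ {n} G v = go (allFin n)
  where
  go : ∀ us → sum (map (λ u → if adj G v u then 1 else 0) us) ≡ length (filter (adjacent? G v) us)
  go [] = refl
  go (u ∷ us) with adj G v u
  ... | true  = cong suc (go us)
  ... | false = go us

high-budget : ∀ {n d k t} (G : Graph n) → k ≤ d → Parity k t → PathFree G k → ¬ ¬ Budget d k t n (numHighDeg G d)
high-budget {n} {d} {k} {t} G k≤d par free cont = account n (allFin n) Hs (≤-reflexive (length-tabulate (λ i → i))) (allFin⁺ n)
    (unique-filter (λ i → d ≤? degree G i) (allFin⁺ n)) (λ {h} _ → ∈-allFin h)
    (λ {h} h∈ → subst (d ≤_) (degree≡ G h) (proj₂ (∈-filter⁻ (λ i → d ≤? degree G i) {xs = allFin n} h∈)))
    (cont ∘ subst (λ u → Budget d k t u (length Hs)) (length-tabulate (λ i → i)))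
  where
  open Accounting G d k t k≤d par free
  Hs = filter (λ i → d ≤? degree G i) (allFin n)

-- Upper bounds

-- Exhaustive search over tuples decides whether a path exists, so that refuting its absence
-- produces one.
anyVec? : ∀ {n} m {P : Vec (Fin n) m → Set} → Decidable P → Dec (∃[ xs ] P xs)
anyVec? zero P? = mapDec ([] ,_) (λ { ([] , p) → p }) (P? [])
anyVec? (suc m) P? = mapDec (λ { (x , xs , p) → x ∷ xs , p }) (λ { (x ∷ xs , p) → x , xs , p })
                            (anyᶠ? λ x → anyVec? m λ xs → P? (x ∷ xs))

module _ {n : ℕ} (G : Graph n) where
  open Walks (Adjacent G) (adjacent-sym G)

  IsPathVec : ∀ k → Vec (Fin n) (suc k) → Set
  IsPathVec k xs = (∀ i j → lookupᵛ xs i ≡ lookupᵛ xs j → i ≡ j) ×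
                   (∀ (i : Fin k) → Adjacent G (lookupᵛ xs (inject₁ i)) (lookupᵛ xs (suc i)))

  isPathVec? : ∀ k → Decidable (IsPathVec k)
  isPathVec? k xs = (allᶠ? λ i → allᶠ? λ j → (lookupᵛ xs i ≟ᶠ lookupᵛ xs j) →-dec (i ≟ᶠ j)) ×-dec
                    (allᶠ? λ i → adjacent? G (lookupᵛ xs (inject₁ i)) (lookupᵛ xs (suc i)))

  prefix : ∀ k {x y zs} → Walk x y zs → Unique zs → suc k ≤ length zs →
           ∃[ xs ] lookupᵛ xs zero ≡ x × (∀ i → lookupᵛ xs i ∈ zs) × IsPathVec k xs
  prefix zero {x} p un le = x ∷ [] , refl , (λ { zero → first-∈ p }) , (λ { zero zero _ → refl }) , λ ()
  prefix (suc k) stop un (s≤s ())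
  prefix (suc k) {x} (step {zs = zs} e p) un (s≤s le) with prefix k p (tail-unique un) le
  ... | xs , eq , inside , inj , adjs = x ∷ xs , refl , inside′ , inj′ , adjs′
    where
    inside′ : ∀ i → lookupᵛ (x ∷ xs) i ∈ x ∷ zs
    inside′ zero = here refl
    inside′ (suc i) = there (inside i)
    inj′ : ∀ i j → lookupᵛ (x ∷ xs) i ≡ lookupᵛ (x ∷ xs) j → i ≡ j
    inj′ zero zero _ = refl
    inj′ zero (suc j) eq = ⊥-elim (head-∉ un (subst (_∈ zs) (sym eq) (inside j)))
    inj′ (suc i) zero eq = ⊥-elim (head-∉ un (subst (_∈ zs) eq (inside i)))
    inj′ (suc i) (suc j) eq = cong suc (inj i j eq)
    adjs′ : ∀ i → Adjacent G (lookupᵛ (x ∷ xs) (inject₁ i)) (lookupᵛ xs i)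
    adjs′ zero = subst (Adjacent G x) (sym eq) e
    adjs′ (suc i) = adjs i

  contains-or-free : ∀ k → ContainsPathOn G k ⊎ PathFree G k
  contains-or-free k with anyVec? (suc k) (isPathVec? k)
  ... | yes (xs , inj , adjs) = inj₁ (lookupᵛ xs , (λ {i} {j} → inj i j) , adjs)
  ... | no ¬p = inj₂ λ p un → ≮⇒≥ λ lt → let xs , _ , _ , isPath = prefix k p un lt in ¬p (xs , isPath)

forces : ∀ {n d k t φ} → k ≤ d → Parity k t → (∀ {h} → Budget d k t n h → h < φ) → Forces n d k φ
forces {k = k} k≤d par bound G φ≤ with contains-or-free G k
... | inj₁ p = p
... | inj₂ free = ⊥-elim (high-budget G k≤d par free λ b → <⇒≱ (bound b) φ≤)

-- A single high vertex is already a path with high ends, and `short` allows such a path only k - 2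
-- = 0 vertices.
forces-k=2 : ∀ {n d} → 2 ≤ d → Forces n d 2 1
forces-k=2 {n} {d} 2≤d G h≥1 with contains-or-free G 2
... | inj₁ p = p
... | inj₂ free with filter (λ i → d ≤? degree G i) (allFin n) in eq
forces-k=2 {n} {d} 2≤d G () | inj₂ free | []
... | h ∷ _ = ⊥-elim (3≰2 (short free stop Hh Hh ((λ ()) ∷ᵘ [])))
  where
  open HighPaths (Adjacent G) (adjacent? G) (adjacent-sym G) (adjacent-irrefl G) (λ v → d ≤ degree G v) (λ v → d ≤? degree G v)
    d 2 2≤d (λ {u} le → ≤-trans le (≤-reflexive (degree≡ G u))) using (short; stop)
  Hh : d ≤ degree G h
  Hh = proj₂ (∈-filter⁻ (λ i → d ≤? degree G i) {xs = allFin n} (subst (h ∈_) (sym eq) (here refl)))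
  3≰2 : ¬ 3 ≤ 2
  3≰2 (s≤s (s≤s ()))

-- From budgets to the formulas

quotient-max : ∀ a q {r D} → r < D → a * D ≤ q * D + r → a ≤ q
quotient-max a q {r} {D} r<D le = ≮⇒≥ λ q<a → <⇒≱ (≤-<-trans le (+-monoʳ-< (q * D) r<D))
  (≤-trans (≤-reflexive (+-comm (q * D) D)) (*-monoˡ-≤ D q<a))

module _ {d k t n h : ℕ} (b : Budget d k t n h) where
  open Budget b

  odd-bound : k ≡ 1 + (t + t) → ∀ q r → n ≡ q * suc d + r → r ≤ d → h < t * q + 1
  odd-bound k≡ q r refl r≤d with parity
  ... | inj₂ k≡′ = ⊥-elim (1+n≢n (sym (trans (sym k≡) k≡′)))
  ... | inj₁ refl = ≤-trans (s≤s (begin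
        h                ≤⟨ covered ⟩
        a * t + 0        ≡⟨ +-identityʳ _ ⟩
        a * t            ≤⟨ *-monoˡ-≤ t (quotient-max a q (s≤s r≤d) (≤-trans (≤-reflexive (sym (+-identityʳ _))) enough)) ⟩
        q * t            ≡⟨ *-comm q t ⟩
        t * q            ∎)) (≤-reflexive (+-comm 1 (t * q)))
    where open ≤-Reasoning

-- Two blocks of 2d + 1 ∸ t vertices are worth less than three blocks of d + 1.
normalise : ∀ {d t n h} → suc (t + t) ≤ d → 2 ≤ t → ∀ a b → a * suc d + b * (suc (d + d) ∸ t) ≤ n → h ≤ a * t + b * suc t →
            ∃[ a′ ] ((a′ * suc d ≤ n × h ≤ a′ * t) ⊎ (suc a′ * suc d + (d ∸ t) ≤ n × h ≤ suc a′ * t + 1))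
normalise {d} {t} {n} {h} _ _ a 0 en co = a , inj₁ (≤-trans (≤-reflexive (sym (+-identityʳ _))) en , ≤-trans co (≤-reflexive (+-identityʳ _)))
normalise {d} {t} {n} {h} td _ a 1 en co = a , inj₂
  (≤-trans (≤-reflexive (trans (lemma (a * suc d) (suc d) (d ∸ t)) (cong (λ z → a * suc d + (z + 0)) (sym (+-∸-assoc (suc d) t≤d))))) en ,
   ≤-trans co (≤-reflexive (lemma′ (a * t) t)))
  where
  t≤d : t ≤ d
  t≤d = ≤-trans (≤-trans (m≤m+n t t) (n≤1+n _)) td
  lemma : ∀ a D e → D + a + e ≡ a + (D + e + 0)
  lemma = solve-∀
  lemma′ : ∀ a t → a + (suc t + 0) ≡ t + a + 1
  lemma′ = solve-∀
normalise {d} {t} {n} {h} td 2≤t a (suc (suc b)) en co = normalise td 2≤t (3 + a) b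
  (begin
    (3 + a) * suc d + b * B                       ≡⟨ lemma₁ (suc d) (a * suc d) (b * B) ⟩
    (suc d + (suc d + suc d)) + (a * suc d + b * B) ≤⟨ +-monoˡ-≤ _ threeD ⟩
    (B + B) + (a * suc d + b * B)                 ≡⟨ lemma₂ B (a * suc d) (b * B) ⟩
    a * suc d + (B + (B + b * B))                 ≤⟨ en ⟩
    n                                             ∎)
  (begin
    h                                             ≤⟨ co ⟩
    a * t + (suc t + (suc t + b * suc t))         ≡⟨ lemma₃ t (a * t) (b * suc t) ⟩
    t + (t + 2) + (a * t + b * suc t)             ≤⟨ +-monoˡ-≤ _ (+-monoʳ-≤ t (+-monoʳ-≤ t 2≤t)) ⟩
    t + (t + t) + (a * t + b * suc t)             ≡⟨ lemma₁ t (a * t) (b * suc t) ⟨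
    (3 + a) * t + b * suc t                       ∎)
  where
  open ≤-Reasoning
  B = suc (d + d) ∸ t
  t≤2d : t ≤ suc (d + d)
  t≤2d = ≤-trans (≤-trans (m≤m+n t t) (n≤1+n _)) (≤-trans td (≤-trans (m≤m+n d d) (n≤1+n _)))
  lemma₁ : ∀ D x y → D + (D + (D + x)) + y ≡ (D + (D + D)) + (x + y)
  lemma₁ = solve-∀
  lemma₂ : ∀ B x y → (B + B) + (x + y) ≡ x + (B + (B + y))
  lemma₂ = solve-∀
  lemma₃ : ∀ t x y → x + (suc t + (suc t + y)) ≡ t + (t + 2) + (x + y)
  lemma₃ = solve-∀
  threeD : suc d + (suc d + suc d) ≤ B + B
  threeD = +-cancelʳ-≤ (t + t) _ _ (begin
    suc d + (suc d + suc d) + (t + t)    ≡⟨ eq₁ d (t + t) ⟩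
    d + d + d + 2 + suc (t + t)          ≤⟨ +-monoʳ-≤ (d + d + d + 2) td ⟩
    d + d + d + 2 + d                    ≡⟨ eq₂ d ⟩
    suc (d + d) + suc (d + d)            ≡⟨ cong (λ z → z + z) (sym (m∸n+n≡m t≤2d)) ⟩
    B + t + (B + t)                      ≡⟨ eq₃ B t ⟩
    B + B + (t + t)                      ∎)
    where
    eq₁ : ∀ d x → suc d + (suc d + suc d) + x ≡ d + d + d + 2 + suc x
    eq₁ = solve-∀
    eq₂ : ∀ d → d + d + d + 2 + d ≡ suc (d + d) + suc (d + d)
    eq₂ = solve-∀
    eq₃ : ∀ B t → B + t + (B + t) ≡ B + B + (t + t)
    eq₃ = solve-∀

-- At most one block of 2d + 1 - t survives; over a block of d + 1 it costs d - t more vertices and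
-- gains 1. If fewer than q blocks are used, a further block of d + 1 would gain t ≥ 1 anyway; if
-- all q are used, the d - t vertices must come out of r.
even-bound : ∀ {d k t n h} → Budget d k t n h → 2 ≤ t → suc (t + t) ≤ d → ∀ q r → n ≡ q * suc d + r → r ≤ d →
             h ≤ t * q ⊎ (h ≤ t * q + 1 × d < r + (t + 1))
even-bound {d} {k} {t} {n} {h} (budget a b _ en co) 2≤t td q r refl r≤d with normalise td 2≤t a b en co
... | a′ , inj₁ (en′ , co′) = inj₁ (≤-trans co′ (≤-trans (*-monoˡ-≤ t (quotient-max a′ q (s≤s r≤d) en′)) (≤-reflexive (*-comm q t))))
... | a′ , inj₂ (en′ , co′) with m≤n⇒m<n∨m≡n (quotient-max (suc a′) q (s≤s r≤d) (≤-trans (m≤m+n _ (d ∸ t)) en′))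
... | inj₁ lt = inj₁ (begin
      h                     ≤⟨ co′ ⟩
      suc a′ * t + 1        ≤⟨ +-monoʳ-≤ (suc a′ * t) (≤-trans (s≤s z≤n) 2≤t) ⟩
      suc a′ * t + t        ≡⟨ +-comm _ t ⟩
      suc (suc a′) * t      ≤⟨ *-monoˡ-≤ t lt ⟩
      q * t                 ≡⟨ *-comm q t ⟩
      t * q                 ∎)
  where open ≤-Reasoning
... | inj₂ refl = inj₂ (≤-trans co′ (≤-reflexive (cong (_+ 1) (*-comm q t))) , (begin
      suc d                 ≡⟨ cong suc (sym (m∸n+n≡m t≤d)) ⟩
      suc (d ∸ t + t)       ≤⟨ s≤s (+-monoˡ-≤ t (+-cancelˡ-≤ (q * suc d) (d ∸ t) r en′)) ⟩
      suc (r + t)           ≡⟨ trans (sym (+-suc r t)) (cong (r +_) (+-comm 1 t)) ⟩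
      r + (t + 1)           ∎))
  where
  open ≤-Reasoning
  t≤d : t ≤ d
  t≤d = ≤-trans (≤-trans (m≤m+n t t) (n≤1+n _)) td

-- For t = 1 the trade goes the other way: a block of 2d is worth as much as two blocks of d + 1.
-- Traded in pairs, at most one of the latter is left, which is why n is divided by 2d.
four-bound : ∀ {d k n h} → Budget d k 1 n h → 1 ≤ d → ∀ q r → n ≡ 2 * q * d + r → r < 2 * d →
             h ≤ 2 * q ⊎ (h ≤ 2 * q + 1 × d < r)
four-bound {d} {k} {n} {h} (budget a b _ en co) 1≤d q r refl r<2d = go a b en co
  where
  open ≤-Reasoning
  n≡ : 2 * q * d + r ≡ q * (2 * d) + r
  n≡ = cong (_+ r) (trans (cong (_* d) (*-comm 2 q)) (*-assoc q 2 d))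
  2d≡ : d + d ≡ 2 * d
  2d≡ = cong (d +_) (sym (+-identityʳ d))
  go : ∀ a b → a * suc d + b * (d + d) ≤ 2 * q * d + r → h ≤ a * 1 + b * 2 → h ≤ 2 * q ⊎ (h ≤ 2 * q + 1 × d < r)
  go 0 b en co = inj₁ (≤-trans co (≤-trans (≤-reflexive (*-comm b 2)) (*-monoʳ-≤ 2 (quotient-max b q r<2d
    (≤-trans (≤-reflexive (cong (b *_) (sym 2d≡))) (≤-trans en (≤-reflexive n≡)))))))
  go 1 b en co with m≤n⇒m<n∨m≡n (quotient-max b q r<2d (≤-trans (≤-reflexive (cong (b *_) (sym 2d≡))) (≤-trans (m≤n+m _ _) (≤-trans en (≤-reflexive n≡)))))
  ... | inj₁ lt = inj₁ (≤-trans co (≤-trans (n≤1+n _) (≤-trans (*-monoˡ-≤ 2 lt) (≤-reflexive (*-comm q 2)))))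
  ... | inj₂ refl = inj₂ (≤-trans co (≤-reflexive (trans (+-comm 1 (b * 2)) (cong (_+ 1) (*-comm b 2)))) ,
        +-cancelˡ-≤ (b * (d + d)) (suc d) r (begin
          b * (d + d) + suc d               ≡⟨ trans (+-comm _ (suc d)) (cong (_+ b * (d + d)) (sym (+-identityʳ (suc d)))) ⟩
          1 * suc d + b * (d + d)           ≤⟨ en ⟩
          2 * b * d + r                     ≡⟨ trans n≡ (cong (λ z → b * z + r) (sym 2d≡)) ⟩
          b * (d + d) + r                   ∎))
  go (suc (suc a)) b en co = go a (suc b)
    (begin
      a * suc d + (d + d + b * (d + d))             ≤⟨ m≤n+m _ 2 ⟩
      2 + (a * suc d + (d + d + b * (d + d)))       ≡⟨ lemma d (a * suc d) (b * (d + d)) ⟩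
      suc (suc a) * suc d + b * (d + d)             ≤⟨ en ⟩
      2 * q * d + r                                 ∎)
    (≤-trans co (≤-reflexive (lemma′ (a * 1) (b * 2))))
    where
    lemma : ∀ d x y → 2 + (x + (d + d + y)) ≡ suc d + (suc d + x) + y
    lemma = solve-∀
    lemma′ : ∀ x y → 1 + (1 + x) + y ≡ x + (2 + y)
    lemma′ = solve-∀

-- Extremal graphs

-- `highs` may omit vertices of large degree: refuting `Forces` takes a lower bound on their number.
record Extremal (d k n h : ℕ) : Set where
  field
    graph       : Graph n
    free        : PathFree graph k
    highs       : List (Fin n)
    distinct    : Unique highs
    count       : length highs ≡ h
    neighbours  : ∀ {v} → v ∈ highs → ∃[ us ] Unique us × d ≤ length us × (∀ {u} → u ∈ us → Adjacent graph v u)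

module _ {n : ℕ} (G : Graph n) where
  open Walks (Adjacent G) (adjacent-sym G)

  tabulate-walk : ∀ k (f : Fin (suc k) → Fin n) → (∀ i → Adjacent G (f (inject₁ i)) (f (suc i))) →
                  ∃[ y ] Walk (f zero) y (tabulateˡ f)
  tabulate-walk zero f adjs = f zero , stop
  tabulate-walk (suc k) f adjs = let y , p = tabulate-walk k (f ∘ suc) (adjs ∘ suc) in y , step (adjs zero) p

  free⇒¬contains : ∀ {k} → PathFree G k → ¬ ContainsPathOn G k
  free⇒¬contains {k} free (f , inj , adjs) = <⇒≱ ≤-refl (≤-trans (≤-reflexive (sym (length-tabulate f)))
    (free (proj₂ (tabulate-walk k f adjs)) (tabulate⁺ inj)))

not-forced : ∀ {d k n h m} → Extremal d k n h → m ≤ h → ¬ Forces n d k m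
not-forced {d} {k} {n} {h} E m≤h F = free⇒¬contains graph free (F graph (≤-trans m≤h (≤-trans (≤-reflexive (sym count))
    (length-⊆ distinct λ {v} v∈ → ∈-filter⁺ (λ i → d ≤? degree graph i) (∈-allFin v) (high v∈)))))
  where
  open Extremal E
  high : ∀ {v} → v ∈ highs → d ≤ degree graph v
  high {v} v∈ with neighbours v∈
  ... | us , un , d≤ , adjs = ≤-trans d≤ (≤-trans (length-⊆ un λ {u} u∈ → ∈-filter⁺ (adjacent? graph v) (∈-allFin u) (adjs u∈))
                                               (≤-reflexive (sym (degree≡ graph v))))

empty : ∀ {d k} n → 1 ≤ k → Extremal d k n 0
empty {d} {k} n 1≤k = record
  { graph = G ; free = free′ ; highs = [] ; distinct = [] ; count = refl ; neighbours = λ () }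
  where
  G : Graph n
  G = record { adj = λ _ _ → false ; sym = λ _ _ → refl ; irrefl = λ _ → refl }
  free′ : PathFree G k
  free′ Walks.stop _ = 1≤k
  free′ (Walks.step () _) _

module _ {d k n₁ h₁ n₂ h₂ : ℕ} (E₁ : Extremal d k n₁ h₁) (E₂ : Extremal d k n₂ h₂) where
  private
    module E₁ = Extremal E₁
    module E₂ = Extremal E₂

    side : Fin n₁ ⊎ Fin n₂ → Fin n₁ ⊎ Fin n₂ → Bool
    side (inj₁ i) (inj₁ j) = adj E₁.graph i j
    side (inj₂ i) (inj₂ j) = adj E₂.graph i j
    side _ _ = false

    side-sym : ∀ a b → side a b ≡ side b a
    side-sym (inj₁ i) (inj₁ j) = Graph.sym E₁.graph i j
    side-sym (inj₂ i) (inj₂ j) = Graph.sym E₂.graph i j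
    side-sym (inj₁ _) (inj₂ _) = refl
    side-sym (inj₂ _) (inj₁ _) = refl

    side-irrefl : ∀ a → side a a ≡ false
    side-irrefl (inj₁ i) = irrefl E₁.graph i
    side-irrefl (inj₂ i) = irrefl E₂.graph i

    G : Graph (n₁ + n₂)
    G = record { adj = λ i j → side (splitAt n₁ i) (splitAt n₁ j) ; sym = λ i j → side-sym (splitAt n₁ i) (splitAt n₁ j)
               ; irrefl = λ i → side-irrefl (splitAt n₁ i) }

    edge₁ : ∀ {i j} → Adjacent E₁.graph i j → Adjacent G (i ↑ˡ n₂) (j ↑ˡ n₂)
    edge₁ {i} {j} e rewrite splitAt-↑ˡ n₁ i n₂ | splitAt-↑ˡ n₁ j n₂ = e

    edge₂ : ∀ {i j} → Adjacent E₂.graph i j → Adjacent G (n₁ ↑ʳ i) (n₁ ↑ʳ j)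
    edge₂ {i} {j} e rewrite splitAt-↑ʳ n₁ n₂ i | splitAt-↑ʳ n₁ n₂ j = e

    W W₁ W₂ : _ → _ → _ → Set
    W = Walks.Walk (Adjacent G) (adjacent-sym G)
    W₁ = Walks.Walk (Adjacent E₁.graph) (adjacent-sym E₁.graph)
    W₂ = Walks.Walk (Adjacent E₂.graph) (adjacent-sym E₂.graph)

    -- No edge changes sides, so a walk in the union comes from one summand.
    left : ∀ {x y zs i} → W x y zs → splitAt n₁ x ≡ inj₁ i → ∃[ j ] ∃[ zs′ ] zs ≡ map (_↑ˡ n₂) zs′ × W₁ i j zs′
    left {i = i} Walks.stop eq = i , _ , cong (_∷ []) (sym (splitAt⁻¹-↑ˡ eq)) , Walks.stop
    left {i = i} (Walks.step {z = z} e p) eq with splitAt n₁ z in eq′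
    ... | inj₁ i′ = let j , zs′ , eqs , q = left p eq′ in
          j , i ∷ zs′ , cong₂ _∷_ (sym (splitAt⁻¹-↑ˡ eq)) eqs , Walks.step (trans (cong (λ a → side a (inj₁ i′)) (sym eq)) e) q
    ... | inj₂ i′ with trans (cong (λ a → side a (inj₂ i′)) (sym eq)) e
    ... | ()

    right : ∀ {x y zs i} → W x y zs → splitAt n₁ x ≡ inj₂ i → ∃[ j ] ∃[ zs′ ] zs ≡ map (n₁ ↑ʳ_) zs′ × W₂ i j zs′
    right {i = i} Walks.stop eq = i , _ , cong (_∷ []) (sym (splitAt⁻¹-↑ʳ eq)) , Walks.stop
    right {i = i} (Walks.step {z = z} e p) eq with splitAt n₁ z in eq′
    ... | inj₂ i′ = let j , zs′ , eqs , q = right p eq′ in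
          j , i ∷ zs′ , cong₂ _∷_ (sym (splitAt⁻¹-↑ʳ eq)) eqs , Walks.step (trans (cong (λ a → side a (inj₂ i′)) (sym eq)) e) q
    ... | inj₁ i′ with trans (cong (λ a → side a (inj₁ i′)) (sym eq)) e
    ... | ()

    free′ : PathFree G k
    free′ {x} p un with splitAt n₁ x in eq
    ... | inj₁ i with left p eq
    ... | _ , zs′ , refl , q = ≤-trans (≤-reflexive (length-map (_↑ˡ n₂) zs′)) (E₁.free q (unique-map⁻ un))
    free′ {x} p un | inj₂ i with right p eq
    ... | _ , zs′ , refl , q = ≤-trans (≤-reflexive (length-map (n₁ ↑ʳ_) zs′)) (E₂.free q (unique-map⁻ un))

    ↑-disjoint : ∀ {i : Fin n₁} {j : Fin n₂} → i ↑ˡ n₂ ≡ n₁ ↑ʳ j → ⊥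
    ↑-disjoint {i} {j} eq with trans (sym (splitAt-↑ˡ n₁ i n₂)) (trans (cong (splitAt n₁) eq) (splitAt-↑ʳ n₁ n₂ j))
    ... | ()

  disjointUnion : Extremal d k (n₁ + n₂) (h₁ + h₂)
  disjointUnion = record
    { graph = G ; free = free′
    ; highs = map (_↑ˡ n₂) E₁.highs ++ map (n₁ ↑ʳ_) E₂.highs
    ; distinct = unique-++ (unique-map (↑ˡ-injective n₂ _ _) E₁.distinct) (unique-map (↑ʳ-injective n₁ _ _) E₂.distinct)
        λ p q → let _ , _ , eq = ∈-map⁻ (_↑ˡ n₂) p ; _ , _ , eq′ = ∈-map⁻ (n₁ ↑ʳ_) q in ↑-disjoint (trans (sym eq) eq′)
    ; count = trans (length-++ (map (_↑ˡ n₂) E₁.highs)) (cong₂ _+_ (trans (length-map _ E₁.highs) E₁.count) (trans (length-map _ E₂.highs) E₂.count))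
    ; neighbours = nb }
    where
    nb : ∀ {v} → v ∈ map (_↑ˡ n₂) E₁.highs ++ map (n₁ ↑ʳ_) E₂.highs → ∃[ us ] Unique us × d ≤ length us × (∀ {u} → u ∈ us → Adjacent G v u)
    nb v∈ with ∈-++⁻ (map (_↑ˡ n₂) E₁.highs) v∈
    ... | inj₁ p with ∈-map⁻ (_↑ˡ n₂) p
    ... | i , i∈ , refl with E₁.neighbours i∈
    ... | us , un , d≤ , adjs = map (_↑ˡ n₂) us , unique-map (↑ˡ-injective n₂ _ _) un , ≤-trans d≤ (≤-reflexive (sym (length-map _ us))) ,
          λ u∈ → let j , j∈ , eq = ∈-map⁻ (_↑ˡ n₂) u∈ in subst (Adjacent G _) (sym eq) (edge₁ (adjs j∈))
    nb v∈ | inj₂ p with ∈-map⁻ (n₁ ↑ʳ_) p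
    ... | i , i∈ , refl with E₂.neighbours i∈
    ... | us , un , d≤ , adjs = map (n₁ ↑ʳ_) us , unique-map (↑ʳ-injective n₁ _ _) un , ≤-trans d≤ (≤-reflexive (sym (length-map _ us))) ,
          λ u∈ → let j , j∈ , eq = ∈-map⁻ (n₁ ↑ʳ_) u∈ in subst (Adjacent G _) (sym eq) (edge₂ (adjs j∈))

copies : ∀ {d k n h} → 1 ≤ k → ∀ q → Extremal d k n h → Extremal d k (q * n) (q * h)
copies 1≤k zero E = empty 0 1≤k
copies 1≤k (suc q) E = disjointUnion E (copies 1≤k q E)

-- Blocks of hubs, a centre, leaves and satellites

data Role : Set where
  hub centre leaf satellite : Role

joined : Role → Role → Bool
joined hub hub = true
joined hub centre = true
joined hub satellite = true
joined centre hub = true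
joined satellite hub = true
joined centre leaf = true
joined leaf centre = true
joined _ _ = false

joined-sym : ∀ r s → joined r s ≡ joined s r
joined-sym hub hub = refl
joined-sym hub centre = refl
joined-sym hub leaf = refl
joined-sym hub satellite = refl
joined-sym centre hub = refl
joined-sym centre centre = refl
joined-sym centre leaf = refl
joined-sym centre satellite = refl
joined-sym leaf hub = refl
joined-sym leaf centre = refl
joined-sym leaf leaf = refl
joined-sym leaf satellite = refl
joined-sym satellite hub = refl
joined-sym satellite centre = refl
joined-sym satellite leaf = refl
joined-sym satellite satellite = refl

-- t hubs, c ≤ 1 centres, l leaves of the centre and s satellites of the hubs.
module Block (t c l s : ℕ) (c≤1 : c ≤ 1) where
  N : ℕ
  N = t + (c + (l + s))

  role₂ : Fin l ⊎ Fin s → Role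
  role₂ (inj₁ _) = leaf
  role₂ (inj₂ _) = satellite

  role₁ : Fin c ⊎ Fin (l + s) → Role
  role₁ (inj₁ _) = centre
  role₁ (inj₂ j) = role₂ (splitAt l j)

  role₀ : Fin t ⊎ Fin (c + (l + s)) → Role
  role₀ (inj₁ _) = hub
  role₀ (inj₂ j) = role₁ (splitAt c j)

  role : Fin N → Role
  role i = role₀ (splitAt t i)

  hubᵛ : Fin t → Fin N
  hubᵛ i = i ↑ˡ (c + (l + s))
  centreᵛ : Fin c → Fin N
  centreᵛ i = t ↑ʳ (i ↑ˡ (l + s))
  leafᵛ : Fin l → Fin N
  leafᵛ i = t ↑ʳ (c ↑ʳ (i ↑ˡ s))
  satelliteᵛ : Fin s → Fin N
  satelliteᵛ i = t ↑ʳ (c ↑ʳ (l ↑ʳ i))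

  role-hub : ∀ i → role (hubᵛ i) ≡ hub
  role-hub i rewrite splitAt-↑ˡ t i (c + (l + s)) = refl
  role-centre : ∀ i → role (centreᵛ i) ≡ centre
  role-centre i rewrite splitAt-↑ʳ t (c + (l + s)) (i ↑ˡ (l + s)) | splitAt-↑ˡ c i (l + s) = refl
  role-leaf : ∀ i → role (leafᵛ i) ≡ leaf
  role-leaf i rewrite splitAt-↑ʳ t (c + (l + s)) (c ↑ʳ (i ↑ˡ s)) | splitAt-↑ʳ c (l + s) (i ↑ˡ s) | splitAt-↑ˡ l i s = refl
  role-satellite : ∀ i → role (satelliteᵛ i) ≡ satellite
  role-satellite i rewrite splitAt-↑ʳ t (c + (l + s)) (c ↑ʳ (l ↑ʳ i)) | splitAt-↑ʳ c (l + s) (l ↑ʳ i) | splitAt-↑ʳ l s i = refl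

  hub⁻ : ∀ {v} → role v ≡ hub → ∃[ i ] v ≡ hubᵛ i
  hub⁻ {v} eq with splitAt t v in split
  ... | inj₁ i = i , sym (splitAt⁻¹-↑ˡ split)
  ... | inj₂ j with splitAt c j
  hub⁻ {v} () | inj₂ j | inj₁ _
  ... | inj₂ j′ with splitAt l j′
  hub⁻ {v} () | inj₂ j | inj₂ j′ | inj₁ _
  hub⁻ {v} () | inj₂ j | inj₂ j′ | inj₂ _

  centre⁻ : ∀ {v} → role v ≡ centre → ∃[ i ] v ≡ centreᵛ i
  centre⁻ {v} eq with splitAt t v in split
  centre⁻ {v} () | inj₁ i
  ... | inj₂ j with splitAt c j in split′
  ... | inj₁ i = i , sym (trans (cong (t ↑ʳ_) (splitAt⁻¹-↑ˡ split′)) (splitAt⁻¹-↑ʳ split))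
  ... | inj₂ j′ with splitAt l j′
  centre⁻ {v} () | inj₂ j | inj₂ j′ | inj₁ _
  centre⁻ {v} () | inj₂ j | inj₂ j′ | inj₂ _

  one-centre : ∀ {u v} → role u ≡ centre → role v ≡ centre → u ≡ v
  one-centre p q with centre⁻ p | centre⁻ q
  ... | i , refl | j , refl = cong centreᵛ (go c≤1 i j)
    where
    go : ∀ {c} → c ≤ 1 → (i j : Fin c) → i ≡ j
    go (s≤s z≤n) zero zero = refl

  G : Graph N
  G = record { adj = link ; sym = link-sym ; irrefl = link-irrefl }
    where
    link : Fin N → Fin N → Bool
    link u v with u ≟ᶠ v
    ... | yes _ = false
    ... | no  _ = joined (role u) (role v)
    link-sym : ∀ u v → link u v ≡ link v u
    link-sym u v with u ≟ᶠ v | v ≟ᶠ u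
    ... | yes _ | yes _ = refl
    ... | no  _ | no  _ = joined-sym (role u) (role v)
    ... | yes e | no ¬e = ⊥-elim (¬e (sym e))
    ... | no ¬e | yes e = ⊥-elim (¬e (sym e))
    link-irrefl : ∀ u → link u u ≡ false
    link-irrefl u with u ≟ᶠ u
    ... | yes _ = refl
    ... | no ¬e = ⊥-elim (¬e refl)

  edge⁻ : ∀ {u v} → Adjacent G u v → joined (role u) (role v) ≡ true
  edge⁻ {u} {v} e with u ≟ᶠ v
  ... | no _ = e

  edge⁺ : ∀ {u v} → u ≢ v → joined (role u) (role v) ≡ true → Adjacent G u v
  edge⁺ {u} {v} ne e with u ≟ᶠ v
  ... | yes eq = ⊥-elim (ne eq)
  ... | no _ = e

  open Walks (Adjacent G) (λ {u} {v} → adjacent-sym G {u} {v})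

  isHub : Role → ℕ
  isHub hub = 1
  isHub _ = 0

  hubs : List (Fin N) → ℕ
  hubs zs = sum (map (isHub ∘ role) zs)

  hubs≤t : ∀ {zs} → Unique zs → hubs zs ≤ t
  hubs≤t {zs} un = ≤-trans (≤-reflexive (count zs)) (≤-trans (length-⊆ (unique-filter hub? un) sub)
      (≤-reflexive (trans (length-map hubᵛ (allFin t)) (length-tabulate (λ i → i)))))
    where
    hub? : Decidable (λ v → role v ≡ hub)
    hub? v with role v
    ... | hub = yes refl
    ... | centre = no λ ()
    ... | leaf = no λ ()
    ... | satellite = no λ ()
    count : ∀ zs → hubs zs ≡ length (filter hub? zs)
    count [] = refl
    count (z ∷ zs) with role z
    ... | hub = cong suc (count zs)
    ... | centre = count zs
    ... | leaf = count zs
    ... | satellite = count zs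
    sub : ∀ {v} → v ∈ filter hub? zs → v ∈ map hubᵛ (allFin t)
    sub v∈ with hub⁻ (proj₂ (∈-filter⁻ hub? {xs = zs} v∈))
    ... | i , refl = ∈-map⁺ hubᵛ (∈-allFin i)

  NoCentre : List (Fin N) → Set
  NoCentre zs = ∀ {v} → v ∈ zs → role v ≢ centre

  -- Away from the centre every edge has a hub.
  hub-covered : ∀ {x y zs} → Walk x y zs → NoCentre zs → length zs ≤ 1 + 2 * hubs zs × (role x ≡ hub → length zs ≤ 2 * hubs zs)
  hub-covered {x} stop nc = s≤s z≤n , λ eq → ≤-trans (s≤s z≤n) (≤-reflexive (sym (cong (λ r → 2 * (isHub r + 0)) eq)))
  hub-covered {x} (step {z = z} {zs = zs} e p) nc with role x in rx | role z in rz | edge⁻ {x} {z} e | hub-covered p (nc ∘ there)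
  ... | centre | _ | _ | _ = ⊥-elim (nc (here refl) rx)
  ... | hub | _ | _ | any , _ = ≤-trans main (n≤1+n _) , λ _ → main
    where main : suc (length zs) ≤ 2 * suc (hubs zs)
          main = ≤-trans (s≤s any) (≤-reflexive (lemma (hubs zs)))
            where lemma : ∀ h → 2 + 2 * h ≡ 2 * suc h
                  lemma = solve-∀
  ... | leaf | centre | _ | _ = ⊥-elim (nc (there (first-∈ p)) rz)
  ... | leaf | hub | () | _
  ... | leaf | leaf | () | _
  ... | leaf | satellite | () | _
  ... | satellite | hub | _ | _ , start = s≤s (start refl) , λ ()
  ... | satellite | centre | () | _
  ... | satellite | leaf | () | _
  ... | satellite | satellite | () | _

  hub-step : ∀ {m h} → m ≤ 2 + 2 * h → suc m ≤ 1 + 2 * suc h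
  hub-step {h = h} le = ≤-trans (s≤s le) (≤-reflexive (lemma h))
    where lemma : ∀ h → 3 + 2 * h ≡ 1 + 2 * suc h
          lemma = solve-∀

  -- A path that enters the centre and then a leaf ends there.
  inner-start : ∀ {x y zs} → Walk x y zs → Unique zs →
                (role x ≢ leaf → length zs ≤ 2 + 2 * hubs zs) × (role x ≡ hub → length zs ≤ 1 + 2 * hubs zs)
  inner-start stop un = (λ _ → s≤s z≤n) , (λ _ → s≤s z≤n)
  inner-start {x} (step {z = z} {zs = zs} e p) un with role x in rx | role z in rz | edge⁻ {x} {z} e | inner-start p (tail-unique un)
  ... | leaf | _ | _ | _ = (λ ne → ⊥-elim (ne refl)) , λ ()
  ... | hub | leaf | () | _
  ... | hub | hub | _ | inner , _ = (λ _ → ≤-trans (hub-step (inner λ ())) (n≤1+n _)) , (λ _ → hub-step (inner λ ()))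
  ... | hub | centre | _ | inner , _ = (λ _ → ≤-trans (hub-step (inner λ ())) (n≤1+n _)) , (λ _ → hub-step (inner λ ()))
  ... | hub | satellite | _ | inner , _ = (λ _ → ≤-trans (hub-step (inner λ ())) (n≤1+n _)) , (λ _ → hub-step (inner λ ()))
  ... | centre | hub | _ | _ , start = (λ _ → s≤s (start refl)) , λ ()
  ... | satellite | hub | _ | _ , start = (λ _ → s≤s (start refl)) , λ ()
  ... | centre | centre | () | _
  ... | centre | satellite | () | _
  ... | satellite | centre | () | _
  ... | satellite | leaf | () | _
  ... | satellite | satellite | () | _
  ... | centre | leaf | _ | _ = (λ _ → dead-end p un rx rz) , λ ()
    where
    dead-end : ∀ {x z y zs h} → Walk z y zs → Unique (x ∷ zs) → role x ≡ centre → role z ≡ leaf → suc (length zs) ≤ 2 + h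
    dead-end stop _ _ _ = s≤s (s≤s z≤n)
    dead-end {z = z} (step {z = z′} f q) un rx rz with role z′ in rz′ | trans (sym (cong (λ r → joined r (role z′)) rz)) (edge⁻ {z} {z′} f)
    ... | centre | _ = ⊥-elim (head-∉ un (there (subst (_∈ _) (one-centre rz′ rx) (first-∈ q))))
    ... | hub | ()
    ... | leaf | ()
    ... | satellite | ()

  centreless-bound : (∀ v → role v ≢ centre) → PathFree G (1 + 2 * t)
  centreless-bound none p un = ≤-trans (proj₁ (hub-covered p (λ {v} _ → none v))) (s≤s (*-monoʳ-≤ 2 (hubs≤t un)))

  -- `inner-start` settles paths that do not start in a leaf. A path starting leaf, centre, hub
  -- spends two vertices before the hub, and the rest avoids the centre, so `hub-covered` allows it
  -- 2t more.
  path-bound : 1 ≤ t → PathFree G (2 + 2 * t)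
  path-bound 1≤t {x} p un with role x in rx
  ... | hub = ≤-trans (proj₁ (inner-start p un) (λ eq → case trans (sym rx) eq of λ ())) (+-monoʳ-≤ 2 (*-monoʳ-≤ 2 (hubs≤t un)))
  ... | centre = ≤-trans (proj₁ (inner-start p un) (λ eq → case trans (sym rx) eq of λ ())) (+-monoʳ-≤ 2 (*-monoʳ-≤ 2 (hubs≤t un)))
  ... | satellite = ≤-trans (proj₁ (inner-start p un) (λ eq → case trans (sym rx) eq of λ ())) (+-monoʳ-≤ 2 (*-monoʳ-≤ 2 (hubs≤t un)))
  path-bound 1≤t stop un | leaf = s≤s z≤n
  path-bound 1≤t {x} (step {z = z} e p) un | leaf with role z in rz | trans (sym (cong (λ r → joined r (role z)) rx)) (edge⁻ {x} {z} e)
  ... | hub | ()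
  ... | leaf | ()
  ... | satellite | ()
  ... | centre | _ with p
  ... | stop = s≤s (s≤s z≤n)
  ... | step {z = z′} {zs = zs} f q with role z′ in rz′ | trans (sym (cong (λ r → joined r (role z′)) rz)) (edge⁻ {z} {z′} f)
  ... | centre | ()
  ... | satellite | ()
  ... | hub | _ = s≤s (s≤s (≤-trans (proj₂ (hub-covered q fresh) rz′) (*-monoʳ-≤ 2 (hubs≤t (tail-unique (tail-unique un))))))
    where fresh : NoCentre zs
          fresh v∈ rv = head-∉ (tail-unique un) (subst (_∈ zs) (one-centre rv rz) v∈)
  ... | leaf | _ with q
  -- The path leaf, centre, leaf has 3 vertices, which fits because t ≥ 1.
  ... | stop = s≤s (s≤s (≤-trans 1≤t (m≤m+n t (t + 0))))
  ... | step {z = z″} g r with role z″ in rz″ | trans (sym (cong (λ r → joined r (role z″)) rz′)) (edge⁻ {z′} {z″} g)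
  ... | centre | _ = ⊥-elim (head-∉ (tail-unique un) (there (subst (_∈ _) (one-centre rz″ rz) (first-∈ r))))
  ... | hub | ()
  ... | leaf | ()
  ... | satellite | ()

  mapped : ∀ {m} → (Fin m → Fin N) → List (Fin N)
  mapped {m} f = map f (allFin m)

  mapped-length : ∀ {m} (f : Fin m → Fin N) → length (mapped f) ≡ m
  mapped-length {m} f = trans (length-map f (allFin m)) (length-tabulate (λ i → i))

  role-apart : ∀ {m m′} (f : Fin m → Fin N) (g : Fin m′ → Fin N) {r r′} → (∀ i → role (f i) ≡ r) → (∀ i → role (g i) ≡ r′) → r ≢ r′ →
               ∀ {v} → v ∈ mapped f → v ∉ mapped g
  role-apart f g p q ne v∈ v∈′ with ∈-map⁻ f v∈ | ∈-map⁻ g v∈′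
  ... | i , _ , eq | j , _ , eq′ = ne (trans (sym (p i)) (trans (cong role (trans (sym eq) eq′)) (q j)))

  hubs-unique : Unique (mapped hubᵛ)
  hubs-unique = unique-map (↑ˡ-injective (c + (l + s)) _ _) (allFin⁺ t)
  centres-unique : Unique (mapped centreᵛ)
  centres-unique = unique-map (↑ˡ-injective (l + s) _ _ ∘ ↑ʳ-injective t _ _) (allFin⁺ c)
  leaves-unique : Unique (mapped leafᵛ)
  leaves-unique = unique-map (↑ˡ-injective s _ _ ∘ ↑ʳ-injective c _ _ ∘ ↑ʳ-injective t _ _) (allFin⁺ l)
  satellites-unique : Unique (mapped satelliteᵛ)
  satellites-unique = unique-map (↑ʳ-injective l _ _ ∘ ↑ʳ-injective c _ _ ∘ ↑ʳ-injective t _ _) (allFin⁺ s)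

  Rich : ℕ → Fin N → Set
  Rich d v = ∃[ us ] Unique us × d ≤ length us × (∀ {u} → u ∈ us → Adjacent G v u)

  hub-rich : ∀ {d} → suc d ≤ t + (c + s) → ∀ {v} → v ∈ mapped hubᵛ → Rich d v
  hub-rich {d} d< {v} v∈ = others ++ mapped centreᵛ ++ mapped satelliteᵛ ,
      unique-++ (unique-filter other? hubs-unique)
        (unique-++ centres-unique satellites-unique (role-apart centreᵛ satelliteᵛ role-centre role-satellite λ ()))
        (λ p q → [ role-apart hubᵛ centreᵛ role-hub role-centre (λ ()) (proj₁ (∈-filter⁻ other? {xs = mapped hubᵛ} p))
                 , role-apart hubᵛ satelliteᵛ role-hub role-satellite (λ ()) (proj₁ (∈-filter⁻ other? {xs = mapped hubᵛ} p)) ]′ (∈-++⁻ (mapped centreᵛ) q)) ,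
      ≤-pred (≤-trans d< (≤-trans (+-monoˡ-≤ (c + s) t≤) (≤-reflexive (cong suc (sym total))))) , adjs
    where
    other? : Decidable (λ u → ¬ u ≡ v)
    other? u = ¬? (u ≟ᶠ v)
    others = filter other? (mapped hubᵛ)
    t≤ : t ≤ suc (length others)
    t≤ = ≤-trans (≤-reflexive (sym (mapped-length hubᵛ))) (length-⊆ hubs-unique split)
      where
      split : ∀ {u} → u ∈ mapped hubᵛ → u ∈ v ∷ others
      split {u} u∈ with u ≟ᶠ v
      ... | yes eq = here eq
      ... | no ne = there (∈-filter⁺ other? u∈ ne)
    total : length (others ++ mapped centreᵛ ++ mapped satelliteᵛ) ≡ length others + (c + s)
    total = trans (length-++ others) (cong (length others +_) (trans (length-++ (mapped centreᵛ)) (cong₂ _+_ (mapped-length centreᵛ) (mapped-length satelliteᵛ))))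
    rv : role v ≡ hub
    rv with ∈-map⁻ hubᵛ v∈
    ... | i , _ , refl = role-hub i
    link : ∀ {u r} → role u ≡ r → joined hub r ≡ true → u ≢ v → Adjacent G v u
    link {u} ru e ne = edge⁺ (ne ∘ sym) (trans (cong₂ joined rv ru) e)
    adjs : ∀ {u} → u ∈ others ++ mapped centreᵛ ++ mapped satelliteᵛ → Adjacent G v u
    adjs u∈ with ∈-++⁻ others u∈
    ... | inj₁ p with ∈-filter⁻ other? {xs = mapped hubᵛ} p
    ... | p′ , ne with ∈-map⁻ hubᵛ p′
    ... | i , _ , refl = link (role-hub i) refl ne
    adjs u∈ | inj₂ p with ∈-++⁻ (mapped centreᵛ) p
    ... | inj₁ q = let i , _ , eq = ∈-map⁻ centreᵛ q in link (trans (cong role eq) (role-centre i)) refl λ { refl → role-apart hubᵛ centreᵛ role-hub role-centre (λ ()) v∈ q }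
    ... | inj₂ q = let i , _ , eq = ∈-map⁻ satelliteᵛ q in link (trans (cong role eq) (role-satellite i)) refl λ { refl → role-apart hubᵛ satelliteᵛ role-hub role-satellite (λ ()) v∈ q }

  centre-rich : ∀ {d} → d ≤ t + l → ∀ i → Rich d (centreᵛ i)
  centre-rich {d} d≤ i = mapped hubᵛ ++ mapped leafᵛ ,
      unique-++ hubs-unique leaves-unique (role-apart hubᵛ leafᵛ role-hub role-leaf λ ()) ,
      ≤-trans d≤ (≤-reflexive (sym (trans (length-++ (mapped hubᵛ)) (cong₂ _+_ (mapped-length hubᵛ) (mapped-length leafᵛ))))) , adjs
    where
    adjs : ∀ {u} → u ∈ mapped hubᵛ ++ mapped leafᵛ → Adjacent G (centreᵛ i) u
    adjs u∈ with ∈-++⁻ (mapped hubᵛ) u∈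
    ... | inj₁ p with ∈-map⁻ hubᵛ p
    ... | j , _ , refl = edge⁺ (λ eq → case trans (sym (role-centre i)) (trans (cong role eq) (role-hub j)) of λ ()) (cong₂ joined (role-centre i) (role-hub j))
    adjs u∈ | inj₂ p with ∈-map⁻ leafᵛ p
    ... | j , _ , refl = edge⁺ (λ eq → case trans (sym (role-centre i)) (trans (cong role eq) (role-leaf j)) of λ ()) (cong₂ joined (role-centre i) (role-leaf j))

weaken : ∀ {n k k′} {G : Graph n} → k ≤ k′ → PathFree G k → PathFree G k′
weaken le free p un = ≤-trans (free p un) le

-- With d + 1 - t satellites, each hub is joined to all d other vertices of the block.
hub-block : ∀ {d k t} → t ≤ d → 1 + 2 * t ≤ k → Extremal d k (suc d) t
hub-block {d} {k} {t} t≤d t<k = subst (λ n → Extremal d k n t) (m+[n∸m]≡n (≤-trans t≤d (n≤1+n d))) (record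
  { graph = G ; free = weaken {G = G} t<k (centreless-bound none)
  ; highs = mapped hubᵛ ; distinct = hubs-unique ; count = mapped-length hubᵛ
  ; neighbours = hub-rich (≤-reflexive (sym (m+[n∸m]≡n (≤-trans t≤d (n≤1+n d))))) })
  where
  open Block t 0 0 (suc d ∸ t) z≤n
  none : ∀ v → role v ≢ centre
  none v eq with centre⁻ {v} eq
  ... | () , _

-- The centre sees t hubs and d - t leaves; a hub sees t - 1 hubs, the centre and d - t satellites.
-- Both counts are d.
centred-block : ∀ {d k t} → 1 ≤ t → t ≤ d → 2 + 2 * t ≤ k → Extremal d k (t + (1 + ((d ∸ t) + (d ∸ t)))) (suc t)
centred-block {d} {k} {t} 1≤t t≤d t<k = record
  { graph = G ; free = weaken {G = G} t<k (path-bound 1≤t)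
  ; highs = centreᵛ zero ∷ mapped hubᵛ
  ; distinct = (λ p → role-apart hubᵛ centreᵛ role-hub role-centre (λ ()) p (here refl)) ∷ᵘ hubs-unique
  ; count = cong suc (mapped-length hubᵛ)
  ; neighbours = λ { (here refl) → centre-rich (≤-reflexive (sym (m+[n∸m]≡n t≤d))) zero
                   ; (there v∈) → hub-rich (≤-reflexive (sym (trans (+-suc t (d ∸ t)) (cong suc (m+[n∸m]≡n t≤d))))) v∈ } }
  where open Block t 1 (d ∸ t) (d ∸ t) (s≤s z≤n)

-- The values of φ

below : ∀ {d k n n′ h φ} → Extremal d k n′ h → n′ ≡ n → φ ≤ suc h → ∀ m → m < φ → ¬ Forces n d k m
below E refl φ≤ m m<φ = not-forced E (≤-pred (≤-trans m<φ φ≤))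

module _ {n d k : ℕ} (1≤k : 1 ≤ k) (k≤d : k ≤ d) (d<n : d < n) where

  hub-blocks : ∀ {t} q r → 1 + 2 * t ≤ k → Extremal d k (q * suc d + r) (q * t + 0)
  hub-blocks {t} q r t<k = disjointUnion (copies 1≤k q (hub-block t≤d t<k)) (empty r 1≤k)
    where
    t≤d : t ≤ d
    t≤d = ≤-trans (≤-trans (m≤m+n t (t + 0)) (n≤1+n _)) (≤-trans t<k k≤d)

  odd-case : ∀ t q r → k ≡ 1 + 2 * t → n ≡ q * suc d + r → r ≤ d → IsPhi n d k (t * q + 1)
  odd-case t q r k≡ n≡ r≤d = forces k≤d (odd {t = t} k≡′) (λ b → odd-bound b k≡′ q r n≡ r≤d) ,
    below (hub-blocks q r (≤-reflexive (sym k≡))) (sym n≡) (≤-reflexive (lemma t q))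
    where
    k≡′ : k ≡ 1 + (t + t)
    k≡′ = trans k≡ (cong (λ z → suc (t + z)) (+-identityʳ t))
    lemma : ∀ t q → t * q + 1 ≡ suc (q * t + 0)
    lemma = solve-∀

  four-case : ∀ q r → k ≡ 4 → n ≡ 2 * q * d + r → r < 2 * d →
              (r ≤ d → IsPhi n d k (2 * q + 1)) × (d < r → IsPhi n d k (2 * q + 2))
  four-case q r refl n≡ r<2d = small , large
    where
    1≤d : 1 ≤ d
    1≤d = ≤-trans 1≤k k≤d
    -- For t = 1 the centred block is a double star on 2d vertices.
    stars : Extremal d 4 (q * (1 + (1 + ((d ∸ 1) + (d ∸ 1))))) (q * 2)
    stars = copies 1≤k q (centred-block ≤-refl 1≤d ≤-refl)
    size : ∀ d → 1 ≤ d → q * (1 + (1 + ((d ∸ 1) + (d ∸ 1)))) ≡ 2 * q * d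
    size (suc e) _ = lemma q e
      where lemma : ∀ q e → q * (1 + (1 + (e + e))) ≡ 2 * q * suc e
            lemma = solve-∀
    small : r ≤ d → IsPhi n d 4 (2 * q + 1)
    small r≤d = forces k≤d (even {t = 1} refl)
        (λ b → ≤-trans (s≤s ([ (λ le → le) , (λ p → ⊥-elim (<⇒≱ (proj₂ p) r≤d)) ]′ (four-bound b 1≤d q r n≡ r<2d))) (≤-reflexive (+-comm 1 _))) ,
      below (disjointUnion stars (empty r 1≤k)) (trans (cong (_+ r) (size d 1≤d)) (sym n≡)) (≤-reflexive (lemma q))
      where lemma : ∀ q → 2 * q + 1 ≡ suc (q * 2 + 0)
            lemma = solve-∀
    large : d < r → IsPhi n d 4 (2 * q + 2)
    large d<r = forces k≤d (even {t = 1} refl)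
        (λ b → ≤-trans (s≤s ([ (λ le → ≤-trans le (m≤m+n _ 1)) , proj₁ ]′ (four-bound b 1≤d q r n≡ r<2d))) (≤-reflexive (sym (+-suc (2 * q) 1)))) ,
      -- A star on d + 1 of the r > d remaining vertices adds one more high vertex.
      below (disjointUnion stars (disjointUnion (hub-block 1≤d (s≤s (s≤s (s≤s z≤n)))) (empty (r ∸ suc d) 1≤k)))
        (trans (cong₂ _+_ (size d 1≤d) (m+[n∸m]≡n d<r)) (sym n≡)) (≤-reflexive (lemma q))
      where
      lemma : ∀ q → 2 * q + 2 ≡ suc (q * 2 + (1 + 0))
      lemma = solve-∀

  even-case : ∀ t q r → k ≡ 2 * t + 2 → 2 ≤ t → n ≡ q * suc d + r → r ≤ d →
              (r + (t + 1) ≤ d → IsPhi n d k (t * q + 1)) × (d < r + (t + 1) → IsPhi n d k (t * q + 2))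
  even-case t q r k≡ 2≤t n≡ r≤d = small , large
    where
    k≡′ : k ≡ 2 + (t + t)
    k≡′ = trans k≡ (lemma t)
      where lemma : ∀ t → 2 * t + 2 ≡ 2 + (t + t)
            lemma = solve-∀
    k≡″ : 2 + 2 * t ≡ k
    k≡″ = trans (+-comm 2 (2 * t)) (sym k≡)
    2t<d : suc (t + t) ≤ d
    2t<d = ≤-trans (n≤1+n _) (≤-trans (≤-reflexive (sym k≡′)) k≤d)
    t≤d : t ≤ d
    t≤d = ≤-trans (≤-trans (m≤m+n t t) (n≤1+n _)) 2t<d
    small : r + (t + 1) ≤ d → IsPhi n d k (t * q + 1)
    small r≤ = forces k≤d (even {t = t} k≡′)
        (λ b → ≤-trans (s≤s ([ (λ le → le) , (λ p → ⊥-elim (<⇒≱ (proj₂ p) r≤)) ]′ (even-bound b 2≤t 2t<d q r n≡ r≤d))) (≤-reflexive (+-comm 1 _))) ,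
      below (hub-blocks q r (≤-trans (n≤1+n _) (≤-reflexive k≡″))) (sym n≡) (≤-reflexive (lemma t q))
      where lemma : ∀ t q → t * q + 1 ≡ suc (q * t + 0)
            lemma = solve-∀
    -- One of the q hub blocks is enlarged by d - t of the r spare vertices to a centred block.
    -- There is such a block since r ≤ d < n excludes q = 0.
    mixed : ∀ q → n ≡ q * suc d + r → d < r + (t + 1) → ∀ m → m < t * q + 2 → ¬ Forces n d k m
    mixed zero n≡ _ = ⊥-elim (<⇒≱ d<n (≤-trans (≤-reflexive n≡) r≤d))
    mixed (suc q) n≡ d< = below
        (disjointUnion (copies 1≤k q (hub-block t≤d (≤-trans (n≤1+n _) (≤-reflexive k≡″))))
          (disjointUnion (centred-block (≤-trans (s≤s z≤n) 2≤t) t≤d (≤-reflexive k≡″)) (empty (r ∸ (d ∸ t)) 1≤k)))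
        (trans (cong (q * suc d +_) size) (trans (lemma (q * suc d) d r) (sym n≡))) (≤-reflexive (lemma′ t q))
      where
      e = d ∸ t
      e≤r : e ≤ r
      e≤r = m≤n+o⇒m∸n≤o d t (≤-pred (≤-trans d< (≤-reflexive (swap′ r t))))
        where swap′ : ∀ r t → r + (t + 1) ≡ suc (t + r)
              swap′ = solve-∀
      size : t + (1 + (e + e)) + (r ∸ e) ≡ suc d + r
      size = trans (shuffle t e (r ∸ e)) (cong₂ (λ x y → suc x + y) (m+[n∸m]≡n t≤d) (m+[n∸m]≡n e≤r))
        where
        shuffle : ∀ t e x → t + (1 + (e + e)) + x ≡ suc (t + e) + (e + x)
        shuffle = solve-∀
      lemma : ∀ x d r → x + (suc d + r) ≡ suc d + x + r
      lemma = solve-∀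
      lemma′ : ∀ t q → t * suc q + 2 ≡ suc (q * t + (suc t + 0))
      lemma′ = solve-∀
    large : d < r + (t + 1) → IsPhi n d k (t * q + 2)
    large d< = forces k≤d (even {t = t} k≡′)
        (λ b → ≤-trans (s≤s ([ (λ le → ≤-trans le (m≤m+n _ 1)) , proj₁ ]′ (even-bound b 2≤t 2t<d q r n≡ r≤d))) (≤-reflexive (sym (+-suc (t * q) 1)))) ,
      mixed q n≡ d<

theorem1p3 : ∀ (n d k : ℕ) → 1 ≤ k → k ≤ d → d < n →
    (∀ (t q r : ℕ) → k ≡ 1 + 2 * t → n ≡ q * suc d + r → r ≤ d →
    IsPhi n d k (t * q + 1))
    × (k ≡ 2 → IsPhi n d k 1)
    × (∀ (q r : ℕ) → k ≡ 4 → n ≡ 2 * q * d + r → r < 2 * d →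
    (r ≤ d → IsPhi n d k (2 * q + 1)) × (d < r → IsPhi n d k (2 * q + 2)))
    × (∀ (t q r : ℕ) → k ≡ 2 * t + 2 → 2 ≤ t → n ≡ q * suc d + r → r ≤ d →
    (r + (t + 1) ≤ d → IsPhi n d k (t * q + 1))
    × (d < r + (t + 1) → IsPhi n d k (t * q + 2)))
theorem1p3 n d k 1≤k k≤d d<n =
  odd-case 1≤k k≤d d<n ,
  (λ { refl → forces-k=2 k≤d , below (empty n 1≤k) refl (s≤s z≤n) }) ,
  four-case 1≤k k≤d d<n ,
  even-case 1≤k k≤d d<n
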